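{- There exist a one-variable polynomial $P$ and a two-variable polynomial $R$ (both absolute) such that the following holds. Let $p\in(0,1)$ and let $n$ be a positive integer such that $pn$ is an integer, and let $D_p$ be the uniform distribution on all $x\in\{\pm1\}^n$ with $\sum_{i=1}^n x_i=(1-2p)n$. Then for every multilinear polynomial $f$ of degree $d$ in $x_1,\dots,x_n$, $$\mathbb E_{x\sim D_p}[f(x)^4]\le P(d)\cdot C_p^{\,d}\cdot\Big(\mathbb E_{x\sim D_p}[f(x)^2]\Big)^2,\qquad C_p=R\Big(\tfrac1{1-p},\tfrac1p\Big).$$
   Context: All polynomials have real coefficients. In the source the bound is written $\mathrm{poly}(d)\cdot C_p^d$ with $C_p=\mathrm{poly}(\frac1{1-p},\frac1p)$; $P$ and $R$ make these two "poly" expressions explicit. -}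

module Defs where

open import Data.Bool using (true; false)
open import Data.Fin.Subset using (Subset; inside; outside; ∣_∣)
import Data.Integer as ℤ
open import Data.List using (List; []; _∷_; foldr; map; filter; length; cartesianProductWith)
open import Data.Nat as ℕ using (ℕ; zero; suc; _⊔_)
import Data.Nat.Properties as ℕₚ
open import Data.Product using (∃-syntax; _×_; _,_)
open import Data.Rational as ℚ using (ℚ; 0ℚ; 1ℚ; ½; Positive; NonNegative; positive; nonNegative; 1/_)
import Data.Rational.Properties as ℚₚ
open import Data.Rational.Solver using (module +-*-Solver)
open import Data.Sign as Sign using (Sign)
open import Data.Vec as Vec using (Vec; []; _∷_)
open import Relation.Binary.PropositionalEquality

-- ℝ is the Cauchy completion of ℚ, with ≃ as its equality.

∣_∣ℚ : ℚ → ℚ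
∣_∣ℚ = ℚ.∣_∣

Cauchy : (ℕ → ℚ) → Set
Cauchy x = ∀ ε → 0ℚ ℚ.< ε →
  ∃[ N ] (∀ m n → N ℕ.≤ m → N ℕ.≤ n → ∣ x m ℚ.- x n ∣ℚ ℚ.≤ ε)

record ℝ : Set where
  constructor mkℝ
  field
    seq    : ℕ → ℚ
    cauchy : Cauchy seq

open ℝ public

infix  4 _≃_ _≤_
infixl 6 _+_
infixl 7 _*_
infixr 8 _^_

_≃_ : ℝ → ℝ → Set
x ≃ y = ∀ ε → 0ℚ ℚ.< ε →
  ∃[ N ] (∀ n → N ℕ.≤ n → ∣ seq x n ℚ.- seq y n ∣ℚ ℚ.≤ ε)

-- The slack ε makes this the non-strict order on the completion; it does not
-- depend on the representing sequences.
_≤_ : ℝ → ℝ → Set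
x ≤ y = ∀ ε → 0ℚ ℚ.< ε →
  ∃[ N ] (∀ n → N ℕ.≤ n → seq x n ℚ.≤ seq y n ℚ.+ ε)

fromℚ : ℚ → ℝ
fromℚ q = mkℝ (λ _ → q) λ ε 0<ε → 0 , λ _ _ _ _ →
  subst (λ t → ∣ t ∣ℚ ℚ.≤ ε) (sym (ℚₚ.+-inverseʳ q)) (ℚₚ.<⇒≤ 0<ε)

fromℕ : ℕ → ℝ
fromℕ n = fromℚ (ℤ.+ n ℚ./ 1)

0ℝ 1ℝ : ℝ
0ℝ = fromℚ 0ℚ
1ℝ = fromℚ 1ℚ

private
  half-pos : ∀ {ε} → 0ℚ ℚ.< ε → 0ℚ ℚ.< ε ℚ.* ½
  half-pos {ε} 0<ε = ℚₚ.positive⁻¹ (ε ℚ.* ½) {{ℚₚ.pos*pos⇒pos ε {{positive 0<ε}} ½}}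

  half+half : ∀ ε → ε ℚ.* ½ ℚ.+ ε ℚ.* ½ ≡ ε
  half+half ε = trans (sym (ℚₚ.*-distribˡ-+ ε ½ ½)) (ℚₚ.*-identityʳ ε)

  sum-diff : ∀ a b c d → (a ℚ.+ b) ℚ.- (c ℚ.+ d) ≡ (a ℚ.- c) ℚ.+ (b ℚ.- d)
  sum-diff = solve 4 (λ a b c d → (a :+ b) :- (c :+ d) := (a :- c) :+ (b :- d)) refl
    where open +-*-Solver

  product-diff : ∀ a b c d → a ℚ.* b ℚ.- c ℚ.* d ≡ a ℚ.* (b ℚ.- d) ℚ.+ d ℚ.* (a ℚ.- c)
  product-diff = solve 4 (λ a b c d → a :* b :- c :* d := a :* (b :- d) :+ d :* (a :- c)) refl
    where open +-*-Solver

  cancel : ∀ a b → (a ℚ.- b) ℚ.+ b ≡ a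
  cancel = solve 2 (λ a b → (a :- b) :+ b := a) refl
    where open +-*-Solver

  +-cauchy : ∀ {x y} → Cauchy x → Cauchy y → Cauchy (λ n → x n ℚ.+ y n)
  +-cauchy {x} {y} cx cy ε 0<ε with cx (ε ℚ.* ½) (half-pos 0<ε) | cy (ε ℚ.* ½) (half-pos 0<ε)
  ... | M , hx | N , hy = M ⊔ N , λ m n M⊔N≤m M⊔N≤n → begin
    ∣ (x m ℚ.+ y m) ℚ.- (x n ℚ.+ y n) ∣ℚ    ≡⟨ cong ∣_∣ℚ (sum-diff (x m) (y m) (x n) (y n)) ⟩
    ∣ (x m ℚ.- x n) ℚ.+ (y m ℚ.- y n) ∣ℚ    ≤⟨ ℚₚ.∣p+q∣≤∣p∣+∣q∣ (x m ℚ.- x n) (y m ℚ.- y n) ⟩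
    ∣ x m ℚ.- x n ∣ℚ ℚ.+ ∣ y m ℚ.- y n ∣ℚ   ≤⟨ ℚₚ.+-mono-≤
      (hx m n (ℕₚ.m⊔n≤o⇒m≤o M N M⊔N≤m) (ℕₚ.m⊔n≤o⇒m≤o M N M⊔N≤n))
      (hy m n (ℕₚ.m⊔n≤o⇒n≤o M N M⊔N≤m) (ℕₚ.m⊔n≤o⇒n≤o M N M⊔N≤n)) ⟩
    ε ℚ.* ½ ℚ.+ ε ℚ.* ½                     ≡⟨ half+half ε ⟩
    ε                                       ∎
    where open ℚₚ.≤-Reasoning

  Bound : (ℕ → ℚ) → ℚ → ℕ → Set
  Bound x B N = ∀ n → N ℕ.≤ n → ∣ x n ∣ℚ ℚ.≤ B

  eventually-bounded : ∀ {x} → Cauchy x → ∃[ B ] ∃[ N ] (0ℚ ℚ.< B × Bound x B N)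
  eventually-bounded {x} cx with cx 1ℚ (ℚₚ.positive⁻¹ 1ℚ)
  ... | N , h = 1ℚ ℚ.+ ∣ x N ∣ℚ , N
    , ℚₚ.+-mono-<-≤ (ℚₚ.positive⁻¹ 1ℚ) (ℚₚ.0≤∣p∣ (x N))
    , λ n N≤n → begin
      ∣ x n ∣ℚ                        ≡⟨ cong ∣_∣ℚ (sym (cancel (x n) (x N))) ⟩
      ∣ (x n ℚ.- x N) ℚ.+ x N ∣ℚ      ≤⟨ ℚₚ.∣p+q∣≤∣p∣+∣q∣ (x n ℚ.- x N) (x N) ⟩
      ∣ x n ℚ.- x N ∣ℚ ℚ.+ ∣ x N ∣ℚ   ≤⟨ ℚₚ.+-monoˡ-≤ ∣ x N ∣ℚ (h n N N≤n ℕₚ.≤-refl) ⟩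
      1ℚ ℚ.+ ∣ x N ∣ℚ                 ∎
    where open ℚₚ.≤-Reasoning

  scaled-bound : ∀ {B ε} → 0ℚ ℚ.< B → 0ℚ ℚ.< ε →
    ∃[ δ ] (0ℚ ℚ.< δ × B ℚ.* δ ≡ ε)
  scaled-bound {B} {ε} 0<B 0<ε = δ , 0<δ , (begin
    B ℚ.* (B⁻¹ ℚ.* ε)   ≡⟨ sym (ℚₚ.*-assoc B B⁻¹ ε) ⟩
    (B ℚ.* B⁻¹) ℚ.* ε   ≡⟨ cong (ℚ._* ε) (ℚₚ.*-inverseʳ B {{ℚₚ.pos⇒nonZero B {{positive 0<B}}}}) ⟩
    1ℚ ℚ.* ε            ≡⟨ ℚₚ.*-identityˡ ε ⟩
    ε                   ∎)
    where
    open ≡-Reasoning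
    B⁻¹ δ : ℚ
    B⁻¹ = (1/ B) {{ℚₚ.pos⇒nonZero B {{positive 0<B}}}}
    δ = B⁻¹ ℚ.* ε
    0<δ : 0ℚ ℚ.< δ
    0<δ = ℚₚ.positive⁻¹ δ {{ℚₚ.pos*pos⇒pos B⁻¹ {{ℚₚ.1/pos⇒pos B {{positive 0<B}}}} ε {{positive 0<ε}}}}

  ∣*∣-bound : ∀ a b {A B} → 0ℚ ℚ.< A → ∣ a ∣ℚ ℚ.≤ A → ∣ b ∣ℚ ℚ.≤ B → ∣ a ℚ.* b ∣ℚ ℚ.≤ A ℚ.* B
  ∣*∣-bound a b {A} {B} 0<A a≤A b≤B = begin
    ∣ a ℚ.* b ∣ℚ         ≡⟨ ℚₚ.∣p*q∣≡∣p∣*∣q∣ a b ⟩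
    ∣ a ∣ℚ ℚ.* ∣ b ∣ℚ    ≤⟨ ℚₚ.*-monoʳ-≤-nonNeg ∣ b ∣ℚ {{ℚₚ.∣-∣-nonNeg b}} a≤A ⟩
    A ℚ.* ∣ b ∣ℚ         ≤⟨ ℚₚ.*-monoˡ-≤-nonNeg A {{nonNegative (ℚₚ.<⇒≤ 0<A)}} b≤B ⟩
    A ℚ.* B              ∎
    where open ℚₚ.≤-Reasoning

  product-close : ∀ a b c d A B δ → 0ℚ ℚ.< A → 0ℚ ℚ.< B →
    ∣ a ∣ℚ ℚ.≤ A → ∣ d ∣ℚ ℚ.≤ B → ∣ b ℚ.- d ∣ℚ ℚ.≤ δ → ∣ a ℚ.- c ∣ℚ ℚ.≤ δ →
    ∣ a ℚ.* b ℚ.- c ℚ.* d ∣ℚ ℚ.≤ (A ℚ.+ B) ℚ.* δ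
  product-close a b c d A B δ 0<A 0<B a≤A d≤B b-d≤δ a-c≤δ = begin
    ∣ a ℚ.* b ℚ.- c ℚ.* d ∣ℚ
      ≡⟨ cong ∣_∣ℚ (product-diff a b c d) ⟩
    ∣ a ℚ.* (b ℚ.- d) ℚ.+ d ℚ.* (a ℚ.- c) ∣ℚ
      ≤⟨ ℚₚ.∣p+q∣≤∣p∣+∣q∣ (a ℚ.* (b ℚ.- d)) (d ℚ.* (a ℚ.- c)) ⟩
    ∣ a ℚ.* (b ℚ.- d) ∣ℚ ℚ.+ ∣ d ℚ.* (a ℚ.- c) ∣ℚ
      ≤⟨ ℚₚ.+-mono-≤
           (∣*∣-bound a (b ℚ.- d) 0<A a≤A b-d≤δ)
           (∣*∣-bound d (a ℚ.- c) 0<B d≤B a-c≤δ) ⟩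
    A ℚ.* δ ℚ.+ B ℚ.* δ
      ≡⟨ sym (ℚₚ.*-distribʳ-+ δ A B) ⟩
    (A ℚ.+ B) ℚ.* δ ∎
    where open ℚₚ.≤-Reasoning

  *-cauchy : ∀ {x y} → Cauchy x → Cauchy y → Cauchy (λ n → x n ℚ.* y n)
  *-cauchy {x} {y} cx cy ε 0<ε =
    let A , K , 0<A , bx    = eventually-bounded {x} cx
        B , L , 0<B , by    = eventually-bounded {y} cy
        δ , 0<δ , A+B*δ≡ε   = scaled-bound {A ℚ.+ B} {ε} (ℚₚ.+-mono-< 0<A 0<B) 0<ε
        M , hx              = cx δ 0<δ
        N , hy              = cy δ 0<δ
        ≤K : ∀ {m} → (K ⊔ L) ⊔ (M ⊔ N) ℕ.≤ m → K ℕ.≤ m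
        ≤K = ℕₚ.≤-trans (ℕₚ.≤-trans (ℕₚ.m≤m⊔n K L) (ℕₚ.m≤m⊔n (K ⊔ L) (M ⊔ N)))
        ≤L : ∀ {m} → (K ⊔ L) ⊔ (M ⊔ N) ℕ.≤ m → L ℕ.≤ m
        ≤L = ℕₚ.≤-trans (ℕₚ.≤-trans (ℕₚ.m≤n⊔m K L) (ℕₚ.m≤m⊔n (K ⊔ L) (M ⊔ N)))
        ≤M : ∀ {m} → (K ⊔ L) ⊔ (M ⊔ N) ℕ.≤ m → M ℕ.≤ m
        ≤M = ℕₚ.≤-trans (ℕₚ.≤-trans (ℕₚ.m≤m⊔n M N) (ℕₚ.m≤n⊔m (K ⊔ L) (M ⊔ N)))
        ≤N : ∀ {m} → (K ⊔ L) ⊔ (M ⊔ N) ℕ.≤ m → N ℕ.≤ m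
        ≤N = ℕₚ.≤-trans (ℕₚ.≤-trans (ℕₚ.m≤n⊔m M N) (ℕₚ.m≤n⊔m (K ⊔ L) (M ⊔ N)))
    in (K ⊔ L) ⊔ (M ⊔ N) , λ m n m≥ n≥ →
      subst (∣ x m ℚ.* y m ℚ.- x n ℚ.* y n ∣ℚ ℚ.≤_) A+B*δ≡ε
        (product-close (x m) (y m) (x n) (y n) A B δ 0<A 0<B
          (bx m (≤K m≥)) (by n (≤L n≥))
          (hy m n (≤N m≥) (≤N n≥)) (hx m n (≤M m≥) (≤M n≥)))

_+_ : ℝ → ℝ → ℝ
x + y = mkℝ (λ n → seq x n ℚ.+ seq y n) (+-cauchy {seq x} {seq y} (cauchy x) (cauchy y))

_*_ : ℝ → ℝ → ℝ
x * y = mkℝ (λ n → seq x n ℚ.* seq y n) (*-cauchy {seq x} {seq y} (cauchy x) (cauchy y))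

_^_ : ℝ → ℕ → ℝ
x ^ zero  = 1ℝ
x ^ suc n = x * x ^ n

sumℝ : List ℝ → ℝ
sumℝ = foldr _+_ 0ℝ

-- Coefficient lists, constant term first.
Poly₁ : Set
Poly₁ = List ℝ

eval₁ : Poly₁ → ℝ → ℝ
eval₁ P t = foldr (λ a r → a + t * r) 0ℝ P

-- ℝ[t][s]: the i-th entry is the coefficient (a polynomial in t) of sⁱ.
Poly₂ : Set
Poly₂ = List Poly₁

eval₂ : Poly₂ → ℝ → ℝ → ℝ
eval₂ R s t = eval₁ (map (λ Q → eval₁ Q t) R) s

vectors : ∀ {A : Set} → List A → ∀ n → List (Vec A n)
vectors as zero    = [] ∷ []
vectors as (suc n) = cartesianProductWith _∷_ as (vectors as n)

subsets : ∀ n → List (Subset n)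
subsets = vectors (outside ∷ inside ∷ [])

-- f S is the coefficient of ∏_{i ∈ S} xᵢ.
Multilinear : ℕ → Set
Multilinear n = Subset n → ℝ

monomial : ∀ {n} → Subset n → Vec ℝ n → ℝ
monomial []          []       = 1ℝ
monomial (true  ∷ S) (x ∷ xs) = x * monomial S xs
monomial (false ∷ S) (x ∷ xs) = monomial S xs

evalML : ∀ {n} → Multilinear n → Vec ℝ n → ℝ
evalML {n} f x = sumℝ (map (λ S → f S * monomial S x) (subsets n))

-- deg f ≤ d.  The exact degree of a real polynomial is not computable, and a
-- bound under deg f ≤ d includes the case deg f = d (and f = 0).
DegreeAtMost : ∀ {n} → ℕ → Multilinear n → Set
DegreeAtMost {n} d f = ∀ (S : Subset n) → d ℕ.< ∣ S ∣ → f S ≃ 0ℝ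

±1 : Sign → ℚ
±1 Sign.+ = 1ℚ
±1 Sign.- = ℚ.- 1ℚ

cube : ∀ n → List (Vec Sign n)
cube = vectors (Sign.+ ∷ Sign.- ∷ [])

coordinateSum : ∀ {n} → Vec Sign n → ℚ
coordinateSum x = Vec.foldr′ ℚ._+_ 0ℚ (Vec.map ±1 x)

-- A rational p suffices: if p n is an integer and n > 0 then p is rational.
slice : ℚ → ∀ n → List (Vec Sign n)
slice p n = filter (λ x → coordinateSum x ℚₚ.≟ (1ℚ ℚ.- (ℤ.+ 2 ℚ./ 1) ℚ.* p) ℚ.* (ℤ.+ n ℚ./ 1)) (cube n)

-- Average over a list.  The value on [] is a convention; slice p n is nonempty
-- when 0 < p < 1 and p n is an integer, having the points with p n entries −1.
mean : ∀ {A : Set} → List A → (A → ℝ) → ℝ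
mean []          g = 0ℝ
mean xs@(_ ∷ ys) g = fromℚ (ℤ.+ 1 ℚ./ suc (length ys)) * sumℝ (map g xs)

𝔼 : ∀ (p : ℚ) {n} → (Vec ℝ n → ℝ) → ℝ
𝔼 p {n} g = mean (slice p n) (λ x → g (Vec.map (λ s → fromℚ (±1 s)) x))

-- R (1 / (1 − p), 1 / p)
C : Poly₂ → (p : ℚ) → 0ℚ ℚ.< p → p ℚ.< 1ℚ → ℝ
C R p 0<p p<1 = eval₂ R
  (fromℚ ((1/ (1ℚ ℚ.- p)) {{ℚₚ.pos⇒nonZero (1ℚ ℚ.- p) {{positive 0<1-p}}}}))
  (fromℚ ((1/ p) {{ℚₚ.pos⇒nonZero p {{positive 0<p}}}}))
  where
  0<1-p : 0ℚ ℚ.< 1ℚ ℚ.- p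
  0<1-p = subst (ℚ._< 1ℚ ℚ.- p) (ℚₚ.+-inverseʳ p) (ℚₚ.+-monoˡ-< (ℚ.- p) p<1)

{-# OPTIONS --safe #-}
module Submission where

-- Write N for the size of the slice of weight k = p n, and eᵢ = (1 − xᵢ) / 2.  On the slice, f
-- is a homogeneous polynomial Σ_{|S| = d} c_S e_S of degree d.  Let W be a random set whose
-- n independent bits have bias u = p / 2; there the inequality E f⁴ ≤ K^d (E f²)² is Bonami's,
-- by induction on n.  It is transported to the slice from both sides:
--
-- (i) if x is a random superset of W of size k, then E[f(W) 1(|W| ≤ k) | x] = τ f(x), because
-- each e_S is multiplied by P(S ⊆ W, |W| ≤ k) / P(S ⊆ x); by Markov's inequality τ ≥ 2^{-d} / 4,
-- and Jensen's inequality gives τ⁴ E f(x)⁴ ≤ E f(W)⁴;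
--
-- (ii) P(S ∪ T ⊆ x) depends only on |S ∩ T| and is a combination of the positive semidefinite
-- kernels (|S ∩ T| choose i) with explicit nonnegative coefficients (Vandermonde); comparing
-- them with those of W gives E f(W)² ≤ (2 / (1 − p))^d E f(x)².
--
-- Both steps need 4 d ≤ k and 4 d ≤ n − k.  Otherwise N ≤ (8 / (p (1 − p)))^{4d}, and
-- E f⁴ ≤ N (E f²)² suffices.

-- Homogeneity is what makes the transport possible: τ depends on the degree, so only on polynomials
-- of a single degree does averaging act as a scalar, and |S ∪ T| is a function of |S ∩ T| only when
-- |S| = |T| = d. It costs nothing, since on the slice the sum of the eᵢ is the constant k. The bias
-- p / 2 instead of p leaves slack twice: W rarely exceeds k elements, and a slice probability, a
-- product of ratios (k - j) / (n - j) below p, still dominates a power of p / 2 as long as j is at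
-- most k / 2. The price is a power of an absolute constant with exponent proportional to d, which
-- the factor C_p^d absorbs.
--
-- All of this is done over the rationals. Real operations act term by term on the representing
-- sequences, so the m-th terms of both sides of the theorem are the two sides of the rational
-- inequality for the m-th terms of the coefficients.

module RationalSlice where

  open import Algebra.Bundles using (CommutativeRing)
  open import Data.Bool using (Bool; true; false)
  open import Data.Fin.Subset using (Subset; ⊥; _∪_; _∩_; ∣_∣)
  open import Data.Fin.Subset.Properties using (∣p∣≤n; ∣⊥∣≡0; ∣p∩q∣≤∣p∣)
  import Data.Integer as ℤ
  import Data.Integer.Properties as ℤₚ
  open import Data.List as List using (List; []; _∷_; _++_; foldr; filter; length)
  open import Data.Nat as ℕ using (ℕ; zero; suc; _∸_; z≤n; s≤s)
  open import Data.Nat.DivMod using (_/_; m/n*n≤m; m%n<n; m≡m%n+[m/n]*n)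
  import Data.Nat.Properties as ℕₚ
  open import Data.Product using (_,_; _×_; ∃-syntax)
  open import Data.Rational as ℚ using (ℚ; 0ℚ; 1ℚ; ½; _+_; _*_; _-_; -_; _≤_; _<_; positive; nonNegative; nonPositive; ≢-nonZero; 1/_)
  open import Data.Rational.Properties
  open import Data.Rational.Solver using (module +-*-Solver)
  import Data.Rational.Unnormalised as ℚᵘ
  import Data.Rational.Unnormalised.Properties as ℚᵘₚ
  open import Data.Sum using (_⊎_; inj₁; inj₂; [_,_]′)
  open import Data.Vec using ([]; _∷_)
  open import Function using (_∘_)
  open import Relation.Binary using (tri<; tri≈; tri>)
  open import Relation.Binary.PropositionalEquality hiding (J)
  open import Relation.Nullary using (yes; no; contradiction; ¬_)
  open import Relation.Unary using (Decidable)
  open +-*-Solver using (solve; con; _:+_; _:*_; _:-_; :-_; _:^_; _:=_)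

  open import Algebra.Properties.CommutativeSemiring.Exp (CommutativeRing.commutativeSemiring +-*-commutativeRing)
    using (_^_; ^-homo-*; ^-assocʳ; ^-distrib-*)
  open import Algebra.Properties.Semiring.Mult (CommutativeRing.semiring +-*-commutativeRing)
    using () renaming (_×_ to _·_; ×-homo-+ to ·-homo-+; ×1-homo-* to ·1-homo-*)

  -- Order on ℚ

  *-≥0 : ∀ {a b} → 0ℚ ≤ a → 0ℚ ≤ b → 0ℚ ≤ a * b
  *-≥0 {a} {b} 0≤a 0≤b =
    nonNegative⁻¹ (a * b) {{nonNeg*nonNeg⇒nonNeg a {{nonNegative 0≤a}} b {{nonNegative 0≤b}}}}

  *->0 : ∀ {a b} → 0ℚ < a → 0ℚ < b → 0ℚ < a * b
  *->0 {a} {b} 0<a 0<b = positive⁻¹ (a * b) {{pos*pos⇒pos a {{positive 0<a}} b {{positive 0<b}}}}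

  +-≥0 : ∀ {a b} → 0ℚ ≤ a → 0ℚ ≤ b → 0ℚ ≤ a + b
  +-≥0 = +-mono-≤

  p+[q-p]≡q : ∀ p q → p + (q - p) ≡ q
  p+[q-p]≡q = solve 2 (λ p q → p :+ (q :- p) := q) refl

  0≤q-p⇒p≤q : ∀ {p q} → 0ℚ ≤ q - p → p ≤ q
  0≤q-p⇒p≤q {p} {q} h = subst₂ _≤_ (+-identityʳ p) (p+[q-p]≡q p q) (+-monoʳ-≤ p h)

  p≤q⇒0≤q-p : ∀ {p q} → p ≤ q → 0ℚ ≤ q - p
  p≤q⇒0≤q-p {p} {q} h = subst (_≤ q - p) (+-inverseʳ p) (+-monoˡ-≤ (- p) h)

  *-monoˡ : ∀ {a b} c → 0ℚ ≤ c → a ≤ b → c * a ≤ c * b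
  *-monoˡ c 0≤c = *-monoˡ-≤-nonNeg c {{nonNegative 0≤c}}

  *-monoʳ : ∀ {a b} c → 0ℚ ≤ c → a ≤ b → a * c ≤ b * c
  *-monoʳ c 0≤c = *-monoʳ-≤-nonNeg c {{nonNegative 0≤c}}

  *-mono : ∀ {a b c d} → 0ℚ ≤ c → 0ℚ ≤ b → a ≤ b → c ≤ d → a * c ≤ b * d
  *-mono {b = b} {c} 0≤c 0≤b a≤b c≤d = ≤-trans (*-monoʳ c 0≤c a≤b) (*-monoˡ b 0≤b c≤d)

  *-cancelˡ : ∀ {a b} c → 0ℚ < c → c * a ≤ c * b → a ≤ b
  *-cancelˡ c 0<c = *-cancelˡ-≤-pos c {{positive 0<c}}

  square : ∀ a → a ^ 2 ≡ a * a
  square = solve 1 (λ a → a :^ 2 := a :* a) refl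

  a*a≥0 : ∀ a → 0ℚ ≤ a * a
  a*a≥0 a with ≤-total 0ℚ a
  ... | inj₁ 0≤a = *-≥0 0≤a 0≤a
  ... | inj₂ a≤0 = nonNegative⁻¹ (a * a) {{nonPos*nonPos⇒nonPos a {{nonPos}} a {{nonPos}}}}
    where nonPos = nonPositive a≤0

  a^2≥0 : ∀ a → 0ℚ ≤ a ^ 2
  a^2≥0 a = subst (0ℚ ≤_) (sym (square a)) (a*a≥0 a)

  ^4≡^2^2 : ∀ a → a ^ 4 ≡ (a ^ 2) ^ 2
  ^4≡^2^2 = solve 1 (λ a → a :^ 4 := (a :^ 2) :^ 2) refl

  a^4≥0 : ∀ a → 0ℚ ≤ a ^ 4
  a^4≥0 a = subst (0ℚ ≤_) (sym (^4≡^2^2 a)) (a^2≥0 (a ^ 2))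

  0≤1-a : ∀ {a} → a ≤ 1ℚ → 0ℚ ≤ 1ℚ - a
  0≤1-a = p≤q⇒0≤q-p

  1-a≤1 : ∀ {a} → 0ℚ ≤ a → 1ℚ - a ≤ 1ℚ
  1-a≤1 {a} 0≤a = 0≤q-p⇒p≤q (subst (0ℚ ≤_) (solve 1 (λ a → a := con 1ℚ :- (con 1ℚ :- a)) refl a) 0≤a)

  0≤½ : 0ℚ ≤ ½
  0≤½ = nonNegative⁻¹ ½

  ½*a≥0 : ∀ {a} → 0ℚ ≤ a → 0ℚ ≤ ½ * a
  ½*a≥0 = *-≥0 0≤½

  ½*a≤1 : ∀ {a} → 0ℚ ≤ a → a ≤ 1ℚ → ½ * a ≤ 1ℚ
  ½*a≤1 {a} 0≤a a≤1 = *-mono {½} {1ℚ} {a} {1ℚ} 0≤a (nonNegative⁻¹ 1ℚ) (0≤q-p⇒p≤q {½} {1ℚ} 0≤½) a≤1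

  ^-≥0 : ∀ {a} n → 0ℚ ≤ a → 0ℚ ≤ a ^ n
  ^-≥0 zero    0≤a = nonNegative⁻¹ 1ℚ
  ^-≥0 (suc n) 0≤a = *-≥0 0≤a (^-≥0 n 0≤a)

  ^->0 : ∀ {a} n → 0ℚ < a → 0ℚ < a ^ n
  ^->0 zero    0<a = positive⁻¹ 1ℚ
  ^->0 (suc n) 0<a = *->0 0<a (^->0 n 0<a)

  ^-mono : ∀ {a b} n → 0ℚ ≤ a → a ≤ b → a ^ n ≤ b ^ n
  ^-mono zero    0≤a a≤b = ≤-refl
  ^-mono (suc n) 0≤a a≤b = *-mono (^-≥0 n 0≤a) (≤-trans 0≤a a≤b) a≤b (^-mono n 0≤a a≤b)

  1^n≡1 : ∀ n → 1ℚ ^ n ≡ 1ℚ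
  1^n≡1 zero    = refl
  1^n≡1 (suc n) = trans (*-identityˡ (1ℚ ^ n)) (1^n≡1 n)

  ^-≤1 : ∀ {a} n → 0ℚ ≤ a → a ≤ 1ℚ → a ^ n ≤ 1ℚ
  ^-≤1 {a} n 0≤a a≤1 = subst (a ^ n ≤_) (1^n≡1 n) (^-mono n 0≤a a≤1)

  ^-antitone : ∀ {a m n} → 0ℚ ≤ a → a ≤ 1ℚ → m ℕ.≤ n → a ^ n ≤ a ^ m
  ^-antitone {a} {m} {n} 0≤a a≤1 m≤n = begin
    a ^ n                  ≡⟨ cong (a ^_) (sym (ℕₚ.m+[n∸m]≡n m≤n)) ⟩
    a ^ (m ℕ.+ (n ∸ m))    ≡⟨ ^-homo-* a m (n ∸ m) ⟩
    a ^ m * a ^ (n ∸ m)    ≤⟨ *-monoˡ (a ^ m) (^-≥0 m 0≤a) (^-≤1 (n ∸ m) 0≤a a≤1) ⟩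
    a ^ m * 1ℚ             ≡⟨ *-identityʳ (a ^ m) ⟩
    a ^ m                  ∎
    where open ≤-Reasoning

  *-cancel-square : ∀ {a b} → 0ℚ ≤ b → a * a ≤ b * b → a ≤ b
  *-cancel-square {a} {b} 0≤b aa≤bb with ≤-total a b
  ... | inj₁ a≤b = a≤b
  ... | inj₂ b≤a with a ≟ b
  ...   | yes a≡b = ≤-reflexive a≡b
  ...   | no  a≢b = contradiction aa≤bb (<⇒≱ (begin-strict
    b * b  ≤⟨ *-monoˡ b 0≤b b≤a ⟩
    b * a  <⟨ *-monoˡ-<-pos a {{positive (≤-<-trans 0≤b b<a)}} b<a ⟩
    a * a  ∎))
    where
    open ≤-Reasoning
    <⇒≱ : ∀ {p q} → p < q → ¬ q ≤ p
    <⇒≱ p<q q≤p = <-irrefl refl (<-≤-trans p<q q≤p)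
    b<a : b < a
    b<a = ≰⇒> (λ a≤b → a≢b (≤-antisym a≤b b≤a))

  -- The value 0 at 0 does real work: in the averaging weight `v` it annihilates the sets with more
  -- than k elements, which have no superset of size k.
  inv : ℚ → ℚ
  inv q with q ≟ 0ℚ
  ... | yes _   = 0ℚ
  ... | no  q≢0 = (1/ q) {{≢-nonZero q≢0}}

  *-invʳ : ∀ {q} → q ≢ 0ℚ → q * inv q ≡ 1ℚ
  *-invʳ {q} q≢0 with q ≟ 0ℚ
  ... | yes q≡0  = contradiction q≡0 q≢0
  ... | no  q≢0′ = *-inverseʳ q {{≢-nonZero q≢0′}}

  *-inv-≤1 : ∀ q → q * inv q ≤ 1ℚ
  *-inv-≤1 q with q ≟ 0ℚ
  ... | yes _   = subst (_≤ 1ℚ) (sym (*-zeroʳ q)) (nonNegative⁻¹ 1ℚ)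
  ... | no  q≢0 = ≤-reflexive (*-inverseʳ q {{≢-nonZero q≢0}})

  inv-≥0 : ∀ {q} → 0ℚ ≤ q → 0ℚ ≤ inv q
  inv-≥0 {q} 0≤q with q ≟ 0ℚ
  ... | yes _   = ≤-refl
  ... | no  q≢0 = <⇒≤ (positive⁻¹ _ {{1/pos⇒pos q {{nonNeg∧nonZero⇒pos q {{nonNegative 0≤q}} {{≢-nonZero q≢0}}}}}})

  -- Iterated addition instead of a fraction: `ι (suc n)` unfolds to `1ℚ + ι n`, which the calls to
  -- the ring solver rely on.
  ι : ℕ → ℚ
  ι n = n · 1ℚ

  ι-+ : ∀ m n → ι (m ℕ.+ n) ≡ ι m + ι n
  ι-+ = ·-homo-+ 1ℚ

  ι-* : ∀ m n → ι (m ℕ.* n) ≡ ι m * ι n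
  ι-* = ·1-homo-*

  ι-≥0 : ∀ n → 0ℚ ≤ ι n
  ι-≥0 zero    = ≤-refl
  ι-≥0 (suc n) = +-≥0 (nonNegative⁻¹ 1ℚ) (ι-≥0 n)

  ι->0 : ∀ n → 0ℚ < ι (suc n)
  ι->0 n = +-mono-<-≤ (positive⁻¹ 1ℚ) (ι-≥0 n)

  ι-mono : ∀ {m n} → m ℕ.≤ n → ι m ≤ ι n
  ι-mono {n = n} z≤n = ι-≥0 n
  ι-mono (s≤s m≤n)   = +-monoʳ-≤ 1ℚ (ι-mono m≤n)

  ι-mono-< : ∀ {m n} → m ℕ.< n → ι m < ι n
  ι-mono-< {m} {n} m<n = <-≤-trans
    (subst (_< ι (suc m)) (+-identityˡ (ι m)) (+-monoˡ-< (ι m) (positive⁻¹ 1ℚ))) (ι-mono m<n)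

  ι-injective : ∀ {m n} → ι m ≡ ι n → m ≡ n
  ι-injective {m} {n} eq with ℕₚ.<-cmp m n
  ... | tri< m<n _ _ = contradiction eq (<⇒≢ (ι-mono-< m<n))
  ... | tri≈ _ m≡n _ = m≡n
  ... | tri> _ _ n<m = contradiction (sym eq) (<⇒≢ (ι-mono-< n<m))

  -- Sums over the cube

  ∑ : ∀ {n} → (Subset n → ℚ) → ℚ
  ∑ {zero}  F = F []
  ∑ {suc n} F = ∑ (F ∘ (false ∷_)) + ∑ (F ∘ (true ∷_))

  ∑-cong : ∀ {n} {F G : Subset n → ℚ} → (∀ x → F x ≡ G x) → ∑ F ≡ ∑ G
  ∑-cong {zero}  eq = eq []
  ∑-cong {suc n} eq = cong₂ _+_ (∑-cong (eq ∘ (false ∷_))) (∑-cong (eq ∘ (true ∷_)))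

  ∑-mono : ∀ {n} {F G : Subset n → ℚ} → (∀ x → F x ≤ G x) → ∑ F ≤ ∑ G
  ∑-mono {zero}  le = le []
  ∑-mono {suc n} le = +-mono-≤ (∑-mono (le ∘ (false ∷_))) (∑-mono (le ∘ (true ∷_)))

  ∑-≥0 : ∀ {n} {F : Subset n → ℚ} → (∀ x → 0ℚ ≤ F x) → 0ℚ ≤ ∑ F
  ∑-≥0 {zero}  h = h []
  ∑-≥0 {suc n} h = +-≥0 (∑-≥0 (h ∘ (false ∷_))) (∑-≥0 (h ∘ (true ∷_)))

  interchange : ∀ a b c d → (a + b) + (c + d) ≡ (a + c) + (b + d)
  interchange = solve 4 (λ a b c d → (a :+ b) :+ (c :+ d) := (a :+ c) :+ (b :+ d)) refl

  ∑-+ : ∀ {n} (F G : Subset n → ℚ) → ∑ (λ x → F x + G x) ≡ ∑ F + ∑ G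
  ∑-+ {zero}  F G = refl
  ∑-+ {suc n} F G = trans
    (cong₂ _+_ (∑-+ (F ∘ (false ∷_)) (G ∘ (false ∷_))) (∑-+ (F ∘ (true ∷_)) (G ∘ (true ∷_))))
    (interchange (∑ (F ∘ (false ∷_))) _ _ _)

  ∑-*ˡ : ∀ {n} c (F : Subset n → ℚ) → ∑ (λ x → c * F x) ≡ c * ∑ F
  ∑-*ˡ {zero}  c F = refl
  ∑-*ˡ {suc n} c F = trans
    (cong₂ _+_ (∑-*ˡ c (F ∘ (false ∷_))) (∑-*ˡ c (F ∘ (true ∷_))))
    (sym (*-distribˡ-+ c _ _))

  ∑-*ʳ : ∀ {n} c (F : Subset n → ℚ) → ∑ (λ x → F x * c) ≡ ∑ F * c
  ∑-*ʳ c F = trans (∑-cong (λ x → *-comm (F x) c)) (trans (∑-*ˡ c F) (*-comm c (∑ F)))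

  ∑-zero : ∀ n → ∑ {n} (λ _ → 0ℚ) ≡ 0ℚ
  ∑-zero zero    = refl
  ∑-zero (suc n) = cong₂ _+_ (∑-zero n) (∑-zero n)

  ∑-swap : ∀ {m n} (F : Subset m → Subset n → ℚ) → ∑ (λ x → ∑ (F x)) ≡ ∑ (λ y → ∑ (λ x → F x y))
  ∑-swap {zero}  F = refl
  ∑-swap {suc m} F = trans
    (cong₂ _+_ (∑-swap (F ∘ (false ∷_))) (∑-swap (F ∘ (true ∷_))))
    (sym (∑-+ (λ y → ∑ (λ x → F (false ∷ x) y)) (λ y → ∑ (λ x → F (true ∷ x) y))))

  ∑-product : ∀ {m n} (F : Subset m → ℚ) (G : Subset n → ℚ) →
    ∑ F * ∑ G ≡ ∑ (λ x → ∑ (λ y → F x * G y))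
  ∑-product F G = trans (sym (∑-*ʳ (∑ G) F)) (∑-cong (λ x → sym (∑-*ˡ (F x) G)))

  -- Only the cross term needs an argument: (2ZZ′)² is at most 4 XY X′Y′, which is at most (XY′ +
  -- X′Y)² by the inequality of arithmetic and geometric means.
  cauchy-schwarz-step : ∀ {X X′ Y Y′} Z Z′ →
    0ℚ ≤ X → 0ℚ ≤ X′ → 0ℚ ≤ Y → 0ℚ ≤ Y′ → Z ^ 2 ≤ X * Y → Z′ ^ 2 ≤ X′ * Y′ →
    (Z + Z′) ^ 2 ≤ (X + X′) * (Y + Y′)
  cauchy-schwarz-step {X} {X′} {Y} {Y′} Z Z′ 0≤X 0≤X′ 0≤Y 0≤Y′ h h′ = begin
    (Z + Z′) ^ 2                               ≡⟨ solve 2 (λ z z′ → (z :+ z′) :^ 2 := z :^ 2 :+ z′ :^ 2 :+ con (ι 2) :* (z :* z′)) refl Z Z′ ⟩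
    Z ^ 2 + Z′ ^ 2 + ι 2 * (Z * Z′)            ≤⟨ +-mono-≤ (+-mono-≤ h h′) cross ⟩
    X * Y + X′ * Y′ + (X * Y′ + X′ * Y)        ≡⟨ solve 4 (λ x x′ y y′ → x :* y :+ x′ :* y′ :+ (x :* y′ :+ x′ :* y) := (x :+ x′) :* (y :+ y′)) refl X X′ Y Y′ ⟩
    (X + X′) * (Y + Y′)                        ∎
    where
    open ≤-Reasoning
    cross : ι 2 * (Z * Z′) ≤ X * Y′ + X′ * Y
    cross = *-cancel-square (+-≥0 (*-≥0 0≤X 0≤Y′) (*-≥0 0≤X′ 0≤Y)) (begin
      ι 2 * (Z * Z′) * (ι 2 * (Z * Z′))        ≡⟨ solve 2 (λ z z′ → con (ι 2) :* (z :* z′) :* (con (ι 2) :* (z :* z′)) := con (ι 4) :* (z :^ 2 :* z′ :^ 2)) refl Z Z′ ⟩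
      ι 4 * (Z ^ 2 * Z′ ^ 2)                   ≤⟨ *-monoˡ (ι 4) (ι-≥0 4) (*-mono (a^2≥0 Z′) (*-≥0 0≤X 0≤Y) h h′) ⟩
      ι 4 * (X * Y * (X′ * Y′))                ≤⟨ 0≤q-p⇒p≤q (subst (0ℚ ≤_) (solve 4 (λ x x′ y y′ →
          (x :* y′ :- x′ :* y) :^ 2 := (x :* y′ :+ x′ :* y) :* (x :* y′ :+ x′ :* y) :- con (ι 4) :* (x :* y :* (x′ :* y′))) refl X X′ Y Y′)
          (a^2≥0 (X * Y′ - X′ * Y))) ⟩
      (X * Y′ + X′ * Y) * (X * Y′ + X′ * Y)    ∎)

  cauchy-schwarz : ∀ {n} (w F G : Subset n → ℚ) → (∀ x → 0ℚ ≤ w x) →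
    ∑ (λ x → w x * (F x * G x)) ^ 2 ≤ ∑ (λ x → w x * F x ^ 2) * ∑ (λ x → w x * G x ^ 2)
  cauchy-schwarz {zero}  w F G 0≤w = ≤-reflexive (solve 3 (λ w f g →
    (w :* (f :* g)) :^ 2 := (w :* f :^ 2) :* (w :* g :^ 2)) refl (w []) (F []) (G []))
  cauchy-schwarz {suc n} w F G 0≤w = cauchy-schwarz-step (Z false) (Z true)
    (nn w F 0≤w false) (nn w F 0≤w true) (nn w G 0≤w false) (nn w G 0≤w true)
    (cauchy-schwarz (w ∘ (false ∷_)) (F ∘ (false ∷_)) (G ∘ (false ∷_)) (0≤w ∘ (false ∷_)))
    (cauchy-schwarz (w ∘ (true ∷_)) (F ∘ (true ∷_)) (G ∘ (true ∷_)) (0≤w ∘ (true ∷_)))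
    where
    Z = λ b → ∑ (λ x → w (b ∷ x) * (F (b ∷ x) * G (b ∷ x)))
    nn : ∀ {n} (w F : Subset (suc n) → ℚ) → (∀ x → 0ℚ ≤ w x) → ∀ b → 0ℚ ≤ ∑ (λ x → w (b ∷ x) * F (b ∷ x) ^ 2)
    nn w F 0≤w b = ∑-≥0 (λ x → *-≥0 (0≤w (b ∷ x)) (a^2≥0 (F (b ∷ x))))

  ∑-squares : ∀ {n} {F : Subset n → ℚ} → (∀ x → 0ℚ ≤ F x) → ∑ (λ x → F x ^ 2) ≤ ∑ F ^ 2
  ∑-squares {zero}  h = ≤-refl
  ∑-squares {suc n} {F} h = begin
    ∑ (λ x → F (false ∷ x) ^ 2) + ∑ (λ x → F (true ∷ x) ^ 2)  ≤⟨ +-mono-≤ (∑-squares (h ∘ (false ∷_))) (∑-squares (h ∘ (true ∷_))) ⟩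
    A ^ 2 + B ^ 2                ≤⟨ 0≤q-p⇒p≤q (subst (0ℚ ≤_) (solve 2 (λ a b → con (ι 2) :* (a :* b) := (a :+ b) :^ 2 :- (a :^ 2 :+ b :^ 2)) refl A B)
                                       (*-≥0 (ι-≥0 2) (*-≥0 (∑-≥0 (h ∘ (false ∷_))) (∑-≥0 (h ∘ (true ∷_)))))) ⟩
    (A + B) ^ 2                  ∎
    where
    open ≤-Reasoning
    A = ∑ (F ∘ (false ∷_))
    B = ∑ (F ∘ (true ∷_))

  -- Polynomials in the indicators eᵢ = (1 − xᵢ) / 2, and binomial sums

  -- The value ∏_{i ∈ S} eᵢ at the indicator vector x, i.e. [S ⊆ x].
  e : ∀ {n} → Subset n → Subset n → ℚ
  e []          []          = 1ℚ
  e (false ∷ S) (_ ∷ x)     = e S x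
  e (true ∷ S)  (true ∷ x)  = e S x
  e (true ∷ S)  (false ∷ x) = 0ℚ

  e-≥0 : ∀ {n} (S x : Subset n) → 0ℚ ≤ e S x
  e-≥0 []          []          = nonNegative⁻¹ 1ℚ
  e-≥0 (false ∷ S) (_ ∷ x)     = e-≥0 S x
  e-≥0 (true ∷ S)  (true ∷ x)  = e-≥0 S x
  e-≥0 (true ∷ S)  (false ∷ x) = ≤-refl

  e-⊥ : ∀ {n} (x : Subset n) → e ⊥ x ≡ 1ℚ
  e-⊥ []      = refl
  e-⊥ (_ ∷ x) = e-⊥ x

  e-∪ : ∀ {n} (S T x : Subset n) → e S x * e T x ≡ e (S ∪ T) x
  e-∪ []          []          []          = refl
  e-∪ (false ∷ S) (false ∷ T) (_ ∷ x)     = e-∪ S T x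
  e-∪ (false ∷ S) (true ∷ T)  (true ∷ x)  = e-∪ S T x
  e-∪ (false ∷ S) (true ∷ T)  (false ∷ x) = *-zeroʳ (e S x)
  e-∪ (true ∷ S)  (false ∷ T) (true ∷ x)  = e-∪ S T x
  e-∪ (true ∷ S)  (false ∷ T) (false ∷ x) = *-zeroˡ (e T x)
  e-∪ (true ∷ S)  (true ∷ T)  (true ∷ x)  = e-∪ S T x
  e-∪ (true ∷ S)  (true ∷ T)  (false ∷ x) = refl

  e≡0⊎∣S∣≤∣x∣ : ∀ {n} (S x : Subset n) → e S x ≡ 0ℚ ⊎ ∣ S ∣ ℕ.≤ ∣ x ∣
  e≡0⊎∣S∣≤∣x∣ []          []          = inj₂ z≤n
  e≡0⊎∣S∣≤∣x∣ (true ∷ S)  (false ∷ x) = inj₁ refl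
  e≡0⊎∣S∣≤∣x∣ (false ∷ S) (false ∷ x) = e≡0⊎∣S∣≤∣x∣ S x
  e≡0⊎∣S∣≤∣x∣ (false ∷ S) (true ∷ x) with e≡0⊎∣S∣≤∣x∣ S x
  ... | inj₁ eq = inj₁ eq
  ... | inj₂ le = inj₂ (ℕₚ.m≤n⇒m≤1+n le)
  e≡0⊎∣S∣≤∣x∣ (true ∷ S) (true ∷ x) with e≡0⊎∣S∣≤∣x∣ S x
  ... | inj₁ eq = inj₁ eq
  ... | inj₂ le = inj₂ (s≤s le)

  ∣S∪T∣+∣S∩T∣ : ∀ {n} (S T : Subset n) → ∣ S ∪ T ∣ ℕ.+ ∣ S ∩ T ∣ ≡ ∣ S ∣ ℕ.+ ∣ T ∣
  ∣S∪T∣+∣S∩T∣ []          []          = refl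
  ∣S∪T∣+∣S∩T∣ (false ∷ S) (false ∷ T) = ∣S∪T∣+∣S∩T∣ S T
  ∣S∪T∣+∣S∩T∣ (false ∷ S) (true ∷ T)  = trans (cong suc (∣S∪T∣+∣S∩T∣ S T)) (sym (ℕₚ.+-suc ∣ S ∣ ∣ T ∣))
  ∣S∪T∣+∣S∩T∣ (true ∷ S)  (false ∷ T) = cong suc (∣S∪T∣+∣S∩T∣ S T)
  ∣S∪T∣+∣S∩T∣ (true ∷ S)  (true ∷ T)  = cong suc (trans (ℕₚ.+-suc ∣ S ∪ T ∣ ∣ S ∩ T ∣)
    (trans (cong suc (∣S∪T∣+∣S∩T∣ S T)) (sym (ℕₚ.+-suc ∣ S ∣ ∣ T ∣))))

  poly : ∀ {n} → (Subset n → ℚ) → Subset n → ℚ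
  poly c x = ∑ (λ S → c S * e S x)

  poly-false : ∀ {n} (c : Subset (suc n) → ℚ) x → poly c (false ∷ x) ≡ poly (c ∘ (false ∷_)) x
  poly-false {n} c x = trans
    (cong (poly (c ∘ (false ∷_)) x +_)
      (trans (∑-cong (λ S → *-zeroʳ (c (true ∷ S)))) (∑-zero n)))
    (+-identityʳ _)

  -- Σⱼ (m choose j) v (a + j)
  binSum : (ℕ → ℚ) → ℕ → ℕ → ℚ
  binSum v zero    a = v a
  binSum v (suc m) a = binSum v m a + binSum v m (suc a)

  binSum-cong : ∀ {v v′} m a → (∀ l → l ℕ.≤ m ℕ.+ a → v l ≡ v′ l) → binSum v m a ≡ binSum v′ m a
  binSum-cong zero    a eq = eq a ℕₚ.≤-refl
  binSum-cong (suc m) a eq = cong₂ _+_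
    (binSum-cong m a (λ l l≤ → eq l (ℕₚ.m≤n⇒m≤1+n l≤)))
    (binSum-cong m (suc a) (λ l l≤ → eq l (subst (l ℕ.≤_) (ℕₚ.+-suc m a) l≤)))

  binSum-mono : ∀ {v v′} m a → (∀ l → a ℕ.≤ l → l ℕ.≤ m ℕ.+ a → v l ≤ v′ l) → binSum v m a ≤ binSum v′ m a
  binSum-mono zero    a le = le a ℕₚ.≤-refl ℕₚ.≤-refl
  binSum-mono (suc m) a le = +-mono-≤
    (binSum-mono m a (λ l a≤ l≤ → le l a≤ (ℕₚ.m≤n⇒m≤1+n l≤)))
    (binSum-mono m (suc a) (λ l a≤ l≤ → le l (ℕₚ.<⇒≤ a≤) (subst (l ℕ.≤_) (ℕₚ.+-suc m a) l≤)))

  binSum-≥0 : ∀ {v} m a → (∀ l → 0ℚ ≤ v l) → 0ℚ ≤ binSum v m a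
  binSum-≥0 zero    a h = h a
  binSum-≥0 (suc m) a h = +-≥0 (binSum-≥0 m a h) (binSum-≥0 m (suc a) h)

  binSum-*ˡ : ∀ c v m a → binSum (λ l → c * v l) m a ≡ c * binSum v m a
  binSum-*ˡ c v zero    a = refl
  binSum-*ˡ c v (suc m) a =
    trans (cong₂ _+_ (binSum-*ˡ c v m a) (binSum-*ˡ c v m (suc a))) (sym (*-distribˡ-+ c _ _))

  binSum-minus : ∀ v v′ m a → binSum (λ l → v l - v′ l) m a ≡ binSum v m a - binSum v′ m a
  binSum-minus v v′ zero    a = refl
  binSum-minus v v′ (suc m) a = trans (cong₂ _+_ (binSum-minus v v′ m a) (binSum-minus v v′ m (suc a)))
    (solve 4 (λ x y z w → (x :- y) :+ (z :- w) := (x :+ z) :- (y :+ w)) refl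
      (binSum v m a) (binSum v′ m a) (binSum v m (suc a)) (binSum v′ m (suc a)))

  binSum-shift : ∀ v m d a → binSum (v ∘ (d ℕ.+_)) m a ≡ binSum v m (d ℕ.+ a)
  binSum-shift v zero    d a = refl
  binSum-shift v (suc m) d a = cong₂ _+_ (binSum-shift v m d a)
    (trans (binSum-shift v m d (suc a)) (cong (binSum v m) (ℕₚ.+-suc d a)))

  -- The absorption identity j (m+1 choose j) = (m+1) (m choose j-1) with j = l - a. It yields both
  -- the ratios of neighbouring binomial coefficients and the mean of the binomial law.
  binSum-weighted : ∀ v m a →
    binSum (λ l → (ι l - ι a) * v l) (suc m) a ≡ ι (suc m) * binSum v m (suc a)
  binSum-weighted v zero    a = solve 3 (λ a x y → (a :- a) :* x :+ ((con 1ℚ :+ a) :- a) :* y := con (ι 1) :* y)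
    refl (ι a) (v a) (v (suc a))
  binSum-weighted v (suc m) a = begin
    binSum (λ l → (ι l - ι a) * v l) (suc m) a + binSum (λ l → (ι l - ι a) * v l) (suc m) (suc a)
      ≡⟨ cong₂ _+_ (binSum-weighted v m a) second ⟩
    ι (suc m) * X + (ι (suc m) * Y - (- 1ℚ) * (X + Y))
      ≡⟨ solve 3 (λ i x y → i :* x :+ (i :* y :- con (- 1ℚ) :* (x :+ y)) := (con 1ℚ :+ i) :* (x :+ y)) refl (ι (suc m)) X Y ⟩
    ι (suc (suc m)) * (X + Y) ∎
    where
    open ≡-Reasoning
    X = binSum v m (suc a)
    Y = binSum v m (suc (suc a))
    second : binSum (λ l → (ι l - ι a) * v l) (suc m) (suc a) ≡ ι (suc m) * Y - (- 1ℚ) * (X + Y)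
    second = begin
      binSum (λ l → (ι l - ι a) * v l) (suc m) (suc a)
        ≡⟨ binSum-cong (suc m) (suc a) (λ l _ → solve 3 (λ l a v → (l :- a) :* v := (l :- (con 1ℚ :+ a)) :* v :- con (- 1ℚ) :* v) refl (ι l) (ι a) (v l)) ⟩
      binSum (λ l → (ι l - ι (suc a)) * v l - (- 1ℚ) * v l) (suc m) (suc a)
        ≡⟨ binSum-minus (λ l → (ι l - ι (suc a)) * v l) (λ l → (- 1ℚ) * v l) (suc m) (suc a) ⟩
      binSum (λ l → (ι l - ι (suc a)) * v l) (suc m) (suc a) - binSum (λ l → (- 1ℚ) * v l) (suc m) (suc a)
        ≡⟨ cong₂ _-_ (binSum-weighted v m (suc a)) (binSum-*ˡ (- 1ℚ) v (suc m) (suc a)) ⟩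
      ι (suc m) * Y - (- 1ℚ) * (X + Y) ∎

  ∑-above : ∀ {n} v (S : Subset n) →
    ∑ (λ x → e S x * v ∣ x ∣) ≡ binSum v (n ∸ ∣ S ∣) ∣ S ∣
  ∑-above v [] = *-identityˡ (v 0)
  ∑-above {suc n} v (false ∷ S) rewrite ℕₚ.+-∸-assoc 1 (∣p∣≤n S) = cong₂ _+_
    (∑-above v S)
    (trans (∑-above (v ∘ suc) S) (binSum-shift v (n ∸ ∣ S ∣) 1 ∣ S ∣))
  ∑-above {suc n} v (true ∷ S) = trans
    (cong₂ _+_ (trans (∑-cong {n} (λ x → *-zeroˡ (v ∣ x ∣))) (∑-zero n))
               (trans (∑-above (v ∘ suc) S) (binSum-shift v (n ∸ ∣ S ∣) 1 ∣ S ∣)))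
    (+-identityˡ _)

  -- A set between S and x is S plus some of the |x| - |S| remaining elements of x. If S is not
  -- contained in x, both sides vanish, so the truncated subtraction does no harm.
  ∑-between : ∀ {n} v (S x : Subset n) →
    ∑ (λ W → e S W * (e W x * v ∣ W ∣)) ≡ e S x * binSum v (∣ x ∣ ∸ ∣ S ∣) ∣ S ∣
  ∑-between v [] [] = cong (1ℚ *_) (*-identityˡ (v 0))
  ∑-between {suc n} v (false ∷ S) (false ∷ x) = trans
    (cong₂ _+_ (∑-between v S x)
      (trans (∑-cong (λ W → trans (cong (e S W *_) (*-zeroˡ (v (suc ∣ W ∣)))) (*-zeroʳ (e S W)))) (∑-zero n)))
    (+-identityʳ _)
  ∑-between {suc n} v (false ∷ S) (true ∷ x) = trans
    (cong₂ _+_ (∑-between v S x)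
      (trans (∑-between (v ∘ suc) S x) (cong (e S x *_) (binSum-shift v (∣ x ∣ ∸ ∣ S ∣) 1 ∣ S ∣))))
    (trans (sym (*-distribˡ-+ (e S x) _ _)) one-more)
    where
    one-more : e S x * binSum v (suc (∣ x ∣ ∸ ∣ S ∣)) ∣ S ∣ ≡ e S x * binSum v (suc ∣ x ∣ ∸ ∣ S ∣) ∣ S ∣
    one-more with e≡0⊎∣S∣≤∣x∣ S x
    ... | inj₁ eq rewrite eq = trans (*-zeroˡ (binSum v (suc (∣ x ∣ ∸ ∣ S ∣)) ∣ S ∣)) (sym (*-zeroˡ (binSum v (suc ∣ x ∣ ∸ ∣ S ∣) ∣ S ∣)))
    ... | inj₂ le rewrite ℕₚ.+-∸-assoc 1 le = refl
  ∑-between {suc n} v (true ∷ S) (false ∷ x) = trans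
    (cong₂ _+_
      (trans (∑-cong (λ W → *-zeroˡ (e W x * v ∣ W ∣))) (∑-zero n))
      (trans (∑-cong (λ W → trans (cong (e S W *_) (*-zeroˡ (v (suc ∣ W ∣)))) (*-zeroʳ (e S W)))) (∑-zero n)))
    (sym (*-zeroˡ (binSum v (∣ x ∣ ∸ suc ∣ S ∣) (suc ∣ S ∣))))
  ∑-between {suc n} v (true ∷ S) (true ∷ x) = trans
    (cong₂ _+_
      (trans (∑-cong (λ W → *-zeroˡ (e W x * v ∣ W ∣))) (∑-zero n))
      (trans (∑-between (v ∘ suc) S x) (cong (e S x *_) (binSum-shift v (∣ x ∣ ∸ ∣ S ∣) 1 ∣ S ∣))))
    (+-identityˡ _)

  ∑-size : ∀ n v → ∑ {n} (λ x → v ∣ x ∣) ≡ binSum v n 0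
  ∑-size zero    v = refl
  ∑-size (suc n) v = cong₂ _+_ (∑-size n v) (trans (∑-size n (v ∘ suc)) (binSum-shift v n 1 0))

  -- Slices

  δ : ℕ → ℕ → ℚ
  δ zero    zero    = 1ℚ
  δ zero    (suc l) = 0ℚ
  δ (suc k) zero    = 0ℚ
  δ (suc k) (suc l) = δ k l

  δ-diag : ∀ k → δ k k ≡ 1ℚ
  δ-diag zero    = refl
  δ-diag (suc k) = δ-diag k

  δ-off : ∀ {k l} → k ≢ l → δ k l ≡ 0ℚ
  δ-off {zero}  {zero}  k≢l = contradiction refl k≢l
  δ-off {zero}  {suc l} k≢l = refl
  δ-off {suc k} {zero}  k≢l = refl
  δ-off {suc k} {suc l} k≢l = δ-off (k≢l ∘ cong suc)

  δ-≥0 : ∀ k l → 0ℚ ≤ δ k l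
  δ-≥0 zero    zero    = nonNegative⁻¹ 1ℚ
  δ-≥0 zero    (suc l) = ≤-refl
  δ-≥0 (suc k) zero    = ≤-refl
  δ-≥0 (suc k) (suc l) = δ-≥0 k l

  δ-cong : ∀ {k l} {a b : ℚ} → (k ≡ l → a ≡ b) → δ k l * a ≡ δ k l * b
  δ-cong {k} {l} {a} {b} h with k ℕ.≟ l
  ... | yes k≡l = cong (δ k l *_) (h k≡l)
  ... | no  k≢l rewrite δ-off k≢l = trans (*-zeroˡ a) (sym (*-zeroˡ b))

  δ-mono : ∀ {k l} {a b : ℚ} → (k ≡ l → a ≤ b) → δ k l * a ≤ δ k l * b
  δ-mono {k} {l} {a} {b} h with k ℕ.≟ l
  ... | yes k≡l = *-monoˡ (δ k l) (δ-≥0 k l) (h k≡l)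
  ... | no  k≢l rewrite δ-off k≢l = ≤-reflexive (trans (*-zeroˡ a) (sym (*-zeroˡ b)))

  δ-shift : ∀ {d k} l → d ℕ.≤ k → δ k (d ℕ.+ l) ≡ δ (k ∸ d) l
  δ-shift l z≤n       = refl
  δ-shift l (s≤s d≤k) = δ-shift l d≤k

  -- (m choose k − a): the number of points of weight k above a point of weight a
  -- that leaves m coordinates free
  B : ℕ → ℕ → ℕ → ℚ
  B k = binSum (δ k)

  B-≥0 : ∀ k m a → 0ℚ ≤ B k m a
  B-≥0 k m a = binSum-≥0 m a (δ-≥0 k)

  B->0 : ∀ {k} m a → a ℕ.≤ k → k ℕ.≤ m ℕ.+ a → 0ℚ < B k m a
  B->0 {k} zero a a≤k k≤a rewrite ℕₚ.≤-antisym a≤k k≤a = subst (0ℚ <_) (sym (δ-diag k)) (positive⁻¹ 1ℚ)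
  B->0 {k} (suc m) a a≤k k≤m+a with k ℕ.≤? m ℕ.+ a
  ... | yes k≤ = +-mono-<-≤ (B->0 m a a≤k k≤) (B-≥0 k m (suc a))
  ... | no  k≰ = +-mono-≤-< (B-≥0 k m a)
    (B->0 m (suc a) (ℕₚ.≤-trans (s≤s (ℕₚ.m≤n+m a m)) (ℕₚ.≰⇒> k≰)) (subst (k ℕ.≤_) (sym (ℕₚ.+-suc m a)) k≤m+a))

  -- Absorption again: under `δ k l` the factor l - a is the constant k - a. Read as a ratio, this
  -- is the probability that one more given coordinate lies in x.
  B-fix-one : ∀ k m a → (ι k - ι a) * B k (suc m) a ≡ ι (suc m) * B k m (suc a)
  B-fix-one k m a = trans (sym (binSum-*ˡ (ι k - ι a) (δ k) (suc m) a))
    (trans (binSum-cong (suc m) a (λ l _ → trans (*-comm (ι k - ι a) (δ k l))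
             (trans (δ-cong {k} {l} (λ { refl → refl })) (*-comm (δ k l) (ι l - ι a)))))
           (binSum-weighted (δ k) m a))

  -- The complementary ratio, for one more coordinate outside x: Pascal's rule minus `B-fix-one`.
  B-fix-zero : ∀ k m a → (ι (suc m) - ι k + ι a) * B k (suc m) a ≡ ι (suc m) * B k m a
  B-fix-zero k m a = begin
    (ι (suc m) - ι k + ι a) * (X + Y)          ≡⟨ solve 5 (λ i k a x y → (i :- k :+ a) :* (x :+ y) := i :* x :+ (i :* y :- (k :- a) :* (x :+ y))) refl (ι (suc m)) (ι k) (ι a) X Y ⟩
    ι (suc m) * X + (ι (suc m) * Y - (ι k - ι a) * (X + Y))  ≡⟨ cong (λ t → ι (suc m) * X + (ι (suc m) * Y - t)) (B-fix-one k m a) ⟩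
    ι (suc m) * X + (ι (suc m) * Y - ι (suc m) * Y)          ≡⟨ solve 2 (λ x y → x :+ (y :- y) := x) refl (ι (suc m) * X) (ι (suc m) * Y) ⟩
    ι (suc m) * X ∎
    where
    open ≡-Reasoning
    X = B k m a
    Y = B k m (suc a)

  -- The binomial weights

  weight : ℕ → ℚ → ℕ → ℚ
  weight n u l = u ^ l * (1ℚ - u) ^ (n ∸ l)

  weight-≥0 : ∀ {u} n l → 0ℚ ≤ u → u ≤ 1ℚ → 0ℚ ≤ weight n u l
  weight-≥0 n l 0≤u u≤1 = *-≥0 (^-≥0 l 0≤u) (^-≥0 (n ∸ l) (0≤1-a u≤1))

  weight-false : ∀ {n l} u → l ℕ.≤ n → weight (suc n) u l ≡ (1ℚ - u) * weight n u l
  weight-false {n} {l} u l≤n rewrite ℕₚ.+-∸-assoc 1 l≤n =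
    solve 3 (λ v a b → a :* (v :* b) := v :* (a :* b)) refl (1ℚ - u) (u ^ l) ((1ℚ - u) ^ (n ∸ l))

  weight-true : ∀ n l u → weight (suc n) u (suc l) ≡ u * weight n u l
  weight-true n l u = *-assoc u (u ^ l) ((1ℚ - u) ^ (n ∸ l))

  -- The probability of a prescribed pattern with a ones and n - (m + a) zeros; each of the m free
  -- bits sums out by u + (1 - u) = 1.
  binSum-weight : ∀ {n} u m a → m ℕ.+ a ℕ.≤ n →
    binSum (weight n u) m a ≡ u ^ a * (1ℚ - u) ^ (n ∸ (m ℕ.+ a))
  binSum-weight {n} u zero    a le = refl
  binSum-weight {n} u (suc m) a le = begin
    binSum (weight n u) m a + binSum (weight n u) m (suc a)
      ≡⟨ cong₂ _+_ (binSum-weight u m a (ℕₚ.<⇒≤ le)) (binSum-weight u m (suc a) (subst (ℕ._≤ n) (sym (ℕₚ.+-suc m a)) le)) ⟩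
    u ^ a * (1ℚ - u) ^ (n ∸ (m ℕ.+ a)) + u ^ suc a * (1ℚ - u) ^ (n ∸ (m ℕ.+ suc a))
      ≡⟨ cong₂ (λ i j → u ^ a * (1ℚ - u) ^ i + u ^ suc a * (1ℚ - u) ^ (n ∸ j)) (ℕₚ.+-∸-assoc 1 le) (ℕₚ.+-suc m a) ⟩
    u ^ a * ((1ℚ - u) * r) + u * u ^ a * r
      ≡⟨ solve 3 (λ u a r → a :* ((con 1ℚ :- u) :* r) :+ u :* a :* r := a :* r) refl u (u ^ a) r ⟩
    u ^ a * r ∎
    where
    open ≡-Reasoning
    r = (1ℚ - u) ^ (n ∸ suc (m ℕ.+ a))

  binSum-weight-total : ∀ n u → binSum (weight n u) n 0 ≡ 1ℚ
  binSum-weight-total n u = trans (binSum-weight u n 0 (ℕₚ.≤-reflexive (ℕₚ.+-identityʳ n)))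
    (trans (*-identityˡ _) (cong ((1ℚ - u) ^_) (trans (cong (n ∸_) (ℕₚ.+-identityʳ n)) (ℕₚ.n∸n≡0 n))))

  𝔼ᵤ : ∀ {n} → ℚ → (Subset n → ℚ) → ℚ
  𝔼ᵤ {n} u F = ∑ (λ x → weight n u ∣ x ∣ * F x)

  𝔼ᵤ-suc : ∀ {n} u (F : Subset (suc n) → ℚ) →
    𝔼ᵤ u F ≡ (1ℚ - u) * 𝔼ᵤ u (F ∘ (false ∷_)) + u * 𝔼ᵤ u (F ∘ (true ∷_))
  𝔼ᵤ-suc {n} u F = cong₂ _+_
    (trans (∑-cong (λ x → trans (cong (_* F (false ∷ x)) (weight-false u (∣p∣≤n x))) (*-assoc (1ℚ - u) (weight n u ∣ x ∣) (F (false ∷ x)))))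
           (∑-*ˡ (1ℚ - u) (λ x → weight n u ∣ x ∣ * F (false ∷ x))))
    (trans (∑-cong (λ x → trans (cong (_* F (true ∷ x)) (weight-true n ∣ x ∣ u)) (*-assoc u (weight n u ∣ x ∣) (F (true ∷ x)))))
           (∑-*ˡ u (λ x → weight n u ∣ x ∣ * F (true ∷ x))))

  -- Homogeneous polynomials are compared through the kernel ⟨S, T⟩ ↦ binSum γ |S ∩ T| 0,
  -- which is a nonnegative combination of the kernels (|S ∩ T| choose i), hence positive semidefinite.

  kernel-≥0 : ∀ {n} γ (c : Subset n → ℚ) → (∀ i → 0ℚ ≤ γ i) →
    0ℚ ≤ ∑ (λ S → ∑ (λ T → c S * c T * binSum γ ∣ S ∩ T ∣ 0))
  kernel-≥0 {zero}  γ c h = *-≥0 (a*a≥0 (c [])) (h 0)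
  -- By Pascal's rule a common first element changes the kernel from `binSum γ t 0` to itself plus
  -- the same expression for `γ ∘ suc`. Only the pairing of c₁ with c₁ sees this extra term, so the
  -- form splits into the form of γ at c₀ + c₁ and that of `γ ∘ suc` at c₁.
  kernel-≥0 {suc n} γ c h = subst (0ℚ ≤_) (sym split)
    (+-≥0 (kernel-≥0 γ (λ S → c₀ S + c₁ S) h) (kernel-≥0 (γ ∘ suc) c₁ (h ∘ suc)))
    where
    open ≡-Reasoning
    c₀ c₁ : Subset n → ℚ
    c₀ = c ∘ (false ∷_)
    c₁ = c ∘ (true ∷_)
    Q : (ℕ → ℚ) → (Subset n → ℚ) → (Subset n → ℚ) → ℚ
    Q γ a b = ∑ (λ S → ∑ (λ T → a S * b T * binSum γ ∣ S ∩ T ∣ 0))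
    split-row : ∀ (F G : Subset n → Subset n → ℚ) → ∑ (λ S → ∑ (F S) + ∑ (G S)) ≡ ∑ (λ S → ∑ (F S)) + ∑ (λ S → ∑ (G S))
    split-row F G = ∑-+ (λ S → ∑ (F S)) (λ S → ∑ (G S))
    Q-+ : ∀ a a′ → Q γ (λ S → a S + a′ S) (λ S → a S + a′ S) ≡ (Q γ a a + Q γ a a′) + (Q γ a′ a + Q γ a′ a′)
    Q-+ a a′ = begin
      Q γ (λ S → a S + a′ S) (λ S → a S + a′ S)
        ≡⟨ ∑-cong (λ S → trans (∑-cong (λ T → solve 5 (λ a a′ b b′ k →
             (a :+ a′) :* (b :+ b′) :* k := (a :* b :* k :+ a :* b′ :* k) :+ (a′ :* b :* k :+ a′ :* b′ :* k)) refl
             (a S) (a′ S) (a T) (a′ T) (binSum γ ∣ S ∩ T ∣ 0)))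
             (∑-+ (λ T → a S * a T * K S T + a S * a′ T * K S T) (λ T → a′ S * a T * K S T + a′ S * a′ T * K S T))) ⟩
      ∑ (λ S → ∑ (λ T → a S * a T * K S T + a S * a′ T * K S T) + ∑ (λ T → a′ S * a T * K S T + a′ S * a′ T * K S T))
        ≡⟨ split-row (λ S T → a S * a T * K S T + a S * a′ T * K S T) (λ S T → a′ S * a T * K S T + a′ S * a′ T * K S T) ⟩
      ∑ (λ S → ∑ (λ T → a S * a T * K S T + a S * a′ T * K S T)) + ∑ (λ S → ∑ (λ T → a′ S * a T * K S T + a′ S * a′ T * K S T))
        ≡⟨ cong₂ _+_ (halves a) (halves a′) ⟩
      (Q γ a a + Q γ a a′) + (Q γ a′ a + Q γ a′ a′) ∎
      where
      K : Subset n → Subset n → ℚ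
      K S T = binSum γ ∣ S ∩ T ∣ 0
      halves : ∀ b → ∑ (λ S → ∑ (λ T → b S * a T * K S T + b S * a′ T * K S T)) ≡ Q γ b a + Q γ b a′
      halves b = trans (∑-cong (λ S → ∑-+ (λ T → b S * a T * K S T) (λ T → b S * a′ T * K S T)))
        (split-row (λ S T → b S * a T * K S T) (λ S T → b S * a′ T * K S T))
    extra : ∑ (λ S → ∑ (λ T → c₁ S * c₁ T * binSum γ (suc ∣ S ∩ T ∣) 0)) ≡ Q γ c₁ c₁ + Q (γ ∘ suc) c₁ c₁
    extra = trans (∑-cong (λ S → trans (∑-cong (λ T → trans
        (cong (λ t → c₁ S * c₁ T * (binSum γ ∣ S ∩ T ∣ 0 + t)) (sym (binSum-shift γ ∣ S ∩ T ∣ 1 0)))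
        (*-distribˡ-+ (c₁ S * c₁ T) (binSum γ ∣ S ∩ T ∣ 0) (binSum (γ ∘ suc) ∣ S ∩ T ∣ 0))))
        (∑-+ (λ T → c₁ S * c₁ T * binSum γ ∣ S ∩ T ∣ 0) (λ T → c₁ S * c₁ T * binSum (γ ∘ suc) ∣ S ∩ T ∣ 0))))
      (split-row (λ S T → c₁ S * c₁ T * binSum γ ∣ S ∩ T ∣ 0) (λ S T → c₁ S * c₁ T * binSum (γ ∘ suc) ∣ S ∩ T ∣ 0))
    split : ∑ (λ S → ∑ (λ T → c S * c T * binSum γ ∣ S ∩ T ∣ 0))
          ≡ Q γ (λ S → c₀ S + c₁ S) (λ S → c₀ S + c₁ S) + Q (γ ∘ suc) c₁ c₁
    split = begin
      ∑ (λ S → ∑ (λ T → c S * c T * binSum γ ∣ S ∩ T ∣ 0))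
        ≡⟨ cong₂ _+_ (split-row (λ S T → c₀ S * c₀ T * binSum γ ∣ S ∩ T ∣ 0) (λ S T → c₀ S * c₁ T * binSum γ ∣ S ∩ T ∣ 0))
             (split-row (λ S T → c₁ S * c₀ T * binSum γ ∣ S ∩ T ∣ 0) (λ S T → c₁ S * c₁ T * binSum γ (suc ∣ S ∩ T ∣) 0)) ⟩
      (Q γ c₀ c₀ + Q γ c₀ c₁) + (Q γ c₁ c₀ + ∑ (λ S → ∑ (λ T → c₁ S * c₁ T * binSum γ (suc ∣ S ∩ T ∣) 0)))
        ≡⟨ cong (λ t → (Q γ c₀ c₀ + Q γ c₀ c₁) + (Q γ c₁ c₀ + t)) extra ⟩
      (Q γ c₀ c₀ + Q γ c₀ c₁) + (Q γ c₁ c₀ + (Q γ c₁ c₁ + Q (γ ∘ suc) c₁ c₁))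
        ≡⟨ solve 4 (λ a b c d → a :+ (b :+ (c :+ d)) := (a :+ (b :+ c)) :+ d) refl (Q γ c₀ c₀ + Q γ c₀ c₁) (Q γ c₁ c₀) (Q γ c₁ c₁) (Q (γ ∘ suc) c₁ c₁) ⟩
      ((Q γ c₀ c₀ + Q γ c₀ c₁) + (Q γ c₁ c₀ + Q γ c₁ c₁)) + Q (γ ∘ suc) c₁ c₁
        ≡⟨ cong (_+ Q (γ ∘ suc) c₁ c₁) (sym (Q-+ c₀ c₁)) ⟩
      Q γ (λ S → c₀ S + c₁ S) (λ S → c₀ S + c₁ S) + Q (γ ∘ suc) c₁ c₁ ∎

  -- Vandermonde's convolution: the t coordinates are set first, and i - s of them are zeros.
  -- Counting zeros rather than ones turns the outer sum into a `binSum` in t, the shape of the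
  -- kernels above.
  binSum-expand : ∀ w m A t s → s ℕ.+ t ℕ.≤ A →
    binSum w (t ℕ.+ m) (A ∸ (s ℕ.+ t)) ≡ binSum (λ i → binSum w m (A ∸ i)) t s
  binSum-expand w m A zero    s le = cong (λ j → binSum w m (A ∸ j)) (ℕₚ.+-identityʳ s)
  binSum-expand w m A (suc t) s le = trans (cong₂ _+_
      (trans (cong (λ j → binSum w (t ℕ.+ m) (A ∸ j)) (ℕₚ.+-suc s t))
             (binSum-expand w m A t (suc s) (subst (ℕ._≤ A) (ℕₚ.+-suc s t) le)))
      (trans (cong (binSum w (t ℕ.+ m)) (trans (cong (λ j → suc (A ∸ j)) (ℕₚ.+-suc s t)) (sym (ℕₚ.+-∸-assoc 1 le′))))
             (binSum-expand w m A t s (ℕₚ.<⇒≤ le′))))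
    (+-comm (binSum (λ i → binSum w m (A ∸ i)) t (suc s)) (binSum (λ i → binSum w m (A ∸ i)) t s))
    where
    le′ : suc (s ℕ.+ t) ℕ.≤ A
    le′ = subst (ℕ._≤ A) (ℕₚ.+-suc s t) le

  Homogeneous : ∀ {n} → ℕ → (Subset n → ℚ) → Set
  Homogeneous d c = ∀ S → ∣ S ∣ ≢ d → c S ≡ 0ℚ

  module _ {n d} (c : Subset n → ℚ) (hom : Homogeneous d c) where

    hom-cong : ∀ S {a b : ℚ} → (∣ S ∣ ≡ d → a ≡ b) → c S * a ≡ c S * b
    hom-cong S {a} {b} h with ∣ S ∣ ℕ.≟ d
    ... | yes eq = cong (c S *_) (h eq)
    ... | no  ne rewrite hom S ne = trans (*-zeroˡ a) (sym (*-zeroˡ b))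

    ∑-square : ∀ w → ∑ (λ x → w ∣ x ∣ * poly c x ^ 2)
      ≡ ∑ (λ S → ∑ (λ T → c S * (c T * binSum w (n ∸ ∣ S ∪ T ∣) ∣ S ∪ T ∣)))
    ∑-square w = begin
      ∑ (λ x → w ∣ x ∣ * poly c x ^ 2)
        ≡⟨ ∑-cong (λ x → trans (cong (w ∣ x ∣ *_) (trans (square (poly c x)) (∑-product (λ S → c S * e S x) (λ T → c T * e T x))))
            (trans (sym (∑-*ˡ (w ∣ x ∣) (λ S → ∑ (λ T → c S * e S x * (c T * e T x)))))
              (∑-cong (λ S → trans (sym (∑-*ˡ (w ∣ x ∣) (λ T → c S * e S x * (c T * e T x))))
                (∑-cong (λ T → term x S T)))))) ⟩
      ∑ (λ x → ∑ (λ S → ∑ (λ T → c S * c T * (e (S ∪ T) x * w ∣ x ∣))))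
        ≡⟨ ∑-swap (λ x S → ∑ (λ T → c S * c T * (e (S ∪ T) x * w ∣ x ∣))) ⟩
      ∑ (λ S → ∑ (λ x → ∑ (λ T → c S * c T * (e (S ∪ T) x * w ∣ x ∣))))
        ≡⟨ ∑-cong (λ S → trans (∑-swap (λ x T → c S * c T * (e (S ∪ T) x * w ∣ x ∣)))
            (∑-cong (λ T → trans (∑-*ˡ (c S * c T) (λ x → e (S ∪ T) x * w ∣ x ∣))
              (trans (cong (c S * c T *_) (∑-above w (S ∪ T))) (*-assoc (c S) (c T) _))))) ⟩
      ∑ (λ S → ∑ (λ T → c S * (c T * binSum w (n ∸ ∣ S ∪ T ∣) ∣ S ∪ T ∣))) ∎
      where
      open ≡-Reasoning
      term : ∀ x S T → w ∣ x ∣ * (c S * e S x * (c T * e T x)) ≡ c S * c T * (e (S ∪ T) x * w ∣ x ∣)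
      term x S T = trans (solve 5 (λ w a b a′ b′ → w :* (a :* b :* (a′ :* b′)) := a :* a′ :* (b :* b′ :* w)) refl
        (w ∣ x ∣) (c S) (e S x) (c T) (e T x)) (cong (λ t → c S * c T * (t * w ∣ x ∣)) (e-∪ S T x))

    -- The weight w may take negative values: for a difference of two weights the conclusion says
    -- that one second moment dominates the other. With |S| = |T| = d one has |S ∪ T| = 2d - |S ∩
    -- T|, and Vandermonde's convolution over |S ∩ T| further coordinates makes the kernel a
    -- combination of binomials. Its i-th coefficient is the total weight of a pattern with 2d - i
    -- ones and i zeros.
    signed-square-≥0 : ∀ w → d ℕ.+ d ℕ.≤ n →
      (∀ i → i ℕ.≤ d → 0ℚ ≤ binSum w (n ∸ (d ℕ.+ d)) (d ℕ.+ d ∸ i)) →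
      0ℚ ≤ ∑ (λ x → w ∣ x ∣ * poly c x ^ 2)
    signed-square-≥0 w 2d≤n h = subst (0ℚ ≤_) (sym eq) (kernel-≥0 γ c (λ i → h (i ℕ.⊓ d) (ℕₚ.m⊓n≤n i d)))
      where
      γ : ℕ → ℚ
      -- The minimum with d makes γ nonnegative at every i, as `kernel-≥0` asks, and changes
      -- nothing, since |S ∩ T| is at most d.
      γ i = binSum w (n ∸ (d ℕ.+ d)) (d ℕ.+ d ∸ (i ℕ.⊓ d))
      kernel : ∀ (S T : Subset n) → ∣ S ∣ ≡ d → ∣ T ∣ ≡ d → binSum w (n ∸ ∣ S ∪ T ∣) ∣ S ∪ T ∣ ≡ binSum γ ∣ S ∩ T ∣ 0
      kernel S T |S|≡d |T|≡d = begin
        binSum w (n ∸ ∣ S ∪ T ∣) ∣ S ∪ T ∣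
          ≡⟨ cong₂ (binSum w) free union ⟩
        binSum w (t ℕ.+ (n ∸ (d ℕ.+ d))) (d ℕ.+ d ∸ (0 ℕ.+ t))
          ≡⟨ binSum-expand w (n ∸ (d ℕ.+ d)) (d ℕ.+ d) t 0 t≤2d ⟩
        binSum (λ i → binSum w (n ∸ (d ℕ.+ d)) (d ℕ.+ d ∸ i)) t 0
          ≡⟨ binSum-cong t 0 (λ i i≤ → cong (λ j → binSum w (n ∸ (d ℕ.+ d)) (d ℕ.+ d ∸ j))
               (sym (ℕₚ.m≤n⇒m⊓n≡m (ℕₚ.≤-trans (subst (i ℕ.≤_) (ℕₚ.+-identityʳ t) i≤) t≤d)))) ⟩
        binSum γ t 0 ∎
        where
        open ≡-Reasoning
        t = ∣ S ∩ T ∣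
        total : ∣ S ∪ T ∣ ℕ.+ t ≡ d ℕ.+ d
        total = trans (∣S∪T∣+∣S∩T∣ S T) (cong₂ ℕ._+_ |S|≡d |T|≡d)
        t≤d : t ℕ.≤ d
        t≤d = subst (t ℕ.≤_) |S|≡d (∣p∩q∣≤∣p∣ S T)
        t≤2d : t ℕ.≤ d ℕ.+ d
        t≤2d = ℕₚ.≤-trans t≤d (ℕₚ.m≤m+n d d)
        union : ∣ S ∪ T ∣ ≡ d ℕ.+ d ∸ t
        union = trans (sym (ℕₚ.m+n∸n≡m ∣ S ∪ T ∣ t)) (cong (_∸ t) total)
        free : n ∸ ∣ S ∪ T ∣ ≡ t ℕ.+ (n ∸ (d ℕ.+ d))
        free = begin
          n ∸ ∣ S ∪ T ∣                                          ≡⟨ cong (_∸ ∣ S ∪ T ∣) (sym (ℕₚ.m+[n∸m]≡n 2d≤n)) ⟩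
          d ℕ.+ d ℕ.+ (n ∸ (d ℕ.+ d)) ∸ ∣ S ∪ T ∣                ≡⟨ cong (λ s → s ℕ.+ (n ∸ (d ℕ.+ d)) ∸ ∣ S ∪ T ∣) (sym total) ⟩
          ∣ S ∪ T ∣ ℕ.+ t ℕ.+ (n ∸ (d ℕ.+ d)) ∸ ∣ S ∪ T ∣        ≡⟨ cong (_∸ ∣ S ∪ T ∣) (ℕₚ.+-assoc ∣ S ∪ T ∣ t _) ⟩
          ∣ S ∪ T ∣ ℕ.+ (t ℕ.+ (n ∸ (d ℕ.+ d))) ∸ ∣ S ∪ T ∣      ≡⟨ ℕₚ.m+n∸m≡n ∣ S ∪ T ∣ _ ⟩
          t ℕ.+ (n ∸ (d ℕ.+ d)) ∎
      eq : ∑ (λ x → w ∣ x ∣ * poly c x ^ 2) ≡ ∑ (λ S → ∑ (λ T → c S * c T * binSum γ ∣ S ∩ T ∣ 0))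
      eq = trans (∑-square w) (∑-cong (λ S → ∑-cong (λ T → trans
        (hom-cong S (λ |S|≡d → hom-cong T (λ |T|≡d → kernel S T |S|≡d |T|≡d)))
        (sym (*-assoc (c S) (c T) _)))))

  -- Hypercontractivity for independent biased bits

  poly-linear : ∀ {n} u (a b : Subset n → ℚ) x → poly (λ S → a S + u * b S) x ≡ poly a x + u * poly b x
  poly-linear u a b x = trans
    (∑-cong (λ S → solve 4 (λ u a b e → (a :+ u :* b) :* e := a :* e :+ u :* (b :* e)) refl u (a S) (b S) (e S x)))
    (trans (∑-+ (λ S → a S * e S x) (λ S → u * (b S * e S x))) (cong (poly a x +_) (∑-*ˡ u (λ S → b S * e S x))))

  poly-zero : ∀ {n} (c : Subset n → ℚ) → (∀ S → c S ≡ 0ℚ) → ∀ x → poly c x ≡ 0ℚ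
  poly-zero {n} c h x = trans (∑-cong (λ S → trans (cong (_* e S x) (h S)) (*-zeroˡ (e S x)))) (∑-zero n)

  -- For a u-biased bit X, a + X b equals h + (X - u) b, with fourth moment h⁴ + 6σ h²b² + 4σ(1 -
  -- 2u) h b³ + σ(1 - 3σ) b⁴. The cubic term has no sign; raising 6 to 8 and 1 - 3σ to 3 absorbs it,
  -- and what is left over is a sum of squares times σ b².
  fourth-moment-of-bit : ∀ u a b → 0ℚ ≤ u → u ≤ 1ℚ → let σ = u * (1ℚ - u); h = a + u * b in
    (1ℚ - u) * a ^ 4 + u * (a + b) ^ 4 ≤ h ^ 4 + ι 8 * σ * (h ^ 2 * b ^ 2) + ι 3 * σ * b ^ 4
  fourth-moment-of-bit u a b 0≤u u≤1 = 0≤q-p⇒p≤q (subst (0ℚ ≤_)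
    (solve 3 (λ u a b → let σ = u :* (con 1ℚ :- u); h = a :+ u :* b in
      σ :* b :^ 2 :* (con (ι 2) :* (h :- (con 1ℚ :- con (ι 2) :* u) :* b) :^ 2 :+ con (ι 11) :* σ :* b :^ 2)
      := (h :^ 4 :+ con (ι 8) :* σ :* (h :^ 2 :* b :^ 2) :+ con (ι 3) :* σ :* b :^ 4)
         :- ((con 1ℚ :- u) :* a :^ 4 :+ u :* (a :+ b) :^ 4)) refl u a b)
    (*-≥0 (*-≥0 0≤σ (a^2≥0 b))
      (+-≥0 (*-≥0 (ι-≥0 2) (a^2≥0 (a + u * b - (1ℚ - ι 2 * u) * b))) (*-≥0 (*-≥0 (ι-≥0 11) 0≤σ) (a^2≥0 b)))))
    where
    0≤σ = *-≥0 0≤u (0≤1-a u≤1)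

  second-moment-of-bit : ∀ u a b → let σ = u * (1ℚ - u); h = a + u * b in
    (1ℚ - u) * a ^ 2 + u * (a + b) ^ 2 ≡ h ^ 2 + σ * b ^ 2
  second-moment-of-bit = solve 3 (λ u a b → let σ = u :* (con 1ℚ :- u); h = a :+ u :* b in
    (con 1ℚ :- u) :* a :^ 2 :+ u :* (a :+ b) :^ 2 := h :^ 2 :+ σ :* b :^ 2) refl

  -- The square K (H + σD)² is matched term by term. X, Y, Z stand for E h⁴, E b⁴, E h²b² and H, D
  -- for E h², E b². Cauchy-Schwarz gives LZ ≤ KHD, so L ≥ 4 turns 8σZ into the mixed term, and L²σ
  -- ≥ 3 turns 3σY into σ²L²Y, which is at most the last term. The factor L² at Y is available
  -- because b has one degree less.
  moment-step : ∀ {L K σ X Y Z H D} → ι 4 ≤ L → ι 3 ≤ L ^ 2 * σ → 0ℚ ≤ K → 0ℚ ≤ σ → 0ℚ ≤ X → 0ℚ ≤ Y → 0ℚ ≤ Z →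
    0ℚ ≤ H → 0ℚ ≤ D → X ≤ K * H ^ 2 → L ^ 2 * Y ≤ K * D ^ 2 → Z ^ 2 ≤ X * Y →
    X + ι 8 * σ * Z + ι 3 * σ * Y ≤ K * (H + σ * D) ^ 2
  moment-step {L} {K} {σ} {X} {Y} {Z} {H} {D} 4≤L 3≤L²σ 0≤K 0≤σ 0≤X 0≤Y 0≤Z 0≤H 0≤D hX hY hZ = begin
    X + ι 8 * σ * Z + ι 3 * σ * Y
      ≤⟨ +-mono-≤ (+-mono-≤ hX cross) (*-monoʳ Y 0≤Y (*-monoʳ σ 0≤σ 3≤L²σ)) ⟩
    K * H ^ 2 + ι 2 * σ * (K * (H * D)) + L ^ 2 * σ * σ * Y
      ≡⟨ cong (K * H ^ 2 + ι 2 * σ * (K * (H * D)) +_) (solve 3 (λ l s y → l :* s :* s :* y := s :* s :* (l :* y)) refl (L ^ 2) σ Y) ⟩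
    K * H ^ 2 + ι 2 * σ * (K * (H * D)) + σ * σ * (L ^ 2 * Y)
      ≤⟨ +-monoʳ-≤ (K * H ^ 2 + ι 2 * σ * (K * (H * D))) (*-monoˡ (σ * σ) (*-≥0 0≤σ 0≤σ) hY) ⟩
    K * H ^ 2 + ι 2 * σ * (K * (H * D)) + σ * σ * (K * D ^ 2)
      ≡⟨ solve 4 (λ k s h d → k :* h :^ 2 :+ con (ι 2) :* s :* (k :* (h :* d)) :+ s :* s :* (k :* d :^ 2) := k :* (h :+ s :* d) :^ 2) refl K σ H D ⟩
    K * (H + σ * D) ^ 2 ∎
    where
    open ≤-Reasoning
    LZ≤KHD : L * Z ≤ K * (H * D)
    LZ≤KHD = *-cancel-square (*-≥0 0≤K (*-≥0 0≤H 0≤D)) (begin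
      L * Z * (L * Z)                ≡⟨ solve 2 (λ l z → l :* z :* (l :* z) := l :^ 2 :* z :^ 2) refl L Z ⟩
      L ^ 2 * Z ^ 2                  ≤⟨ *-monoˡ (L ^ 2) (a^2≥0 L) hZ ⟩
      L ^ 2 * (X * Y)                ≡⟨ solve 3 (λ l x y → l :* (x :* y) := x :* (l :* y)) refl (L ^ 2) X Y ⟩
      X * (L ^ 2 * Y)                ≤⟨ *-mono (*-≥0 (a^2≥0 L) 0≤Y) (*-≥0 0≤K (a^2≥0 H)) hX hY ⟩
      K * H ^ 2 * (K * D ^ 2)        ≡⟨ solve 3 (λ k h d → k :* h :^ 2 :* (k :* d :^ 2) := k :* (h :* d) :* (k :* (h :* d))) refl K H D ⟩
      K * (H * D) * (K * (H * D))    ∎)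
    cross : ι 8 * σ * Z ≤ ι 2 * σ * (K * (H * D))
    cross = begin
      ι 8 * σ * Z                  ≡⟨ solve 2 (λ s z → con (ι 8) :* s :* z := con (ι 2) :* s :* (con (ι 4) :* z)) refl σ Z ⟩
      ι 2 * σ * (ι 4 * Z)          ≤⟨ *-monoˡ (ι 2 * σ) (*-≥0 (ι-≥0 2) 0≤σ) (≤-trans (*-monoʳ Z 0≤Z 4≤L) LZ≤KHD) ⟩
      ι 2 * σ * (K * (H * D))      ∎

  module _ {u L : ℚ} (0≤u : 0ℚ ≤ u) (u≤1 : u ≤ 1ℚ) (4≤L : ι 4 ≤ L) (3≤L²σ : ι 3 ≤ L ^ 2 * (u * (1ℚ - u))) where

    private
      σ = u * (1ℚ - u)
      0≤σ = *-≥0 0≤u (0≤1-a u≤1)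

    𝔼ᵤ-≥0 : ∀ {n} {F : Subset n → ℚ} → (∀ x → 0ℚ ≤ F x) → 0ℚ ≤ 𝔼ᵤ u F
    𝔼ᵤ-≥0 {n} h = ∑-≥0 (λ x → *-≥0 (weight-≥0 n ∣ x ∣ 0≤u u≤1) (h x))

    𝔼ᵤ-linear : ∀ {n} α β γ (F G H : Subset n → ℚ) →
      𝔼ᵤ u (λ x → α * F x + β * G x + γ * H x) ≡ α * 𝔼ᵤ u F + β * 𝔼ᵤ u G + γ * 𝔼ᵤ u H
    𝔼ᵤ-linear {n} α β γ F G H = begin
      ∑ (λ x → w x * (α * F x + β * G x + γ * H x))
        ≡⟨ ∑-cong (λ x → solve 7 (λ w a b c f g h → w :* (a :* f :+ b :* g :+ c :* h) := a :* (w :* f) :+ b :* (w :* g) :+ c :* (w :* h)) refl (w x) α β γ (F x) (G x) (H x)) ⟩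
      ∑ (λ x → α * (w x * F x) + β * (w x * G x) + γ * (w x * H x))
        ≡⟨ trans (∑-+ (λ x → α * (w x * F x) + β * (w x * G x)) (λ x → γ * (w x * H x)))
             (cong (_+ ∑ (λ x → γ * (w x * H x))) (∑-+ (λ x → α * (w x * F x)) (λ x → β * (w x * G x)))) ⟩
      ∑ (λ x → α * (w x * F x)) + ∑ (λ x → β * (w x * G x)) + ∑ (λ x → γ * (w x * H x))
        ≡⟨ cong₂ _+_ (cong₂ _+_ (∑-*ˡ α (λ x → w x * F x)) (∑-*ˡ β (λ x → w x * G x))) (∑-*ˡ γ (λ x → w x * H x)) ⟩
      α * 𝔼ᵤ u F + β * 𝔼ᵤ u G + γ * 𝔼ᵤ u H ∎
      where
      open ≡-Reasoning
      w : Subset n → ℚ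
      w x = weight n u ∣ x ∣

    𝔼ᵤ-bit : ∀ {n} (c : Subset (suc n) → ℚ) k → 𝔼ᵤ u (λ x → poly c x ^ k) ≡
      𝔼ᵤ u (λ x → let a = poly (c ∘ (false ∷_)) x in (1ℚ - u) * a ^ k + u * (a + poly (c ∘ (true ∷_)) x) ^ k)
    𝔼ᵤ-bit {n} c k = begin
      𝔼ᵤ u (λ x → poly c x ^ k)
        ≡⟨ 𝔼ᵤ-suc u (λ x → poly c x ^ k) ⟩
      (1ℚ - u) * 𝔼ᵤ u (λ x → poly c (false ∷ x) ^ k) + u * 𝔼ᵤ u F
        ≡⟨ cong (λ t → (1ℚ - u) * t + u * 𝔼ᵤ u F) (∑-cong (λ x → cong (λ t → weight n u ∣ x ∣ * t ^ k) (poly-false c x))) ⟩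
      (1ℚ - u) * 𝔼ᵤ u A + u * 𝔼ᵤ u F
        ≡⟨ solve 3 (λ a b c → a :* b :+ c := a :* b :+ c :+ con 0ℚ :* b) refl (1ℚ - u) (𝔼ᵤ u A) (u * 𝔼ᵤ u F) ⟩
      (1ℚ - u) * 𝔼ᵤ u A + u * 𝔼ᵤ u F + 0ℚ * 𝔼ᵤ u A
        ≡⟨ sym (𝔼ᵤ-linear (1ℚ - u) u 0ℚ A F A) ⟩
      𝔼ᵤ u (λ x → (1ℚ - u) * A x + u * F x + 0ℚ * A x)
        ≡⟨ ∑-cong (λ x → cong (weight n u ∣ x ∣ *_) (solve 2 (λ b c → b :+ con 0ℚ :* c := b) refl ((1ℚ - u) * A x + u * F x) (A x))) ⟩
      𝔼ᵤ u (λ x → (1ℚ - u) * A x + u * F x) ∎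
      where
      open ≡-Reasoning
      A F : Subset n → ℚ
      A x = poly (c ∘ (false ∷_)) x ^ k
      F x = (poly (c ∘ (false ∷_)) x + poly (c ∘ (true ∷_)) x) ^ k

    -- Given the other bits, the first bit contributes its mean h′, of degree at most d, and its
    -- difference b′, of degree at most d - 1. Both live on n bits, where the induction hypothesis
    -- applies.
    hypercontractive : ∀ {n} d (c : Subset n → ℚ) → (∀ S → d ℕ.< ∣ S ∣ → c S ≡ 0ℚ) →
      𝔼ᵤ u (λ x → poly c x ^ 4) ≤ (L ^ 2) ^ d * 𝔼ᵤ u (λ x → poly c x ^ 2) ^ 2
    hypercontractive {zero} d c deg = begin
      1ℚ * 1ℚ * (c [] * 1ℚ) ^ 4                 ≡⟨ solve 1 (λ c → con 1ℚ :* con 1ℚ :* (c :* con 1ℚ) :^ 4 := con 1ℚ :* (con 1ℚ :* con 1ℚ :* (c :* con 1ℚ) :^ 2) :^ 2) refl (c []) ⟩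
      1ℚ * (1ℚ * 1ℚ * (c [] * 1ℚ) ^ 2) ^ 2      ≤⟨ *-monoʳ ((1ℚ * 1ℚ * (c [] * 1ℚ) ^ 2) ^ 2) (a^2≥0 (1ℚ * 1ℚ * (c [] * 1ℚ) ^ 2)) 1≤K ⟩
      (L ^ 2) ^ d * (1ℚ * 1ℚ * (c [] * 1ℚ) ^ 2) ^ 2 ∎
      where
      open ≤-Reasoning
      1≤L : 1ℚ ≤ L
      1≤L = ≤-trans (ι-mono {1} {4} (s≤s z≤n)) 4≤L
      1≤K : 1ℚ ≤ (L ^ 2) ^ d
      1≤K = subst (_≤ (L ^ 2) ^ d) (1^n≡1 d) (^-mono d (nonNegative⁻¹ 1ℚ) (^-mono 2 (nonNegative⁻¹ 1ℚ) 1≤L))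
    hypercontractive {suc n} d c deg = begin
      𝔼ᵤ u (λ x → poly c x ^ 4)
        ≡⟨ 𝔼ᵤ-bit c 4 ⟩
      𝔼ᵤ u (λ x → (1ℚ - u) * a x ^ 4 + u * (a x + b x) ^ 4)
        ≤⟨ ∑-mono (λ x → *-monoˡ (weight n u ∣ x ∣) (weight-≥0 n ∣ x ∣ 0≤u u≤1) (≤-trans
             (fourth-moment-of-bit u (a x) (b x) 0≤u u≤1)
             (≤-reflexive (cong (λ t → t ^ 4 + ι 8 * σ * (t ^ 2 * b x ^ 2) + ι 3 * σ * b x ^ 4) (sym (poly-linear u a′ b′ x)))))) ⟩
      𝔼ᵤ u (λ x → h x ^ 4 + ι 8 * σ * (h x ^ 2 * b x ^ 2) + ι 3 * σ * b x ^ 4)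
        ≡⟨ trans (∑-cong (λ x → cong (λ t → weight n u ∣ x ∣ * (t + ι 8 * σ * (h x ^ 2 * b x ^ 2) + ι 3 * σ * b x ^ 4)) (sym (*-identityˡ (h x ^ 4)))))
             (𝔼ᵤ-linear 1ℚ (ι 8 * σ) (ι 3 * σ) (λ x → h x ^ 4) (λ x → h x ^ 2 * b x ^ 2) (λ x → b x ^ 4)) ⟩
      1ℚ * X + ι 8 * σ * Z + ι 3 * σ * Y
        ≡⟨ cong (λ t → t + ι 8 * σ * Z + ι 3 * σ * Y) (*-identityˡ X) ⟩
      X + ι 8 * σ * Z + ι 3 * σ * Y
        ≤⟨ moment-step 4≤L 3≤L²σ (^-≥0 d (a^2≥0 L)) 0≤σ (𝔼ᵤ-≥0 (λ x → a^4≥0 (h x))) (𝔼ᵤ-≥0 (λ x → a^4≥0 (b x)))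
             (𝔼ᵤ-≥0 (λ x → *-≥0 (a^2≥0 (h x)) (a^2≥0 (b x)))) (𝔼ᵤ-≥0 (λ x → a^2≥0 (h x))) (𝔼ᵤ-≥0 (λ x → a^2≥0 (b x)))
             (hypercontractive d h′ deg-h) (bound-Y d deg) Z²≤XY ⟩
      (L ^ 2) ^ d * (H + σ * D) ^ 2
        ≡⟨ cong (λ t → (L ^ 2) ^ d * t ^ 2) (sym second) ⟩
      (L ^ 2) ^ d * 𝔼ᵤ u (λ x → poly c x ^ 2) ^ 2 ∎
      where
      open ≤-Reasoning
      a′ b′ h′ : Subset n → ℚ
      a′ = c ∘ (false ∷_)
      b′ = c ∘ (true ∷_)
      h′ S = a′ S + u * b′ S
      a b h : Subset n → ℚ
      a = poly a′
      b = poly b′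
      h = poly h′
      X Y Z H D : ℚ
      X = 𝔼ᵤ u (λ x → h x ^ 4)
      Y = 𝔼ᵤ u (λ x → b x ^ 4)
      Z = 𝔼ᵤ u (λ x → h x ^ 2 * b x ^ 2)
      H = 𝔼ᵤ u (λ x → h x ^ 2)
      D = 𝔼ᵤ u (λ x → b x ^ 2)
      deg-h : ∀ S → d ℕ.< ∣ S ∣ → h′ S ≡ 0ℚ
      deg-h S d< = cong₂ _+_ (deg (false ∷ S) d<)
        (trans (cong (u *_) (deg (true ∷ S) (ℕₚ.m<n⇒m<1+n d<))) (*-zeroʳ u))
      Z²≤XY : Z ^ 2 ≤ X * Y
      Z²≤XY = subst₂ (λ s t → Z ^ 2 ≤ s * t)
        (∑-cong (λ x → cong (weight n u ∣ x ∣ *_) (sym (^4≡^2^2 (h x)))))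
        (∑-cong (λ x → cong (weight n u ∣ x ∣ *_) (sym (^4≡^2^2 (b x)))))
        (cauchy-schwarz (λ x → weight n u ∣ x ∣) (λ x → h x ^ 2) (λ x → b x ^ 2) (λ x → weight-≥0 n ∣ x ∣ 0≤u u≤1))
      bound-Y : ∀ d → (∀ S → d ℕ.< ∣ S ∣ → c S ≡ 0ℚ) → L ^ 2 * Y ≤ (L ^ 2) ^ d * D ^ 2
      -- A polynomial of degree 0 does not involve the first bit, so the difference is zero.
      bound-Y zero deg = subst (_≤ 1ℚ * D ^ 2) (sym (trans (cong (L ^ 2 *_) Y≡0) (*-zeroʳ (L ^ 2))))
        (*-≥0 (nonNegative⁻¹ 1ℚ) (a^2≥0 D))
        where
        Y≡0 : Y ≡ 0ℚ
        Y≡0 = trans (∑-cong (λ x → trans (cong (λ t → weight n u ∣ x ∣ * t ^ 4) (poly-zero b′ (λ S → deg (true ∷ S) (s≤s z≤n)) x))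
          (*-zeroʳ (weight n u ∣ x ∣)))) (∑-zero n)
      bound-Y (suc d) deg = subst (L ^ 2 * Y ≤_) (sym (*-assoc (L ^ 2) ((L ^ 2) ^ d) (D ^ 2)))
        (*-monoˡ (L ^ 2) (a^2≥0 L) (hypercontractive d b′ (λ S d< → deg (true ∷ S) (s≤s d<))))
      second : 𝔼ᵤ u (λ x → poly c x ^ 2) ≡ H + σ * D
      second = ≡.begin
        𝔼ᵤ u (λ x → poly c x ^ 2)
          ≡.≡⟨ 𝔼ᵤ-bit c 2 ⟩
        𝔼ᵤ u (λ x → (1ℚ - u) * a x ^ 2 + u * (a x + b x) ^ 2)
          ≡.≡⟨ ∑-cong (λ x → cong (weight n u ∣ x ∣ *_) (trans (second-moment-of-bit u (a x) (b x))
                (trans (cong (λ t → t ^ 2 + σ * b x ^ 2) (sym (poly-linear u a′ b′ x)))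
                  (solve 3 (λ h s b → h :+ s :* b := con 1ℚ :* h :+ s :* b :+ con 0ℚ :* h) refl (h x ^ 2) σ (b x ^ 2))))) ⟩
        𝔼ᵤ u (λ x → 1ℚ * h x ^ 2 + σ * b x ^ 2 + 0ℚ * h x ^ 2)
          ≡.≡⟨ 𝔼ᵤ-linear 1ℚ σ 0ℚ (λ x → h x ^ 2) (λ x → b x ^ 2) (λ x → h x ^ 2) ⟩
        1ℚ * H + σ * D + 0ℚ * H
          ≡.≡⟨ solve 3 (λ h s d → con 1ℚ :* h :+ s :* d :+ con 0ℚ :* h := h :+ s :* d) refl H σ D ⟩
        H + σ * D ≡.∎
        where module ≡ = ≡-Reasoning

  -- Binomial bounds on the slice

  ι-cancel-≤ : ∀ {m n} → ι m ≤ ι n → m ℕ.≤ n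
  ι-cancel-≤ {m} {n} h with m ℕ.≤? n
  ... | yes m≤n = m≤n
  ... | no  m≰n = contradiction (<-≤-trans (ι-mono-< (ℕₚ.≰⇒> m≰n)) h) (<-irrefl refl)

  ½*a+½*a : ∀ a → ½ * a + ½ * a ≡ a
  ½*a+½*a = solve 1 (λ a → con ½ :* a :+ con ½ :* a := a) refl

  a+a≤b⇒½*b≤b-a : ∀ {a b} → a + a ≤ b → ½ * b ≤ b - a
  a+a≤b⇒½*b≤b-a {a} {b} h = 0≤q-p⇒p≤q (subst (0ℚ ≤_)
    (solve 2 (λ a b → con ½ :* (b :- (a :+ a)) := b :- a :- con ½ :* b) refl a b)
    (½*a≥0 (p≤q⇒0≤q-p h)))

  module Slice {p : ℚ} {n k : ℕ} (0≤p : 0ℚ ≤ p) (p≤1 : p ≤ 1ℚ) (pn≡k : p * ι n ≡ ι k) where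

    private
      N = B k n 0

      0≤1-p : 0ℚ ≤ 1ℚ - p
      0≤1-p = 0≤1-a p≤1

    k≤n : k ℕ.≤ n
    k≤n = ι-cancel-≤ (begin
      ι k         ≡⟨ sym pn≡k ⟩
      p * ι n     ≤⟨ *-monoʳ (ι n) (ι-≥0 n) p≤1 ⟩
      1ℚ * ι n    ≡⟨ *-identityˡ (ι n) ⟩
      ι n         ∎)
      where open ≤-Reasoning

    N>0 : 0ℚ < N
    N>0 = B->0 n 0 z≤n (subst (k ℕ.≤_) (sym (ℕₚ.+-identityʳ n)) k≤n)

    -- Containing a given elements has probability equal to the product of (k - j) / (n - j) over j
    -- below a, and no factor exceeds k / n = p.
    B-upper : ∀ a m → m ℕ.+ a ≡ n → B k m a ≤ p ^ a * N
    B-upper zero m m+0≡n = ≤-reflexive (trans (cong (λ j → B k j 0) (trans (sym (ℕₚ.+-identityʳ m)) m+0≡n)) (sym (*-identityˡ N)))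
    B-upper (suc a) m m+1+a≡n = *-cancelˡ (ι (suc m)) (ι->0 m) (begin
      ι (suc m) * B k m (suc a)         ≡⟨ sym (B-fix-one k m a) ⟩
      (ι k - ι a) * B k (suc m) a       ≤⟨ *-mono (B-≥0 k (suc m) a) (*-≥0 0≤p (ι-≥0 (suc m))) ratio (B-upper a (suc m) 1+m+a≡n) ⟩
      p * ι (suc m) * (p ^ a * N)       ≡⟨ solve 4 (λ p i q n → p :* i :* (q :* n) := i :* (p :* q :* n)) refl p (ι (suc m)) (p ^ a) N ⟩
      ι (suc m) * (p ^ suc a * N)       ∎)
      where
      open ≤-Reasoning
      1+m+a≡n : suc m ℕ.+ a ≡ n
      1+m+a≡n = trans (sym (ℕₚ.+-suc m a)) m+1+a≡n
      ratio : ι k - ι a ≤ p * ι (suc m)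
      ratio = 0≤q-p⇒p≤q (subst (0ℚ ≤_) (sym (begin-equality
        p * ι (suc m) - (ι k - ι a)                    ≡⟨ cong (λ t → p * ι (suc m) - (t - ι a)) (trans (sym pn≡k) (cong (p *_) (trans (cong ι (sym 1+m+a≡n)) (ι-+ (suc m) a)))) ⟩
        p * ι (suc m) - (p * (ι (suc m) + ι a) - ι a)  ≡⟨ solve 3 (λ p i a → p :* i :- (p :* (i :+ a) :- a) := (con 1ℚ :- p) :* a) refl p (ι (suc m)) (ι a) ⟩
        (1ℚ - p) * ι a                                 ∎)) (*-≥0 0≤1-p (ι-≥0 a)))

    -- The same product from below: while 2j ≤ k, the numerator k - j is at least k / 2, so each
    -- factor is at least p / 2.
    B-lower-ones : ∀ a m → m ℕ.+ a ≡ n → ι a + ι a ≤ ι k → (½ * p) ^ a * N ≤ B k m a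
    B-lower-ones zero m m+0≡n _ = ≤-reflexive (trans (*-identityˡ N) (cong (λ j → B k j 0) (trans (sym m+0≡n) (ℕₚ.+-identityʳ m))))
    B-lower-ones (suc a) m m+1+a≡n 2a≤k = *-cancelˡ (ι (suc m)) (ι->0 m) (begin
      ι (suc m) * ((½ * p) ^ suc a * N)             ≡⟨ solve 4 (λ i u q n → i :* (u :* q :* n) := u :* i :* (q :* n)) refl (ι (suc m)) (½ * p) ((½ * p) ^ a) N ⟩
      ½ * p * ι (suc m) * ((½ * p) ^ a * N)         ≤⟨ *-mono (*-≥0 (^-≥0 a 0≤½p) (<⇒≤ N>0)) (≤-trans (*-≥0 0≤½p (ι-≥0 (suc m))) ratio) ratio (B-lower-ones a (suc m) 1+m+a≡n 2a≤k′) ⟩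
      (ι k - ι a) * B k (suc m) a                   ≡⟨ B-fix-one k m a ⟩
      ι (suc m) * B k m (suc a)                     ∎)
      where
      open ≤-Reasoning
      0≤½p : 0ℚ ≤ ½ * p
      0≤½p = ½*a≥0 0≤p
      1+m+a≡n : suc m ℕ.+ a ≡ n
      1+m+a≡n = trans (sym (ℕₚ.+-suc m a)) m+1+a≡n
      a≤1+a : ι a ≤ ι (suc a)
      a≤1+a = ι-mono (ℕₚ.n≤1+n a)
      2a≤k′ : ι a + ι a ≤ ι k
      2a≤k′ = ≤-trans (+-mono-≤ a≤1+a a≤1+a) 2a≤k
      ratio : ½ * p * ι (suc m) ≤ ι k - ι a
      ratio = begin
        ½ * p * ι (suc m)    ≤⟨ *-monoˡ (½ * p) 0≤½p (ι-mono (subst (suc m ℕ.≤_) 1+m+a≡n (ℕₚ.m≤m+n (suc m) a))) ⟩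
        ½ * p * ι n          ≡⟨ trans (*-assoc ½ p (ι n)) (cong (½ *_) pn≡k) ⟩
        ½ * ι k              ≤⟨ a+a≤b⇒½*b≤b-a 2a≤k′ ⟩
        ι k - ι a            ∎

    -- Avoiding one more element, when z are already avoided, has a conditional probability with
    -- numerator n - k - z. This is at least half of n - k = (1 - p) n, so each factor is at least
    -- (1 - p) / 2.
    B-lower-zeros : ∀ z m a → z ℕ.+ m ℕ.+ a ≡ n → ι z + ι z ≤ ι n - ι k →
      (½ * (1ℚ - p)) ^ z * B k (z ℕ.+ m) a ≤ B k m a
    B-lower-zeros zero m a _ _ = ≤-reflexive (*-identityˡ (B k m a))
    B-lower-zeros (suc z) m a z+m+a≡n 2z≤n-k = *-cancelˡ (ι (suc m)) (ι->0 m) (begin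
      ι (suc m) * (β ^ suc z * B k (suc z ℕ.+ m) a)     ≡⟨ cong (λ j → ι (suc m) * (β ^ suc z * B k j a)) (sym (ℕₚ.+-suc z m)) ⟩
      ι (suc m) * (β ^ suc z * B k (z ℕ.+ suc m) a)     ≡⟨ solve 4 (λ i u q n → i :* (u :* q :* n) := u :* i :* (q :* n)) refl (ι (suc m)) β (β ^ z) (B k (z ℕ.+ suc m) a) ⟩
      β * ι (suc m) * (β ^ z * B k (z ℕ.+ suc m) a)     ≤⟨ *-mono (*-≥0 (^-≥0 z 0≤β) (B-≥0 k (z ℕ.+ suc m) a)) (≤-trans (*-≥0 0≤β (ι-≥0 (suc m))) ratio) ratio (B-lower-zeros z (suc m) a z+1+m+a≡n 2z≤n-k′) ⟩
      (ι (suc m) - ι k + ι a) * B k (suc m) a           ≡⟨ B-fix-zero k m a ⟩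
      ι (suc m) * B k m a                               ∎)
      where
      open ≤-Reasoning
      β = ½ * (1ℚ - p)
      0≤β : 0ℚ ≤ β
      0≤β = ½*a≥0 0≤1-p
      z+1+m+a≡n : z ℕ.+ suc m ℕ.+ a ≡ n
      z+1+m+a≡n = trans (cong (ℕ._+ a) (ℕₚ.+-suc z m)) z+m+a≡n
      z≤1+z : ι z ≤ ι (suc z)
      z≤1+z = ι-mono (ℕₚ.n≤1+n z)
      2z≤n-k′ : ι z + ι z ≤ ι n - ι k
      2z≤n-k′ = ≤-trans (+-mono-≤ z≤1+z z≤1+z) 2z≤n-k
      ιn : ι z + ι (suc m) + ι a ≡ ι n
      ιn = trans (sym (trans (ι-+ (z ℕ.+ suc m) a) (cong (_+ ι a) (ι-+ z (suc m))))) (cong ι z+1+m+a≡n)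
      ratio : β * ι (suc m) ≤ ι (suc m) - ι k + ι a
      ratio = begin
        β * ι (suc m)                      ≤⟨ *-monoˡ β 0≤β (ι-mono (subst (suc m ℕ.≤_) z+1+m+a≡n (ℕₚ.≤-trans (ℕₚ.m≤n+m (suc m) z) (ℕₚ.m≤m+n (z ℕ.+ suc m) a)))) ⟩
        β * ι n                            ≡⟨ solve 2 (λ p n → con ½ :* (con 1ℚ :- p) :* n := con ½ :* (n :- p :* n)) refl p (ι n) ⟩
        ½ * (ι n - p * ι n)                ≡⟨ cong (λ t → ½ * (ι n - t)) pn≡k ⟩
        ½ * (ι n - ι k)                    ≤⟨ a+a≤b⇒½*b≤b-a 2z≤n-k′ ⟩
        ι n - ι k - ι z                    ≡⟨ cong (λ t → t - ι k - ι z) (sym ιn) ⟩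
        ι z + ι (suc m) + ι a - ι k - ι z  ≡⟨ solve 4 (λ z m a k → z :+ m :+ a :- k :- z := m :- k :+ a) refl (ι z) (ι (suc m)) (ι a) (ι k) ⟩
        ι (suc m) - ι k + ι a              ∎

    -- It suffices to compare a pattern of i ≤ d zeros and a = 2d - i ones. The slice gives it at
    -- least N βⁱ uᵃ, the biased bits uᵃ (1 - u)ⁱ, which is at most uᵃ. The powers of u cancel,
    -- since u = p / 2 is also the lower bound for the ratios of the ones; the zeros, at most d of
    -- them, cost the factor β^d.
    slice-dominates : ∀ {d} (c : Subset n → ℚ) → Homogeneous d c →
      4 ℕ.* d ℕ.≤ k → 4 ℕ.* d ℕ.+ k ℕ.≤ n →
      N * (½ * (1ℚ - p)) ^ d * 𝔼ᵤ (½ * p) (λ x → poly c x ^ 2) ≤ ∑ (λ x → δ k ∣ x ∣ * poly c x ^ 2)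
    slice-dominates {d} c hom 4d≤k 4d+k≤n = 0≤q-p⇒p≤q (subst (0ℚ ≤_) split
      (signed-square-≥0 c hom w 2d≤n (λ i i≤d → subst (0ℚ ≤_) (sym (coefficient i)) (p≤q⇒0≤q-p (bound i i≤d)))))
      where
      open ≤-Reasoning
      u = ½ * p
      β = ½ * (1ℚ - p)
      A = N * β ^ d
      2d = d ℕ.+ d
      0≤β : 0ℚ ≤ β
      0≤β = ½*a≥0 0≤1-p
      0≤u : 0ℚ ≤ u
      0≤u = ½*a≥0 0≤p
      β≤1 : β ≤ 1ℚ
      β≤1 = ½*a≤1 0≤1-p (1-a≤1 0≤p)
      u≤1 : u ≤ 1ℚ
      u≤1 = ½*a≤1 0≤p p≤1
      0≤1-u : 0ℚ ≤ 1ℚ - u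
      0≤1-u = 0≤1-a u≤1
      1-u≤1 : 1ℚ - u ≤ 1ℚ
      1-u≤1 = 1-a≤1 0≤u
      4d≡2d+2d : 4 ℕ.* d ≡ 2d ℕ.+ 2d
      4d≡2d+2d = trans (cong (λ t → d ℕ.+ (d ℕ.+ (d ℕ.+ t))) (ℕₚ.+-identityʳ d)) (sym (ℕₚ.+-assoc d d 2d))
      2d+2d≤k : ι 2d + ι 2d ≤ ι k
      2d+2d≤k = subst (_≤ ι k) (trans (cong ι 4d≡2d+2d) (ι-+ 2d 2d)) (ι-mono 4d≤k)
      2d≤4d : 2d ℕ.≤ 4 ℕ.* d
      2d≤4d = subst (2d ℕ.≤_) (sym 4d≡2d+2d) (ℕₚ.m≤m+n 2d 2d)
      2d≤n : 2d ℕ.≤ n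
      2d≤n = ℕₚ.≤-trans 2d≤4d (ℕₚ.≤-trans 4d≤k k≤n)
      2d≤n-k : ι 2d ≤ ι n - ι k
      2d≤n-k = 0≤q-p⇒p≤q (subst (0ℚ ≤_)
        (trans (cong (λ t → ι n - t) (ι-+ 2d k)) (solve 3 (λ n d k → n :- (d :+ k) := n :- k :- d) refl (ι n) (ι 2d) (ι k)))
        (p≤q⇒0≤q-p (ι-mono (ℕₚ.≤-trans (ℕₚ.+-monoˡ-≤ k 2d≤4d) 4d+k≤n))))
      w : ℕ → ℚ
      w l = δ k l - A * weight n u l
      m = n ∸ 2d
      coefficient : ∀ i → binSum w m (2d ∸ i) ≡ B k m (2d ∸ i) - A * binSum (weight n u) m (2d ∸ i)
      coefficient i = trans (binSum-minus (δ k) (λ l → A * weight n u l) m (2d ∸ i))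
        (cong (λ t → B k m (2d ∸ i) - t) (binSum-*ˡ A (weight n u) m (2d ∸ i)))
      bound : ∀ i → i ℕ.≤ d → A * binSum (weight n u) m (2d ∸ i) ≤ B k m (2d ∸ i)
      bound i i≤d = begin
        A * binSum (weight n u) m a
          ≡⟨ cong (A *_) (binSum-weight u m a m+a≤n) ⟩
        N * β ^ d * (u ^ a * (1ℚ - u) ^ (n ∸ (m ℕ.+ a)))
          ≤⟨ *-mono (*-≥0 (^-≥0 a 0≤u) (^-≥0 (n ∸ (m ℕ.+ a)) 0≤1-u)) (*-≥0 (<⇒≤ N>0) (^-≥0 i 0≤β))
               (*-monoˡ N (<⇒≤ N>0) (^-antitone 0≤β β≤1 i≤d))
               (*-monoˡ (u ^ a) (^-≥0 a 0≤u) (^-≤1 (n ∸ (m ℕ.+ a)) 0≤1-u 1-u≤1)) ⟩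
        N * β ^ i * (u ^ a * 1ℚ)
          ≡⟨ solve 3 (λ n b u → n :* b :* (u :* con 1ℚ) := b :* (u :* n)) refl N (β ^ i) (u ^ a) ⟩
        β ^ i * (u ^ a * N)
          ≤⟨ *-monoˡ (β ^ i) (^-≥0 i 0≤β) (B-lower-ones a (i ℕ.+ m) i+m+a≡n 2a≤k) ⟩
        β ^ i * B k (i ℕ.+ m) a
          ≤⟨ B-lower-zeros i m a i+m+a≡n 2i≤n-k ⟩
        B k m a ∎
        where
        a = 2d ∸ i
        i≤2d : i ℕ.≤ 2d
        i≤2d = ℕₚ.≤-trans i≤d (ℕₚ.m≤m+n d d)
        i+m+a≡n : i ℕ.+ m ℕ.+ a ≡ n
        i+m+a≡n = trans (cong (ℕ._+ a) (ℕₚ.+-comm i m)) (trans (ℕₚ.+-assoc m i a)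
          (trans (cong (m ℕ.+_) (ℕₚ.m+[n∸m]≡n i≤2d)) (ℕₚ.m∸n+n≡m 2d≤n)))
        m+a≤n : m ℕ.+ a ℕ.≤ n
        m+a≤n = subst (m ℕ.+ a ℕ.≤_) i+m+a≡n (ℕₚ.+-monoˡ-≤ a (ℕₚ.m≤n+m m i))
        2a≤k : ι a + ι a ≤ ι k
        2a≤k = ≤-trans (+-mono-≤ a≤2d a≤2d) 2d+2d≤k
          where a≤2d = ι-mono (ℕₚ.m∸n≤m 2d i)
        2i≤n-k : ι i + ι i ≤ ι n - ι k
        2i≤n-k = ≤-trans (subst (_≤ ι 2d) (ι-+ i i) (ι-mono (ℕₚ.+-mono-≤ i≤d i≤d))) 2d≤n-k
      split : ∑ (λ x → w ∣ x ∣ * poly c x ^ 2)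
        ≡ ∑ (λ x → δ k ∣ x ∣ * poly c x ^ 2) - A * 𝔼ᵤ u (λ x → poly c x ^ 2)
      split = begin-equality
        ∑ (λ x → w ∣ x ∣ * poly c x ^ 2)
          ≡⟨ ∑-cong (λ x → solve 4 (λ d a w f → (d :- a :* w) :* f := d :* f :+ (con 0ℚ :- a) :* (w :* f)) refl (δ k ∣ x ∣) A (weight n u ∣ x ∣) (poly c x ^ 2)) ⟩
        ∑ (λ x → δ k ∣ x ∣ * poly c x ^ 2 + (0ℚ - A) * (weight n u ∣ x ∣ * poly c x ^ 2))
          ≡⟨ trans (∑-+ (λ x → δ k ∣ x ∣ * poly c x ^ 2) (λ x → (0ℚ - A) * (weight n u ∣ x ∣ * poly c x ^ 2)))
               (cong (X +_) (∑-*ˡ (0ℚ - A) (λ x → weight n u ∣ x ∣ * poly c x ^ 2))) ⟩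
        X + (0ℚ - A) * E
          ≡⟨ solve 3 (λ x a e → x :+ (con 0ℚ :- a) :* e := x :- a :* e) refl X A E ⟩
        X - A * E ∎
        where
        X = ∑ (λ x → δ k ∣ x ∣ * poly c x ^ 2)
        E = 𝔼ᵤ u (λ x → poly c x ^ 2)

  -- A slice polynomial is an average of its values on smaller sets

  -- Cauchy-Schwarz against the constant 1. Total mass at most one is enough, as the square vanishes
  -- at 0; the conditional law of W loses mass at the cutoff |W| ≤ k.
  jensen-square : ∀ {n} (w F : Subset n → ℚ) → (∀ x → 0ℚ ≤ w x) → ∑ w ≤ 1ℚ →
    ∑ (λ x → w x * F x) ^ 2 ≤ ∑ (λ x → w x * F x ^ 2)
  jensen-square {n} w F 0≤w ∑w≤1 = begin
    ∑ (λ x → w x * F x) ^ 2                        ≡⟨ cong (_^ 2) (∑-cong (λ x → cong (w x *_) (sym (*-identityʳ (F x))))) ⟩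
    ∑ (λ x → w x * (F x * 1ℚ)) ^ 2                 ≤⟨ cauchy-schwarz w F (λ _ → 1ℚ) 0≤w ⟩
    M * ∑ (λ x → w x * 1ℚ ^ 2)                     ≡⟨ cong (M *_) (∑-cong (λ x → *-identityʳ (w x))) ⟩
    M * ∑ w                                        ≤⟨ *-monoˡ M (∑-≥0 (λ x → *-≥0 (0≤w x) (a^2≥0 (F x)))) ∑w≤1 ⟩
    M * 1ℚ                                         ≡⟨ *-identityʳ M ⟩
    M                                              ∎
    where
    open ≤-Reasoning
    M = ∑ (λ x → w x * F x ^ 2)

  jensen-fourth : ∀ {n} (w F : Subset n → ℚ) → (∀ x → 0ℚ ≤ w x) → ∑ w ≤ 1ℚ →
    ∑ (λ x → w x * F x) ^ 4 ≤ ∑ (λ x → w x * F x ^ 4)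
  jensen-fourth {n} w F 0≤w ∑w≤1 = begin
    M ^ 4                                ≡⟨ ^4≡^2^2 M ⟩
    (M ^ 2) ^ 2                          ≤⟨ ^-mono 2 (a^2≥0 M) (jensen-square w F 0≤w ∑w≤1) ⟩
    ∑ (λ x → w x * F x ^ 2) ^ 2          ≤⟨ jensen-square w (λ x → F x ^ 2) 0≤w ∑w≤1 ⟩
    ∑ (λ x → w x * (F x ^ 2) ^ 2)        ≡⟨ ∑-cong (λ x → cong (w x *_) (sym (^4≡^2^2 (F x)))) ⟩
    ∑ (λ x → w x * F x ^ 4)              ∎
    where
    open ≤-Reasoning
    M = ∑ (λ x → w x * F x)

  ∑-below : ∀ {n} v (x : Subset n) → ∑ (λ W → e W x * v ∣ W ∣) ≡ binSum v ∣ x ∣ 0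
  ∑-below {n} v x = begin
    ∑ (λ W → e W x * v ∣ W ∣)                                    ≡⟨ ∑-cong (λ W → trans (sym (*-identityˡ _)) (cong (_* (e W x * v ∣ W ∣)) (sym (e-⊥ W)))) ⟩
    ∑ (λ W → e (⊥ {n}) W * (e W x * v ∣ W ∣))                    ≡⟨ ∑-between v (⊥ {n}) x ⟩
    e (⊥ {n}) x * binSum v ((∣ x ∣) ∸ (∣ ⊥ {n} ∣)) (∣ ⊥ {n} ∣)     ≡⟨ cong₂ (λ a j → a * binSum v (∣ x ∣ ∸ j) j) (e-⊥ x) (∣⊥∣≡0 n) ⟩
    1ℚ * binSum v (∣ x ∣) 0                                        ≡⟨ *-identityˡ _ ⟩
    binSum v (∣ x ∣) 0                                             ∎
    where open ≡-Reasoning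

  ∑-pairs : ∀ {n} j (v : ℕ → ℚ) (G : Subset n → ℚ) →
    ∑ (λ x → δ j ∣ x ∣ * ∑ (λ W → e W x * v ∣ W ∣ * G W)) ≡ ∑ (λ W → v ∣ W ∣ * B j (n ∸ ∣ W ∣) ∣ W ∣ * G W)
  ∑-pairs {n} j v G = begin
    ∑ (λ x → δ j ∣ x ∣ * ∑ (λ W → e W x * v ∣ W ∣ * G W))
      ≡⟨ ∑-cong (λ x → trans (sym (∑-*ˡ (δ j ∣ x ∣) (λ W → e W x * v ∣ W ∣ * G W)))
           (∑-cong (λ W → solve 4 (λ d e v g → d :* (e :* v :* g) := v :* g :* (e :* d)) refl (δ j ∣ x ∣) (e W x) (v ∣ W ∣) (G W)))) ⟩
    ∑ (λ x → ∑ (λ W → v ∣ W ∣ * G W * (e W x * δ j ∣ x ∣)))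
      ≡⟨ ∑-swap (λ x W → v ∣ W ∣ * G W * (e W x * δ j ∣ x ∣)) ⟩
    ∑ (λ W → ∑ (λ x → v ∣ W ∣ * G W * (e W x * δ j ∣ x ∣)))
      ≡⟨ ∑-cong (λ W → trans (∑-*ˡ (v ∣ W ∣ * G W) (λ x → e W x * δ j ∣ x ∣)) (trans (cong (v ∣ W ∣ * G W *_) (∑-above (δ j) W))
           (solve 3 (λ v g b → v :* g :* b := v :* b :* g) refl (v ∣ W ∣) (G W) (B j (n ∸ ∣ W ∣) ∣ W ∣)))) ⟩
    ∑ (λ W → v ∣ W ∣ * B j (n ∸ ∣ W ∣) ∣ W ∣ * G W) ∎
    where open ≡-Reasoning

  -- The subset-of-a-subset identity (m choose j) (j choose l) = (m choose l) (m-l choose j-l),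
  -- summed against v: both sides count the pairs of W contained in x with |x| = j.
  binSum-pairs-0 : ∀ m j (v : ℕ → ℚ) → B j m 0 * binSum v j 0 ≡ binSum (λ l → v l * B j (m ∸ l) l) m 0
  binSum-pairs-0 m j v = begin
    B j m 0 * binSum v j 0
      ≡⟨ cong (_* binSum v j 0) (sym (∑-size m (δ j))) ⟩
    ∑ {m} (λ x → δ j ∣ x ∣) * binSum v j 0
      ≡⟨ sym (∑-*ʳ (binSum v j 0) (λ (x : Subset m) → δ j ∣ x ∣)) ⟩
    ∑ {m} (λ x → δ j ∣ x ∣ * binSum v j 0)
      ≡⟨ ∑-cong {m} (λ x → δ-cong {j} {∣ x ∣} (λ { refl → trans (sym (∑-below v x)) (∑-cong (λ W → sym (*-identityʳ (e W x * v ∣ W ∣)))) })) ⟩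
    ∑ {m} (λ x → δ j ∣ x ∣ * ∑ (λ W → e W x * v ∣ W ∣ * 1ℚ))
      ≡⟨ ∑-pairs {m} j v (λ _ → 1ℚ) ⟩
    ∑ {m} (λ W → v ∣ W ∣ * B j (m ∸ ∣ W ∣) ∣ W ∣ * 1ℚ)
      ≡⟨ ∑-cong {m} (λ W → *-identityʳ (v ∣ W ∣ * B j (m ∸ ∣ W ∣) ∣ W ∣)) ⟩
    ∑ {m} (λ W → v ∣ W ∣ * B j (m ∸ ∣ W ∣) ∣ W ∣)
      ≡⟨ ∑-size m (λ l → v l * B j (m ∸ l) l) ⟩
    binSum (λ l → v l * B j (m ∸ l) l) m 0 ∎
    where open ≡-Reasoning

  -- The same count of pairs when d fixed elements are required to lie in W.
  binSum-pairs : ∀ {d k} n v → d ℕ.≤ k →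
    B k (n ∸ d) d * binSum v (k ∸ d) d ≡ binSum (λ l → v l * B k (n ∸ l) l) (n ∸ d) d
  binSum-pairs {d} {k} n v d≤k = begin
    B k (n ∸ d) d * binSum v (k ∸ d) d
      ≡⟨ cong₂ _*_ (sym (shift-B (n ∸ d))) (sym (shift v (k ∸ d))) ⟩
    B (k ∸ d) (n ∸ d) 0 * binSum (v ∘ (d ℕ.+_)) (k ∸ d) 0
      ≡⟨ binSum-pairs-0 (n ∸ d) (k ∸ d) (v ∘ (d ℕ.+_)) ⟩
    binSum (λ l → v (d ℕ.+ l) * B (k ∸ d) (n ∸ d ∸ l) l) (n ∸ d) 0
      ≡⟨ binSum-cong (n ∸ d) 0 (λ l _ → cong (v (d ℕ.+ l) *_) (trans (cong (λ j → B (k ∸ d) j l) (ℕₚ.∸-+-assoc n d l)) (shift-B′ (n ∸ (d ℕ.+ l)) l))) ⟩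
    binSum (λ l → v (d ℕ.+ l) * B k (n ∸ (d ℕ.+ l)) (d ℕ.+ l)) (n ∸ d) 0
      ≡⟨ shift (λ l → v l * B k (n ∸ l) l) (n ∸ d) ⟩
    binSum (λ l → v l * B k (n ∸ l) l) (n ∸ d) d ∎
    where
    open ≡-Reasoning
    shift : ∀ v m → binSum (v ∘ (d ℕ.+_)) m 0 ≡ binSum v m d
    shift v m = trans (binSum-shift v m d 0) (cong (binSum v m) (ℕₚ.+-identityʳ d))
    shift-B′ : ∀ m l → B (k ∸ d) m l ≡ B k m (d ℕ.+ l)
    shift-B′ m l = trans (binSum-cong m l (λ j _ → sym (δ-shift j d≤k))) (binSum-shift (δ k) m d l)
    shift-B : ∀ m → B (k ∸ d) m 0 ≡ B k m d
    shift-B m = trans (shift-B′ m 0) (cong (B k m) (ℕₚ.+-identityʳ d))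

  module SliceAverage {p : ℚ} {n k : ℕ} (0<p : 0ℚ < p) (p≤1 : p ≤ 1ℚ) (pn≡k : p * ι n ≡ ι k) where

    private
      0≤p = <⇒≤ 0<p
      N = B k n 0
    open Slice {p} {n} {k} 0≤p p≤1 pn≡k
    private
      u = ½ * p
      0≤u : 0ℚ ≤ u
      0≤u = ½*a≥0 0≤p
      u≤1 : u ≤ 1ℚ
      u≤1 = ½*a≤1 0≤p p≤1

      -- The number of sets of size k that contain a given set of size l.
      above : ℕ → ℚ
      above l = B k (n ∸ l) l

      -- Σ_{W ⊆ x} v |W| F(W) is, for |x| = k, the conditional expectation of F(W) 1[|W| ≤ k]
      -- given x, when W is u-biased and x is a random superset of W of size k.
      v : ℕ → ℚ
      v l = weight n u l * (N * inv (above l))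

      v-≥0 : ∀ l → 0ℚ ≤ v l
      v-≥0 l = *-≥0 (weight-≥0 n l 0≤u u≤1) (*-≥0 (<⇒≤ N>0) (inv-≥0 (B-≥0 k (n ∸ l) l)))

      v-above : ∀ l → v l * above l ≡ N * weight n u l * (above l * inv (above l))
      v-above l = solve 4 (λ w n i b → w :* (n :* i) :* b := n :* w :* (b :* i)) refl (weight n u l) N (inv (above l)) (above l)

      v-above-≤ : ∀ l → v l * above l ≤ N * weight n u l
      v-above-≤ l = begin
        v l * above l                                 ≡⟨ v-above l ⟩
        N * weight n u l * (above l * inv (above l))  ≤⟨ *-monoˡ (N * weight n u l) (*-≥0 (<⇒≤ N>0) (weight-≥0 n l 0≤u u≤1)) (*-inv-≤1 (above l)) ⟩
        N * weight n u l * 1ℚ                         ≡⟨ *-identityʳ _ ⟩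
        N * weight n u l                              ∎
        where open ≤-Reasoning

      v-above-≤k : ∀ l → l ℕ.≤ k → v l * above l ≡ N * weight n u l
      v-above-≤k l l≤k = begin
        v l * above l                                 ≡⟨ v-above l ⟩
        N * weight n u l * (above l * inv (above l))  ≡⟨ cong (N * weight n u l *_) (*-invʳ (≢-sym (<⇒≢ (B->0 (n ∸ l) l l≤k (subst (k ℕ.≤_) (sym (ℕₚ.m∸n+n≡m (ℕₚ.≤-trans l≤k k≤n))) k≤n))))) ⟩
        N * weight n u l * 1ℚ                         ≡⟨ *-identityʳ _ ⟩
        N * weight n u l                              ∎
        where open ≡-Reasoning

      v-total : binSum v k 0 ≤ 1ℚ
      v-total = *-cancelˡ N N>0 (begin
        N * binSum v k 0                       ≡⟨ binSum-pairs-0 n k v ⟩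
        binSum (λ l → v l * above l) n 0       ≤⟨ binSum-mono n 0 (λ l _ _ → v-above-≤ l) ⟩
        binSum (λ l → N * weight n u l) n 0    ≡⟨ trans (binSum-*ˡ N (weight n u) n 0) (cong (N *_) (binSum-weight-total n u)) ⟩
        N * 1ℚ                                 ∎)
        where open ≤-Reasoning

    -- For S contained in x, |S| = d and |x| = k, this is the sum of `v |W|` over all W between S
    -- and x: the conditional probability given x that W contains S and has at most k elements. It
    -- depends on S only through d.
    τ : ℕ → ℚ
    τ d = binSum v (k ∸ d) d

    slice-average : ∀ {d} (c : Subset n → ℚ) → Homogeneous d c → ∀ x → k ≡ ∣ x ∣ →
      ∑ (λ W → e W x * v ∣ W ∣ * poly c W) ≡ τ d * poly c x
    slice-average {d} c hom x |x|≡k = begin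
      ∑ (λ W → e W x * v ∣ W ∣ * poly c W)
        ≡⟨ ∑-cong (λ W → trans (sym (∑-*ˡ (e W x * v ∣ W ∣) (λ S → c S * e S W)))
             (∑-cong (λ S → solve 3 (λ a c e → a :* (c :* e) := c :* (e :* a)) refl (e W x * v ∣ W ∣) (c S) (e S W)))) ⟩
      ∑ (λ W → ∑ (λ S → c S * (e S W * (e W x * v ∣ W ∣))))
        ≡⟨ ∑-swap (λ W S → c S * (e S W * (e W x * v ∣ W ∣))) ⟩
      ∑ (λ S → ∑ (λ W → c S * (e S W * (e W x * v ∣ W ∣))))
        ≡⟨ ∑-cong (λ S → trans (∑-*ˡ (c S) (λ W → e S W * (e W x * v ∣ W ∣))) (trans (cong (c S *_) (∑-between v S x))
             (trans (hom-cong c hom S (λ |S|≡d → cong₂ (λ i j → e S x * binSum v (i ∸ j) j) (sym |x|≡k) |S|≡d))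
               (solve 3 (λ c e t → c :* (e :* t) := t :* (c :* e)) refl (c S) (e S x) (τ d))))) ⟩
      ∑ (λ S → τ d * (c S * e S x))
        ≡⟨ ∑-*ˡ (τ d) (λ S → c S * e S x) ⟩
      τ d * poly c x ∎
      where open ≡-Reasoning

    -- Jensen's inequality for each x of the slice, then the sum over x: a set W receives the total
    -- weight `v |W| * above |W|`, which is at most N times its u-biased probability.
    slice-fourth : ∀ {d} (c : Subset n → ℚ) → Homogeneous d c →
      τ d ^ 4 * ∑ (λ x → δ k ∣ x ∣ * poly c x ^ 4) ≤ N * 𝔼ᵤ u (λ x → poly c x ^ 4)
    slice-fourth {d} c hom = begin
      τ d ^ 4 * ∑ (λ x → δ k ∣ x ∣ * poly c x ^ 4)
        ≡⟨ trans (sym (∑-*ˡ (τ d ^ 4) (λ x → δ k ∣ x ∣ * poly c x ^ 4)))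
             (∑-cong (λ x → solve 3 (λ t d f → t :^ 4 :* (d :* f :^ 4) := d :* (t :* f) :^ 4) refl (τ d) (δ k ∣ x ∣) (poly c x))) ⟩
      ∑ (λ x → δ k ∣ x ∣ * (τ d * poly c x) ^ 4)
        ≤⟨ ∑-mono (λ x → δ-mono {k} {∣ x ∣} (pointwise x)) ⟩
      ∑ (λ x → δ k ∣ x ∣ * ∑ (λ W → e W x * v ∣ W ∣ * poly c W ^ 4))
        ≡⟨ ∑-pairs k v (λ W → poly c W ^ 4) ⟩
      ∑ (λ W → v ∣ W ∣ * above ∣ W ∣ * poly c W ^ 4)
        ≤⟨ ∑-mono (λ W → *-monoʳ (poly c W ^ 4) (a^4≥0 (poly c W)) (v-above-≤ ∣ W ∣)) ⟩
      ∑ (λ W → N * weight n u ∣ W ∣ * poly c W ^ 4)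
        ≡⟨ trans (∑-cong (λ W → *-assoc N (weight n u ∣ W ∣) (poly c W ^ 4))) (∑-*ˡ N (λ W → weight n u ∣ W ∣ * poly c W ^ 4)) ⟩
      N * 𝔼ᵤ u (λ x → poly c x ^ 4) ∎
      where
      open ≤-Reasoning
      pointwise : ∀ x → k ≡ ∣ x ∣ → (τ d * poly c x) ^ 4 ≤ ∑ (λ W → e W x * v ∣ W ∣ * poly c W ^ 4)
      pointwise x k≡|x| = subst (λ t → t ^ 4 ≤ ∑ (λ W → e W x * v ∣ W ∣ * poly c W ^ 4)) (slice-average c hom x k≡|x|)
        (jensen-fourth (λ W → e W x * v ∣ W ∣) (poly c) (λ W → *-≥0 (e-≥0 W x) (v-≥0 ∣ W ∣))
          (subst (_≤ 1ℚ) (sym (trans (∑-below v x) (cong (λ j → binSum v j 0) (sym k≡|x|)))) v-total))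

    -- Markov's inequality: W ⊇ S has more than k elements with probability at most 3/4.
    τ-lower : ∀ d → d ℕ.< k → 4 ℕ.* d ℕ.≤ k → ½ ^ d ≤ ι 4 * τ d
    τ-lower d d<k 4d≤k = *-cancelˡ (p ^ d * N) (*->0 (^->0 d 0<p) N>0) (begin
      p ^ d * N * ½ ^ d                ≡⟨ solve 3 (λ p n h → p :* n :* h := n :* (h :* p)) refl (p ^ d) N (½ ^ d) ⟩
      N * (½ ^ d * p ^ d)              ≡⟨ cong (N *_) (sym (^-distrib-* ½ p d)) ⟩
      N * u ^ d                        ≤⟨ scaled ⟩
      ι 4 * (above d * τ d)            ≤⟨ *-monoˡ (ι 4) (ι-≥0 4) (*-monoʳ (τ d) (binSum-≥0 (k ∸ d) d v-≥0) (B-upper d (n ∸ d) (ℕₚ.m∸n+n≡m d≤n))) ⟩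
      ι 4 * (p ^ d * N * τ d)          ≡⟨ solve 2 (λ a t → con (ι 4) :* (a :* t) := a :* (con (ι 4) :* t)) refl (p ^ d * N) (τ d) ⟩
      p ^ d * N * (ι 4 * τ d)          ∎)
      where
      open ≤-Reasoning
      d≤n : d ℕ.≤ n
      d≤n = ℕₚ.≤-trans (ℕₚ.<⇒≤ d<k) k≤n
      J : ℚ
      J = ι k - ι d
      0<J : 0ℚ < J
      0<J = subst (_< J) (+-inverseʳ (ι d)) (+-monoˡ-< (- ι d) (ι-mono-< d<k))
      m = n ∸ suc d
      free : n ∸ d ≡ suc m
      free = ℕₚ.+-∸-assoc 1 (ℕₚ.≤-trans d<k k≤n)
      total : binSum (weight n u) (n ∸ d) d ≡ u ^ d
      total = trans (binSum-weight u (n ∸ d) d (ℕₚ.≤-reflexive (ℕₚ.m∸n+n≡m d≤n)))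
        (trans (cong (λ j → u ^ d * (1ℚ - u) ^ (n ∸ j)) (ℕₚ.m∸n+n≡m d≤n))
          (trans (cong (λ j → u ^ d * (1ℚ - u) ^ j) (ℕₚ.n∸n≡0 n)) (*-identityʳ (u ^ d))))
      -- The expected number of elements of W outside S, on the event that W contains S.
      excess : binSum (λ l → (ι l - ι d) * weight n u l) (n ∸ d) d ≡ (ι n - ι d) * (u * u ^ d)
      excess = begin-equality
        binSum (λ l → (ι l - ι d) * weight n u l) (n ∸ d) d   ≡⟨ cong (λ j → binSum (λ l → (ι l - ι d) * weight n u l) j d) free ⟩
        binSum (λ l → (ι l - ι d) * weight n u l) (suc m) d   ≡⟨ binSum-weighted (weight n u) m d ⟩
        ι (suc m) * binSum (weight n u) m (suc d)             ≡⟨ cong (ι (suc m) *_) (binSum-weight u m (suc d) (ℕₚ.≤-reflexive m+1+d≡n)) ⟩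
        ι (suc m) * (u ^ suc d * (1ℚ - u) ^ (n ∸ (m ℕ.+ suc d)))  ≡⟨ cong (λ j → ι (suc m) * (u ^ suc d * (1ℚ - u) ^ j)) (trans (cong (n ∸_) m+1+d≡n) (ℕₚ.n∸n≡0 n)) ⟩
        ι (suc m) * (u ^ suc d * 1ℚ)                          ≡⟨ cong₂ _*_ (trans (solve 2 (λ m d → m := m :+ d :- d) refl (ι (suc m)) (ι d)) (cong (_- ι d) ιm+ιd)) (*-identityʳ (u ^ suc d)) ⟩
        (ι n - ι d) * (u * u ^ d)                             ∎
        where
        m+1+d≡n : m ℕ.+ suc d ≡ n
        m+1+d≡n = ℕₚ.m∸n+n≡m (ℕₚ.≤-trans d<k k≤n)
        ιm+ιd : ι (suc m) + ι d ≡ ι n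
        ιm+ιd = trans (sym (ι-+ (suc m) d)) (cong ι (trans (sym (ℕₚ.+-suc m d)) m+1+d≡n))
      -- The pointwise form of Markov's inequality, cleared of denominators: the indicator of l ≤ k
      -- is at least 1 - (l - d) / J, which is negative beyond k.
      truncate : ∀ l → d ℕ.≤ l → N * ((J - (ι l - ι d)) * weight n u l) ≤ J * (v l * above l)
      truncate l d≤l with l ℕ.≤? k
      ... | yes l≤k = begin
        N * ((J - (ι l - ι d)) * weight n u l)  ≤⟨ *-monoˡ N (<⇒≤ N>0) (*-monoʳ {J - (ι l - ι d)} {J} (weight n u l) (weight-≥0 n l 0≤u u≤1)
                                                     (0≤q-p⇒p≤q (subst (0ℚ ≤_) (solve 2 (λ j t → t := j :- (j :- t)) refl J (ι l - ι d)) (p≤q⇒0≤q-p {ι d} {ι l} (ι-mono d≤l))))) ⟩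
        N * (J * weight n u l)                  ≡⟨ solve 3 (λ n j w → n :* (j :* w) := j :* (n :* w)) refl N J (weight n u l) ⟩
        J * (N * weight n u l)                  ≡⟨ cong (J *_) (sym (v-above-≤k l l≤k)) ⟩
        J * (v l * above l)                     ∎
      ... | no  l≰k = ≤-trans
        (0≤q-p⇒p≤q (subst (0ℚ ≤_)
          (solve 5 (λ n k d l w → n :* ((l :- k) :* w) := con 0ℚ :- n :* ((k :- d :- (l :- d)) :* w)) refl N (ι k) (ι d) (ι l) (weight n u l))
          (*-≥0 (<⇒≤ N>0) (*-≥0 (p≤q⇒0≤q-p (ι-mono (ℕₚ.<⇒≤ (ℕₚ.≰⇒> l≰k)))) (weight-≥0 n l 0≤u u≤1)))))
        (*-≥0 (<⇒≤ 0<J) (*-≥0 (v-≥0 l) (B-≥0 k (n ∸ l) l)))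
      markov : N * (J * u ^ d - (ι n - ι d) * (u * u ^ d)) ≤ J * (above d * τ d)
      markov = begin
        N * (J * u ^ d - (ι n - ι d) * (u * u ^ d))
          ≡⟨ cong (N *_) (sym (trans (binSum-cong (n ∸ d) d (λ l _ → solve 3 (λ j t w → (j :- t) :* w := j :* w :- t :* w) refl J (ι l - ι d) (weight n u l)))
               (trans (binSum-minus (λ l → J * weight n u l) (λ l → (ι l - ι d) * weight n u l) (n ∸ d) d)
                 (cong₂ _-_ (trans (binSum-*ˡ J (weight n u) (n ∸ d) d) (cong (J *_) total)) excess)))) ⟩
        N * binSum (λ l → (J - (ι l - ι d)) * weight n u l) (n ∸ d) d
          ≡⟨ sym (binSum-*ˡ N (λ l → (J - (ι l - ι d)) * weight n u l) (n ∸ d) d) ⟩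
        binSum (λ l → N * ((J - (ι l - ι d)) * weight n u l)) (n ∸ d) d
          ≤⟨ binSum-mono (n ∸ d) d (λ l d≤l _ → truncate l d≤l) ⟩
        binSum (λ l → J * (v l * above l)) (n ∸ d) d
          ≡⟨ trans (binSum-*ˡ J (λ l → v l * above l) (n ∸ d) d) (cong (J *_) (sym (binSum-pairs n v (ℕₚ.<⇒≤ d<k)))) ⟩
        J * (above d * τ d) ∎
      4ιd≤ιk : ι d + (ι d + (ι d + (ι d + 0ℚ))) ≤ ι k
      4ιd≤ιk = subst (_≤ ι k) (trans (ι-+ d _) (cong (ι d +_) (trans (ι-+ d _) (cong (ι d +_) (trans (ι-+ d _) (cong (ι d +_) (ι-+ d 0))))))) (ι-mono 4d≤k)
      -- As n u = k / 2, the difference of the two sides is (k - 4d) + d + 4ud. This is where 4d ≤ k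
      -- enters: the mean number of extra elements is at most 3/4 of the room J.
      quarter : J ≤ ι 4 * (J - (ι n - ι d) * u)
      quarter = 0≤q-p⇒p≤q (subst (0ℚ ≤_)
        (trans (solve 2 (λ b k → b := b :+ con (ι 2) :* (k :- k)) refl slack (ι k))
          (trans (cong (λ t → slack + ι 2 * (ι k - t)) (sym pn≡k))
            (solve 4 (λ k d n p → k :- (d :+ (d :+ (d :+ (d :+ con 0ℚ)))) :+ d :+ con (ι 4) :* (con ½ :* p) :* d :+ con (ι 2) :* (k :- p :* n)
               := con (ι 4) :* (k :- d :- (n :- d) :* (con ½ :* p)) :- (k :- d)) refl (ι k) (ι d) (ι n) p)))
        (+-≥0 (+-≥0 (p≤q⇒0≤q-p 4ιd≤ιk) (ι-≥0 d)) (*-≥0 (*-≥0 (ι-≥0 4) 0≤u) (ι-≥0 d))))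
        where
        slack = ι k - (ι d + (ι d + (ι d + (ι d + 0ℚ)))) + ι d + ι 4 * u * ι d
      scaled : N * u ^ d ≤ ι 4 * (above d * τ d)
      scaled = *-cancelˡ J 0<J (begin
        J * (N * u ^ d)                                            ≤⟨ *-monoʳ (N * u ^ d) (*-≥0 (<⇒≤ N>0) (^-≥0 d 0≤u)) quarter ⟩
        ι 4 * (J - (ι n - ι d) * u) * (N * u ^ d)                  ≡⟨ solve 5 (λ j t u n q → con (ι 4) :* (j :- t :* u) :* (n :* q) := con (ι 4) :* (n :* (j :* q :- t :* (u :* q)))) refl J (ι n - ι d) u N (u ^ d) ⟩
        ι 4 * (N * (J * u ^ d - (ι n - ι d) * (u * u ^ d)))        ≤⟨ *-monoˡ (ι 4) (ι-≥0 4) markov ⟩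
        ι 4 * (J * (above d * τ d))                                ≡⟨ solve 2 (λ j t → con (ι 4) :* (j :* t) := j :* (con (ι 4) :* t)) refl J (above d * τ d) ⟩
        J * (ι 4 * (above d * τ d))                                ∎)

  -- Small slices

  bernoulli : ∀ {v} q → 0ℚ ≤ v → v ≤ 1ℚ → 1ℚ - ι q * v ≤ (1ℚ - v) ^ q
  bernoulli {v} zero    0≤v v≤1 = ≤-reflexive (solve 1 (λ v → con 1ℚ :- con 0ℚ :* v := con 1ℚ) refl v)
  bernoulli {v} (suc q) 0≤v v≤1 = begin
    1ℚ - ι (suc q) * v              ≤⟨ 0≤q-p⇒p≤q (subst (0ℚ ≤_)
      (solve 2 (λ q v → q :* (v :* v) := (con 1ℚ :- v) :* (con 1ℚ :- q :* v) :- (con 1ℚ :- (con 1ℚ :+ q) :* v)) refl (ι q) v)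
      (*-≥0 (ι-≥0 q) (a*a≥0 v))) ⟩
    (1ℚ - v) * (1ℚ - ι q * v)       ≤⟨ *-monoˡ (1ℚ - v) (0≤1-a v≤1) (bernoulli q 0≤v v≤1) ⟩
    (1ℚ - v) ^ suc q                ∎
    where open ≤-Reasoning

  -- The slice is an event under r-biased bits, so its probability is at most one. The bias r is
  -- free and is chosen to bound the size of the slice.
  slice-mass : ∀ {r} n k → 0ℚ ≤ r → r ≤ 1ℚ → B k n 0 * weight n r k ≤ 1ℚ
  slice-mass {r} n k 0≤r r≤1 = begin
    B k n 0 * weight n r k                       ≡⟨ *-comm (B k n 0) (weight n r k) ⟩
    weight n r k * B k n 0                       ≡⟨ sym (binSum-*ˡ (weight n r k) (δ k) n 0) ⟩
    binSum (λ l → weight n r k * δ k l) n 0      ≤⟨ binSum-mono n 0 (λ l _ _ → pointwise l) ⟩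
    binSum (weight n r) n 0                      ≡⟨ binSum-weight-total n r ⟩
    1ℚ                                           ∎
    where
    open ≤-Reasoning
    pointwise : ∀ l → weight n r k * δ k l ≤ weight n r l
    pointwise l with k ℕ.≟ l
    ... | yes refl rewrite δ-diag k = ≤-reflexive (*-identityʳ (weight n r k))
    ... | no  k≢l  rewrite δ-off k≢l = subst (_≤ weight n r l) (sym (*-zeroʳ (weight n r k))) (weight-≥0 n l 0≤r r≤1)

  -- The exponent n is traded for j. With q = floor (n / j) + 1 one has n ≤ qj ≤ 2n, hence qr ≤ 2
  -- and qv ≤ 1/2 for v = r / 4. Bernoulli's inequality then gives (1 - v)^q ≥ 1/2, and the j-th
  -- power of this bounds (1 - v)^n.
  power-lower : ∀ {r n} j → .{{ℕ.NonZero j}} → 0ℚ ≤ r → r ≤ 1ℚ → 0ℚ < ι n → r * ι n ≡ ι j →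
    let v = ½ * (½ * r) in (½ * v) ^ j ≤ v ^ j * (1ℚ - v) ^ n
  power-lower {r} {n} j 0≤r r≤1 0<n rn≡j = begin
    (½ * v) ^ j                  ≡⟨ trans (cong (_^ j) (*-comm ½ v)) (^-distrib-* v ½ j) ⟩
    v ^ j * ½ ^ j                ≤⟨ *-monoˡ (v ^ j) (^-≥0 j 0≤v) (begin
      ½ ^ j                        ≤⟨ ^-mono j (nonNegative⁻¹ ½) (≤-trans half (bernoulli q 0≤v v≤1)) ⟩
      ((1ℚ - v) ^ q) ^ j           ≡⟨ ^-assocʳ (1ℚ - v) q j ⟩
      (1ℚ - v) ^ (q ℕ.* j)         ≤⟨ ^-antitone (0≤1-a v≤1) (1-a≤1 0≤v) n≤qj ⟩
      (1ℚ - v) ^ n                 ∎) ⟩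
    v ^ j * (1ℚ - v) ^ n         ∎
    where
    open ≤-Reasoning
    v = ½ * (½ * r)
    q = suc (n / j)
    0≤v : 0ℚ ≤ v
    0≤v = ½*a≥0 (½*a≥0 0≤r)
    v≤1 : v ≤ 1ℚ
    v≤1 = ½*a≤1 (½*a≥0 0≤r) (½*a≤1 0≤r r≤1)
    j≤n : j ℕ.≤ n
    j≤n = ι-cancel-≤ (subst₂ _≤_ rn≡j (*-identityˡ (ι n)) (*-monoʳ (ι n) (<⇒≤ 0<n) r≤1))
    n≤qj : n ℕ.≤ q ℕ.* j
    n≤qj = subst (ℕ._≤ q ℕ.* j) (sym (m≡m%n+[m/n]*n n j)) (ℕₚ.+-monoˡ-≤ (n / j ℕ.* j) (ℕₚ.<⇒≤ (m%n<n n j)))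
    qj≤2n : q ℕ.* j ℕ.≤ n ℕ.+ n
    qj≤2n = ℕₚ.+-mono-≤ j≤n (m/n*n≤m n j)
    qr≤2 : ι q * r ≤ ι 2
    qr≤2 = *-cancelˡ (ι n) 0<n (begin
      ι n * (ι q * r)      ≡⟨ solve 3 (λ n q r → n :* (q :* r) := q :* (r :* n)) refl (ι n) (ι q) r ⟩
      ι q * (r * ι n)      ≡⟨ cong (ι q *_) rn≡j ⟩
      ι q * ι j            ≡⟨ sym (ι-* q j) ⟩
      ι (q ℕ.* j)          ≤⟨ ι-mono qj≤2n ⟩
      ι (n ℕ.+ n)          ≡⟨ ι-+ n n ⟩
      ι n + ι n            ≡⟨ solve 1 (λ n → n :+ n := n :* con (ι 2)) refl (ι n) ⟩
      ι n * ι 2            ∎)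
    half : ½ ≤ 1ℚ - ι q * v
    half = 0≤q-p⇒p≤q (subst (0ℚ ≤_)
      (solve 2 (λ q r → con ½ :* con ½ :* (con (ι 2) :- q :* r) := con 1ℚ :- q :* (con ½ :* (con ½ :* r)) :- con ½) refl (ι q) r)
      (*-≥0 (*-≥0 0≤½ 0≤½) (p≤q⇒0≤q-p qr≤2)))

  divide-power : ∀ {x y a b} m → 0ℚ ≤ x → x * y ≡ 1ℚ → a * y ^ m ≤ b → a ≤ b * x ^ m
  divide-power {x} {y} {a} {b} m 0≤x xy≡1 h = begin
    a                      ≡⟨ sym (*-identityʳ a) ⟩
    a * 1ℚ                 ≡⟨ cong (a *_) (sym (trans (sym (^-distrib-* x y m)) (trans (cong (_^ m) xy≡1) (1^n≡1 m)))) ⟩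
    a * (x ^ m * y ^ m)    ≡⟨ solve 3 (λ a x y → a :* (x :* y) := a :* y :* x) refl a (x ^ m) (y ^ m) ⟩
    a * y ^ m * x ^ m      ≤⟨ *-monoʳ (x ^ m) (^-≥0 m 0≤x) h ⟩
    b * x ^ m              ∎
    where open ≤-Reasoning

  ^-swap : ∀ a m n → (a ^ m) ^ n ≡ (a ^ n) ^ m
  ^-swap a m n = trans (^-assocʳ a m n) (trans (cong (a ^_) (ℕₚ.*-comm m n)) (sym (^-assocʳ a n m)))

  4*m≤n⇒m<n : ∀ {n} m → 0 ℕ.< n → 4 ℕ.* m ℕ.≤ n → m ℕ.< n
  4*m≤n⇒m<n zero    0<n _    = 0<n
  4*m≤n⇒m<n (suc m) _   4m≤n = ℕₚ.<-≤-trans (s≤s (ℕₚ.m<m+n m (s≤s z≤n))) 4m≤n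

  -- Unnormalised form of E F⁴ ≤ N (E F²)²; a sum of squares of nonnegative numbers is at most the
  -- square of their sum.
  fourth-≤-second : ∀ {n} k (F : Subset n → ℚ) → ∑ (λ x → δ k ∣ x ∣ * F x ^ 4) ≤ ∑ (λ x → δ k ∣ x ∣ * F x ^ 2) ^ 2
  fourth-≤-second k F = begin
    ∑ (λ x → δ k ∣ x ∣ * F x ^ 4)           ≡⟨ ∑-cong (λ x → idem x) ⟩
    ∑ (λ x → (δ k ∣ x ∣ * F x ^ 2) ^ 2)     ≤⟨ ∑-squares (λ x → *-≥0 (δ-≥0 k ∣ x ∣) (a^2≥0 (F x))) ⟩
    ∑ (λ x → δ k ∣ x ∣ * F x ^ 2) ^ 2       ∎
    where
    open ≤-Reasoning
    idem : ∀ x → δ k ∣ x ∣ * F x ^ 4 ≡ (δ k ∣ x ∣ * F x ^ 2) ^ 2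
    idem x = trans (δ-cong {k} {∣ x ∣} (λ { refl → trans (sym (*-identityˡ (F x ^ 4))) (cong (_* F x ^ 4) (sym (δ-diag k))) }))
      (solve 2 (λ d f → d :* (d :* f :^ 4) := (d :* f :^ 2) :^ 2) refl (δ k ∣ x ∣) (F x))

  -- Here s and t stand for 1 / (1 − p) and 1 / p.
  module SliceBound {p s t : ℚ} {n k : ℕ} (0<p : 0ℚ < p) (p<1 : p < 1ℚ) (s*[1-p]≡1 : s * (1ℚ - p) ≡ 1ℚ) (t*p≡1 : t * p ≡ 1ℚ)
    (0<n : 0ℚ < ι n) (pn≡k : p * ι n ≡ ι k) where

    private
      N = B k n 0
      0≤p = <⇒≤ 0<p
      p≤1 = <⇒≤ p<1
      0<1-p : 0ℚ < 1ℚ - p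
      0<1-p = subst (_< 1ℚ - p) (+-inverseʳ p) (+-monoˡ-< (- p) p<1)
      0≤1-p = <⇒≤ 0<1-p
      1-p≤1 : 1ℚ - p ≤ 1ℚ
      1-p≤1 = 1-a≤1 0≤p

      1≤inverse : ∀ {a b} → 0ℚ < b → b ≤ 1ℚ → a * b ≡ 1ℚ → 1ℚ ≤ a
      1≤inverse {a} {b} 0<b b≤1 ab≡1 = *-cancelˡ b 0<b (begin
        b * 1ℚ   ≡⟨ *-identityʳ b ⟩
        b        ≤⟨ b≤1 ⟩
        1ℚ       ≡⟨ trans (sym ab≡1) (*-comm a b) ⟩
        b * a    ∎)
        where open ≤-Reasoning

      1≤s : 1ℚ ≤ s
      1≤s = 1≤inverse 0<1-p 1-p≤1 s*[1-p]≡1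
      1≤t : 1ℚ ≤ t
      1≤t = 1≤inverse 0<p p≤1 t*p≡1
      0≤s = ≤-trans (nonNegative⁻¹ 1ℚ) 1≤s
      0≤t = ≤-trans (nonNegative⁻¹ 1ℚ) 1≤t

      C : ℚ
      C = (ι 8 * s * t) ^ 4

    open Slice {p} {n} {k} 0≤p p≤1 pn≡k
    open SliceAverage {p} {n} {k} 0<p p≤1 pn≡k

    0<k : 0 ℕ.< k
    0<k = ℕₚ.n≢0⇒n>0 (λ { refl → <-irrefl refl (subst (0ℚ <_) pn≡k (*->0 0<p 0<n)) })

    [1-p]n≡n-k : (1ℚ - p) * ι n ≡ ι (n ∸ k)
    [1-p]n≡n-k = begin
      (1ℚ - p) * ι n        ≡⟨ solve 2 (λ p n → (con 1ℚ :- p) :* n := n :- p :* n) refl p (ι n) ⟩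
      ι n - p * ι n         ≡⟨ cong₂ _-_ (trans (cong ι (sym (ℕₚ.m∸n+n≡m k≤n))) (ι-+ (n ∸ k) k)) pn≡k ⟩
      ι (n ∸ k) + ι k - ι k ≡⟨ solve 2 (λ a b → a :+ b :- b := a) refl (ι (n ∸ k)) (ι k) ⟩
      ι (n ∸ k)             ∎
      where open ≡-Reasoning

    0<n∸k : 0 ℕ.< n ∸ k
    0<n∸k = ℕₚ.n≢0⇒n>0 (λ eq → <-irrefl refl (subst (0ℚ <_) (trans [1-p]n≡n-k (cong ι eq)) (*->0 0<1-p 0<n)))

    private
      8st = ι 8 * s * t

      -- The origin of the 8 in `C`: the base r / 8 is half of the bias r / 4 from `power-lower`,
      -- and its inverse 8a is at most 8st. The fourth power in `C` is the 4 of j ≤ 4d.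
      size-bound : ∀ {r a d} j → 0ℚ ≤ r → r ≤ 1ℚ → a * r ≡ 1ℚ → 0ℚ ≤ a → a ≤ s * t → j ℕ.≤ 4 ℕ.* d →
        N * (½ * (½ * (½ * r))) ^ j ≤ 1ℚ → N ≤ C ^ d
      size-bound {r} {a} {d} j 0≤r r≤1 ar≡1 0≤a a≤st j≤4d h = begin
        N                    ≤⟨ divide-power (4 ℕ.* d) 0≤8a 8a*y≡1 (≤-trans (*-monoˡ N (<⇒≤ N>0) (^-antitone 0≤y y≤1 j≤4d)) h) ⟩
        1ℚ * (ι 8 * a) ^ (4 ℕ.* d)   ≡⟨ *-identityˡ _ ⟩
        (ι 8 * a) ^ (4 ℕ.* d)   ≤⟨ ^-mono (4 ℕ.* d) 0≤8a (subst (ι 8 * a ≤_) (sym (*-assoc (ι 8) s t)) (*-monoˡ (ι 8) (ι-≥0 8) a≤st)) ⟩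
        8st ^ (4 ℕ.* d)      ≡⟨ sym (^-assocʳ 8st 4 d) ⟩
        C ^ d                ∎
        where
        open ≤-Reasoning
        y = ½ * (½ * (½ * r))
        0≤8a : 0ℚ ≤ ι 8 * a
        0≤8a = *-≥0 (ι-≥0 8) 0≤a
        8a*y≡1 : ι 8 * a * y ≡ 1ℚ
        8a*y≡1 = trans (solve 2 (λ a r → con (ι 8) :* a :* (con ½ :* (con ½ :* (con ½ :* r))) := a :* r) refl a r) ar≡1
        0≤y : 0ℚ ≤ y
        0≤y = ½*a≥0 (½*a≥0 (½*a≥0 0≤r))
        y≤1 : y ≤ 1ℚ
        y≤1 = ½*a≤1 (½*a≥0 (½*a≥0 0≤r)) (½*a≤1 (½*a≥0 0≤r) (½*a≤1 0≤r r≤1))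

      few-ones : ∀ {d} → k ℕ.≤ 4 ℕ.* d → N ≤ C ^ d
      few-ones {d} k≤4d = size-bound {p} {t} {d} k 0≤p p≤1 t*p≡1 0≤t
        (subst (_≤ s * t) (*-identityˡ t) (*-monoʳ t 0≤t 1≤s)) k≤4d (begin
          N * (½ * v) ^ k                      ≤⟨ *-monoˡ N (<⇒≤ N>0) (power-lower {p} {n} k {{ℕ.>-nonZero 0<k}} 0≤p p≤1 0<n pn≡k) ⟩
          N * (v ^ k * (1ℚ - v) ^ n)           ≤⟨ *-monoˡ N (<⇒≤ N>0) (*-monoˡ (v ^ k) (^-≥0 k 0≤v) (^-antitone (0≤1-a v≤1) (1-a≤1 0≤v) (ℕₚ.m∸n≤m n k))) ⟩
          N * (v ^ k * (1ℚ - v) ^ (n ∸ k))     ≤⟨ slice-mass n k 0≤v v≤1 ⟩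
          1ℚ                                   ∎)
        where
        open ≤-Reasoning
        v = ½ * (½ * p)
        0≤v : 0ℚ ≤ v
        0≤v = ½*a≥0 (½*a≥0 0≤p)
        v≤1 = ½*a≤1 (½*a≥0 0≤p) (½*a≤1 0≤p p≤1)

      -- The mirror image of `few-ones`: zeros and ones trade places, so the slice is measured under
      -- bias 1 - v with v = (1 - p) / 4.
      few-zeros : ∀ {d} → n ∸ k ℕ.≤ 4 ℕ.* d → N ≤ C ^ d
      few-zeros {d} n∸k≤4d = size-bound {1ℚ - p} {s} {d} (n ∸ k) 0≤1-p 1-p≤1 s*[1-p]≡1 0≤s
        (subst (_≤ s * t) (*-identityʳ s) (*-monoˡ s 0≤s 1≤t)) n∸k≤4d (begin
          N * (½ * v) ^ (n ∸ k)                             ≤⟨ *-monoˡ N (<⇒≤ N>0) (power-lower {1ℚ - p} {n} (n ∸ k) {{ℕ.>-nonZero 0<n∸k}} 0≤1-p 1-p≤1 0<n [1-p]n≡n-k) ⟩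
          N * (v ^ (n ∸ k) * (1ℚ - v) ^ n)                  ≤⟨ *-monoˡ N (<⇒≤ N>0) (*-monoˡ (v ^ (n ∸ k)) (^-≥0 (n ∸ k) 0≤v) (^-antitone (0≤1-a v≤1) (1-a≤1 0≤v) k≤n)) ⟩
          N * (v ^ (n ∸ k) * (1ℚ - v) ^ k)                  ≡⟨ cong (N *_) (trans (*-comm (v ^ (n ∸ k)) ((1ℚ - v) ^ k)) (cong (λ z → (1ℚ - v) ^ k * z ^ (n ∸ k)) (solve 1 (λ v → v := con 1ℚ :- (con 1ℚ :- v)) refl v))) ⟩
          N * ((1ℚ - v) ^ k * (1ℚ - (1ℚ - v)) ^ (n ∸ k))    ≤⟨ slice-mass n k (0≤1-a v≤1) (1-a≤1 0≤v) ⟩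
          1ℚ                                                ∎)
        where
        open ≤-Reasoning
        v = ½ * (½ * (1ℚ - p))
        0≤v : 0ℚ ≤ v
        0≤v = ½*a≥0 (½*a≥0 0≤1-p)
        v≤1 = ½*a≤1 (½*a≥0 0≤1-p) (½*a≤1 0≤1-p 1-p≤1)

    -- The moment inequality multiplied by N², so that no division is left. The factor 4⁴ is the 1/4
    -- of Markov's inequality after taking fourth powers.
    Bound : ℕ → (Subset n → ℚ) → Set
    Bound d F = N * ∑ (λ x → δ k ∣ x ∣ * F x ^ 4) ≤ ι 4 ^ 4 * C ^ d * ∑ (λ x → δ k ∣ x ∣ * F x ^ 2) ^ 2

    small-slice : ∀ {d} F → k ℕ.≤ 4 ℕ.* d ⊎ n ∸ k ℕ.≤ 4 ℕ.* d → Bound d F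
    small-slice {d} F small = begin
      N * ∑ (λ x → δ k ∣ x ∣ * F x ^ 4)   ≤⟨ *-mono (∑-≥0 (λ x → *-≥0 (δ-≥0 k ∣ x ∣) (a^4≥0 (F x)))) 0≤M N≤M (fourth-≤-second k F) ⟩
      ι 4 ^ 4 * C ^ d * ∑ (λ x → δ k ∣ x ∣ * F x ^ 2) ^ 2 ∎
      where
      open ≤-Reasoning
      N≤C^d : N ≤ C ^ d
      N≤C^d = [ few-ones {d} , few-zeros {d} ]′ small
      0≤C^d = ≤-trans (<⇒≤ N>0) N≤C^d
      N≤M : N ≤ ι 4 ^ 4 * C ^ d
      N≤M = ≤-trans N≤C^d (subst (_≤ ι 4 ^ 4 * C ^ d) (*-identityˡ (C ^ d)) (*-monoʳ (C ^ d) 0≤C^d (ι-mono {1} {256} (s≤s z≤n))))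
      0≤M : 0ℚ ≤ ι 4 ^ 4 * C ^ d
      0≤M = ≤-trans (<⇒≤ N>0) N≤M

    -- The fourth moment passes to the biased bits, Bonami's inequality bounds it by the second
    -- moment there, and that moment passes back to the slice. The losses (1/2)^d, to the fourth
    -- power, and β^d, squared, stay on the left until the end and are then inverted together.
    large-slice : ∀ {d} (c : Subset n → ℚ) → Homogeneous d c → 4 ℕ.* d ℕ.≤ k → 4 ℕ.* d ℕ.+ k ℕ.≤ n → Bound d (poly c)
    large-slice {d} c hom 4d≤k 4d+k≤n = begin
      N * A₄                                ≤⟨ divide-power d (*-≥0 (ι-≥0 16) (a^2≥0 (ι 2 * s))) inverse scaled ⟩
      ι 4 ^ 4 * K ^ d * A₂ ^ 2 * (ι 16 * (ι 2 * s) ^ 2) ^ d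
        ≡⟨ solve 4 (λ a k f x → a :* k :* f :* x := a :* (k :* x) :* f) refl (ι 4 ^ 4) (K ^ d) (A₂ ^ 2) ((ι 16 * (ι 2 * s) ^ 2) ^ d) ⟩
      ι 4 ^ 4 * (K ^ d * (ι 16 * (ι 2 * s) ^ 2) ^ d) * A₂ ^ 2
        ≡⟨ cong (λ z → ι 4 ^ 4 * z * A₂ ^ 2) (sym (^-distrib-* K (ι 16 * (ι 2 * s) ^ 2) d)) ⟩
      ι 4 ^ 4 * (K * (ι 16 * (ι 2 * s) ^ 2)) ^ d * A₂ ^ 2
        ≤⟨ *-monoʳ (A₂ ^ 2) (a^2≥0 A₂) (*-monoˡ (ι 4 ^ 4) (a^4≥0 (ι 4)) (^-mono d (*-≥0 (a^2≥0 (ι 4 * t)) (*-≥0 (ι-≥0 16) (a^2≥0 (ι 2 * s)))) constants)) ⟩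
      ι 4 ^ 4 * C ^ d * A₂ ^ 2              ∎
      where
      open ≤-Reasoning
      u = ½ * p
      β = ½ * (1ℚ - p)
      K = (ι 4 * t) ^ 2
      A₄ = ∑ (λ x → δ k ∣ x ∣ * poly c x ^ 4)
      A₂ = ∑ (λ x → δ k ∣ x ∣ * poly c x ^ 2)
      E₄ = 𝔼ᵤ u (λ x → poly c x ^ 4)
      E₂ = 𝔼ᵤ u (λ x → poly c x ^ 2)
      0≤u : 0ℚ ≤ u
      0≤u = ½*a≥0 0≤p
      u≤1 : u ≤ 1ℚ
      u≤1 = ½*a≤1 0≤p p≤1
      0≤β : 0ℚ ≤ β
      0≤β = ½*a≥0 0≤1-p
      0≤A₄ : 0ℚ ≤ A₄
      0≤A₄ = ∑-≥0 (λ x → *-≥0 (δ-≥0 k ∣ x ∣) (a^4≥0 (poly c x)))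
      0≤E₂ : 0ℚ ≤ E₂
      0≤E₂ = ∑-≥0 (λ x → *-≥0 (weight-≥0 n ∣ x ∣ 0≤u u≤1) (a^2≥0 (poly c x)))
      d<k : d ℕ.< k
      d<k = 4*m≤n⇒m<n d 0<k 4d≤k
      4≤4t : ι 4 ≤ ι 4 * t
      4≤4t = *-monoˡ {1ℚ} {t} (ι 4) (ι-≥0 4) 1≤t
      -- With tp = 1 the right side equals 8t - 4, which is at least 4. The solver proves only ring
      -- identities, so a multiple of tp - 1 is added as a zero.
      3≤16t²σ : ι 3 ≤ K * (u * (1ℚ - u))
      3≤16t²σ = ≤-trans {ι 3} {ι 4} (ι-mono {3} {4} (s≤s (s≤s (s≤s z≤n)))) (0≤q-p⇒p≤q (subst (0ℚ ≤_)
        (trans (cong (λ z → ι 8 * (t - 1ℚ) + z) (trans (sym (*-zeroˡ (ι 8 * t - ι 4 * (t * p) - ι 4))) (cong (_* (ι 8 * t - ι 4 * (t * p) - ι 4)) (trans (sym (+-inverseʳ 1ℚ)) (cong (_- 1ℚ) (sym t*p≡1))))))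
          (solve 2 (λ t p → con (ι 8) :* (t :- con 1ℚ) :+ (t :* p :- con 1ℚ) :* (con (ι 8) :* t :- con (ι 4) :* (t :* p) :- con (ι 4))
             := (con (ι 4) :* t) :^ 2 :* ((con ½ :* p) :* (con 1ℚ :- con ½ :* p)) :- con (ι 4)) refl t p))
        (+-≥0 {ι 8 * (t - 1ℚ)} {0ℚ} (*-≥0 (ι-≥0 8) (p≤q⇒0≤q-p 1≤t)) ≤-refl)))
      inverse : ι 16 * (ι 2 * s) ^ 2 * (½ ^ 4 * β ^ 2) ≡ 1ℚ
      inverse = trans (solve 2 (λ s q → con (ι 16) :* (con (ι 2) :* s) :^ 2 :* (con ½ :^ 4 :* (con ½ :* q) :^ 2) := (s :* q) :^ 2) refl s (1ℚ - p))
        (cong (_^ 2) s*[1-p]≡1)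
      fourth : (½ ^ d) ^ 4 * A₄ ≤ ι 4 ^ 4 * (N * (K ^ d * E₂ ^ 2))
      fourth = begin
        (½ ^ d) ^ 4 * A₄                          ≤⟨ *-monoʳ A₄ 0≤A₄ (^-mono 4 (^-≥0 d 0≤½) (τ-lower d d<k 4d≤k)) ⟩
        (ι 4 * τ d) ^ 4 * A₄                      ≡⟨ solve 2 (λ t a → (con (ι 4) :* t) :^ 4 :* a := con (ι 4) :^ 4 :* (t :^ 4 :* a)) refl (τ d) A₄ ⟩
        ι 4 ^ 4 * (τ d ^ 4 * A₄)                  ≤⟨ *-monoˡ (ι 4 ^ 4) (a^4≥0 (ι 4)) (slice-fourth c hom) ⟩
        ι 4 ^ 4 * (N * E₄)                        ≤⟨ *-monoˡ (ι 4 ^ 4) (a^4≥0 (ι 4)) (*-monoˡ N (<⇒≤ N>0) (hypercontractive {u} {ι 4 * t} 0≤u u≤1 4≤4t 3≤16t²σ d c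
                                                       (λ S d<|S| → hom S (λ eq → ℕₚ.<-irrefl (sym eq) d<|S|)))) ⟩
        ι 4 ^ 4 * (N * (K ^ d * E₂ ^ 2))          ∎
      scaled : N * A₄ * (½ ^ 4 * β ^ 2) ^ d ≤ ι 4 ^ 4 * K ^ d * A₂ ^ 2
      scaled = begin
        N * A₄ * (½ ^ 4 * β ^ 2) ^ d              ≡⟨ cong (N * A₄ *_) (trans (^-distrib-* (½ ^ 4) (β ^ 2) d) (cong₂ _*_ (^-swap ½ 4 d) (^-swap β 2 d))) ⟩
        N * A₄ * ((½ ^ d) ^ 4 * (β ^ d) ^ 2)      ≡⟨ solve 4 (λ n a h b → n :* a :* (h :* b) := n :* b :* (h :* a)) refl N A₄ ((½ ^ d) ^ 4) ((β ^ d) ^ 2) ⟩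
        N * (β ^ d) ^ 2 * ((½ ^ d) ^ 4 * A₄)      ≤⟨ *-monoˡ (N * (β ^ d) ^ 2) (*-≥0 (<⇒≤ N>0) (a^2≥0 (β ^ d))) fourth ⟩
        N * (β ^ d) ^ 2 * (ι 4 ^ 4 * (N * (K ^ d * E₂ ^ 2)))
          ≡⟨ solve 5 (λ n b a k e → n :* b :^ 2 :* (a :* (n :* (k :* e :^ 2))) := a :* k :* (n :* b :* e) :^ 2) refl N (β ^ d) (ι 4 ^ 4) (K ^ d) E₂ ⟩
        ι 4 ^ 4 * K ^ d * (N * β ^ d * E₂) ^ 2
          ≤⟨ *-monoˡ (ι 4 ^ 4 * K ^ d) (*-≥0 (a^4≥0 (ι 4)) (^-≥0 d (a^2≥0 (ι 4 * t)))) (^-mono 2 (*-≥0 (*-≥0 (<⇒≤ N>0) (^-≥0 d 0≤β)) 0≤E₂) (slice-dominates c hom 4d≤k 4d+k≤n)) ⟩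
        ι 4 ^ 4 * K ^ d * A₂ ^ 2 ∎
      -- The cost per degree is 16 (8st)², while `C` is (8st)⁴; the gap is closed by st ≥ 1.
      constants : K * (ι 16 * (ι 2 * s) ^ 2) ≤ C
      constants = begin
        K * (ι 16 * (ι 2 * s) ^ 2)      ≡⟨ solve 2 (λ s t → (con (ι 4) :* t) :^ 2 :* (con (ι 16) :* (con (ι 2) :* s) :^ 2) := con (ι 16) :* con 1ℚ :* (con (ι 8) :* s :* t) :^ 2) refl s t ⟩
        ι 16 * 1ℚ * 8st ^ 2             ≤⟨ *-monoʳ (8st ^ 2) (a^2≥0 8st) (*-mono {ι 16} {ι 64} {1ℚ} {(s * t) ^ 2} (nonNegative⁻¹ 1ℚ) (ι-≥0 64) (ι-mono {16} {64} (ℕₚ.m≤m+n 16 48))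
                                             (^-mono 2 (nonNegative⁻¹ 1ℚ) (*-mono {1ℚ} {s} {1ℚ} {t} (nonNegative⁻¹ 1ℚ) 0≤s 1≤s 1≤t))) ⟩
        ι 64 * (s * t) ^ 2 * 8st ^ 2    ≡⟨ solve 2 (λ s t → con (ι 64) :* (s :* t) :^ 2 :* (con (ι 8) :* s :* t) :^ 2 := (con (ι 8) :* s :* t) :^ 4) refl s t ⟩
        C                               ∎

  -- From multilinear polynomials in xᵢ = ±1 to homogeneous polynomials in eᵢ

  module _ {n k d : ℕ} (d≤k : d ℕ.≤ k) (c : Subset n → ℚ) (deg : ∀ S → d ℕ.< ∣ S ∣ → c S ≡ 0ℚ) where

    private
      -- The reciprocal of the number of T with S ⊆ T ⊆ x and |T| = d, where S ⊆ x and |x| = k: each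
      -- e_S with |S| ≤ d is counted that many times in the sum of the e_T over T ⊇ S.
      r : Subset n → ℚ
      r S = inv (B d (k ∸ ∣ S ∣) ∣ S ∣)

    -- On the slice, each e_S is a multiple of the sum of the e_T with T ⊇ S and |T| = d.
    homogenise : Subset n → ℚ
    homogenise T = δ d ∣ T ∣ * ∑ (λ S → c S * r S * e S T)

    homogenise-homogeneous : Homogeneous d homogenise
    homogenise-homogeneous T |T|≢d = trans (cong (_* σ) (δ-off (≢-sym |T|≢d))) (*-zeroˡ σ)
      where
      σ = ∑ (λ S → c S * r S * e S T)

    poly-homogenise : ∀ x → k ≡ ∣ x ∣ → poly homogenise x ≡ poly c x
    poly-homogenise x k≡|x| = begin
      ∑ (λ T → δ d ∣ T ∣ * ∑ (λ S → c S * r S * e S T) * e T x)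
        ≡⟨ ∑-cong (λ T → trans (trans (solve 3 (λ d s e → d :* s :* e := e :* d :* s) refl (δ d ∣ T ∣) (∑ (λ S → c S * r S * e S T)) (e T x))
             (sym (∑-*ˡ (e T x * δ d ∣ T ∣) (λ S → c S * r S * e S T))))
             (∑-cong (λ S → solve 3 (λ a b e → a :* (b :* e) := b :* (e :* a)) refl (e T x * δ d ∣ T ∣) (c S * r S) (e S T)))) ⟩
      ∑ (λ T → ∑ (λ S → c S * r S * (e S T * (e T x * δ d ∣ T ∣))))
        ≡⟨ ∑-swap (λ T S → c S * r S * (e S T * (e T x * δ d ∣ T ∣))) ⟩
      ∑ (λ S → ∑ (λ T → c S * r S * (e S T * (e T x * δ d ∣ T ∣))))
        ≡⟨ ∑-cong (λ S → trans (∑-*ˡ (c S * r S) (λ T → e S T * (e T x * δ d ∣ T ∣)))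
             (trans (cong (c S * r S *_) (∑-between (δ d) S x)) (cancel S))) ⟩
      ∑ (λ S → c S * e S x) ∎
      where
      open ≡-Reasoning
      cancel : ∀ S → c S * r S * (e S x * B d ((∣ x ∣) ∸ ∣ S ∣) (∣ S ∣)) ≡ c S * e S x
      cancel S rewrite sym k≡|x| with ∣ S ∣ ℕ.≤? d
      ... | no  |S|≰d rewrite deg S (ℕₚ.≰⇒> |S|≰d) =
        solve 3 (λ r e b → con 0ℚ :* r :* (e :* b) := con 0ℚ :* e) refl (r S) (e S x) (B d (k ∸ ∣ S ∣) (∣ S ∣))
      ... | yes |S|≤d = begin
        c S * r S * (e S x * b)      ≡⟨ solve 4 (λ c r e b → c :* r :* (e :* b) := c :* e :* (b :* r)) refl (c S) (r S) (e S x) b ⟩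
        c S * e S x * (b * r S)      ≡⟨ cong (c S * e S x *_) (*-invʳ (≢-sym (<⇒≢ b>0))) ⟩
        c S * e S x * 1ℚ             ≡⟨ *-identityʳ (c S * e S x) ⟩
        c S * e S x                  ∎
        where
        b = B d (k ∸ ∣ S ∣) (∣ S ∣)
        b>0 : 0ℚ < b
        b>0 = B->0 (k ∸ ∣ S ∣) (∣ S ∣) |S|≤d (subst (d ℕ.≤_) (sym (ℕₚ.m∸n+n≡m (ℕₚ.≤-trans |S|≤d d≤k))) d≤k)

  -- A point x of the cube is encoded by the set of its coordinates equal to −1.
  bit : Bool → ℚ
  bit false = 1ℚ
  bit true  = - 1ℚ

  χ : ∀ {n} → Subset n → Subset n → ℚ
  χ []          []      = 1ℚ
  χ (true ∷ S)  (b ∷ x) = bit b * χ S x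
  χ (false ∷ S) (b ∷ x) = χ S x

  poly± : ∀ {n} → (Subset n → ℚ) → Subset n → ℚ
  poly± a x = ∑ (λ S → a S * χ S x)

  -- The substitution xᵢ = 1 − 2 eᵢ.
  indicatorCoefficients : ∀ {n} → (Subset n → ℚ) → Subset n → ℚ
  indicatorCoefficients a []          = a []
  indicatorCoefficients a (false ∷ S) = indicatorCoefficients (λ T → a (false ∷ T) + a (true ∷ T)) S
  indicatorCoefficients a (true ∷ S)  = indicatorCoefficients (λ T → - ι 2 * a (true ∷ T)) S

  indicatorCoefficients-degree : ∀ {n} d (a : Subset n → ℚ) → (∀ S → d ℕ.< ∣ S ∣ → a S ≡ 0ℚ) →
    ∀ S → d ℕ.< ∣ S ∣ → indicatorCoefficients a S ≡ 0ℚ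
  indicatorCoefficients-degree d a deg [] d< = deg [] d<
  indicatorCoefficients-degree d a deg (false ∷ S) d< = indicatorCoefficients-degree d _
    (λ T d<|T| → cong₂ _+_ (deg (false ∷ T) d<|T|) (deg (true ∷ T) (ℕₚ.m<n⇒m<1+n d<|T|))) S d<
  indicatorCoefficients-degree zero a deg (true ∷ S) _ = vanish _
    (λ T → trans (cong (- ι 2 *_) (deg (true ∷ T) (s≤s z≤n))) (*-zeroʳ (- ι 2))) S
    where
    vanish : ∀ {n} (a : Subset n → ℚ) → (∀ T → a T ≡ 0ℚ) → ∀ S → indicatorCoefficients a S ≡ 0ℚ
    vanish a h []          = h []
    vanish a h (false ∷ S) = vanish _ (λ T → cong₂ _+_ (h (false ∷ T)) (h (true ∷ T))) S
    vanish a h (true ∷ S)  = vanish _ (λ T → trans (cong (- ι 2 *_) (h (true ∷ T))) (*-zeroʳ (- ι 2))) S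
  indicatorCoefficients-degree (suc d) a deg (true ∷ S) (s≤s d<) = indicatorCoefficients-degree d _
    (λ T d<|T| → trans (cong (- ι 2 *_) (deg (true ∷ T) (s≤s d<|T|))) (*-zeroʳ (- ι 2))) S d<

  poly-indicatorCoefficients : ∀ {n} (a : Subset n → ℚ) x → poly (indicatorCoefficients a) x ≡ poly± a x
  poly-indicatorCoefficients {zero}  a [] = refl
  poly-indicatorCoefficients {suc n} a (false ∷ x) = begin
    poly (indicatorCoefficients a) (false ∷ x)          ≡⟨ poly-false (indicatorCoefficients a) x ⟩
    poly (indicatorCoefficients (λ T → a (false ∷ T) + a (true ∷ T))) x
      ≡⟨ poly-indicatorCoefficients (λ T → a (false ∷ T) + a (true ∷ T)) x ⟩
    ∑ (λ S → (a (false ∷ S) + a (true ∷ S)) * χ S x)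
      ≡⟨ ∑-cong (λ S → solve 3 (λ a b c → (a :+ b) :* c := a :* c :+ b :* (con 1ℚ :* c)) refl (a (false ∷ S)) (a (true ∷ S)) (χ S x)) ⟩
    ∑ (λ S → a (false ∷ S) * χ S x + a (true ∷ S) * (1ℚ * χ S x))
      ≡⟨ ∑-+ (λ S → a (false ∷ S) * χ S x) (λ S → a (true ∷ S) * (1ℚ * χ S x)) ⟩
    poly± a (false ∷ x) ∎
    where open ≡-Reasoning
  poly-indicatorCoefficients {suc n} a (true ∷ x) = begin
    poly (indicatorCoefficients (λ T → a (false ∷ T) + a (true ∷ T))) x + poly (indicatorCoefficients (λ T → - ι 2 * a (true ∷ T))) x
      ≡⟨ cong₂ _+_ (poly-indicatorCoefficients (λ T → a (false ∷ T) + a (true ∷ T)) x) (poly-indicatorCoefficients (λ T → - ι 2 * a (true ∷ T)) x) ⟩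
    ∑ (λ S → (a (false ∷ S) + a (true ∷ S)) * χ S x) + ∑ (λ S → - ι 2 * a (true ∷ S) * χ S x)
      ≡⟨ sym (∑-+ (λ S → (a (false ∷ S) + a (true ∷ S)) * χ S x) (λ S → - ι 2 * a (true ∷ S) * χ S x)) ⟩
    ∑ (λ S → (a (false ∷ S) + a (true ∷ S)) * χ S x + - ι 2 * a (true ∷ S) * χ S x)
      ≡⟨ ∑-cong (λ S → solve 3 (λ a b c → (a :+ b) :* c :+ con (- ι 2) :* b :* c := a :* c :+ b :* (con (- 1ℚ) :* c)) refl (a (false ∷ S)) (a (true ∷ S)) (χ S x)) ⟩
    ∑ (λ S → a (false ∷ S) * χ S x + a (true ∷ S) * (- 1ℚ * χ S x))
      ≡⟨ ∑-+ (λ S → a (false ∷ S) * χ S x) (λ S → a (true ∷ S) * (- 1ℚ * χ S x)) ⟩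
    poly± a (true ∷ x) ∎
    where open ≡-Reasoning

  -- The moment inequality on the slice for rational coefficients

  module _ {p s t : ℚ} {n k : ℕ} (0<p : 0ℚ < p) (p<1 : p < 1ℚ) (s*[1-p]≡1 : s * (1ℚ - p) ≡ 1ℚ) (t*p≡1 : t * p ≡ 1ℚ)
    (0<n : 0ℚ < ι n) (pn≡k : p * ι n ≡ ι k) where

    open SliceBound {p} {s} {t} {n} {k} 0<p p<1 s*[1-p]≡1 t*p≡1 0<n pn≡k
    open Slice {p} {n} {k} (<⇒≤ 0<p) (<⇒≤ p<1) pn≡k

    slice-moments : ∀ d (a : Subset n → ℚ) → (∀ S → d ℕ.< ∣ S ∣ → a S ≡ 0ℚ) → Bound d (poly± a)
    slice-moments d a deg with k ℕ.≤? 4 ℕ.* d | n ∸ k ℕ.≤? 4 ℕ.* d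
    ... | yes k≤4d | _           = small-slice {d} (poly± a) (inj₁ k≤4d)
    ... | no  _    | yes n∸k≤4d  = small-slice {d} (poly± a) (inj₂ n∸k≤4d)
    ... | no  k≰4d | no  n∸k≰4d  = subst₂ (λ A₄ A₂ → B k n 0 * A₄ ≤ ι 4 ^ 4 * ((ι 8 * s * t) ^ 4) ^ d * A₂ ^ 2) (moment 4) (moment 2)
      (large-slice (homogenise d≤k c deg-c) (homogenise-homogeneous d≤k c deg-c) 4d≤k 4d+k≤n)
      where
      c : Subset n → ℚ
      c = indicatorCoefficients a
      deg-c = indicatorCoefficients-degree d a deg
      4d≤k : 4 ℕ.* d ℕ.≤ k
      4d≤k = ℕₚ.<⇒≤ (ℕₚ.≰⇒> k≰4d)
      d≤k : d ℕ.≤ k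
      d≤k = ℕₚ.<⇒≤ (4*m≤n⇒m<n d 0<k 4d≤k)
      4d+k≤n : 4 ℕ.* d ℕ.+ k ℕ.≤ n
      4d+k≤n = subst (4 ℕ.* d ℕ.+ k ℕ.≤_) (ℕₚ.m∸n+n≡m k≤n) (ℕₚ.+-monoˡ-≤ k (ℕₚ.<⇒≤ (ℕₚ.≰⇒> n∸k≰4d)))
      moment : ∀ j → ∑ (λ x → δ k ∣ x ∣ * poly (homogenise d≤k c deg-c) x ^ j) ≡ ∑ (λ x → δ k ∣ x ∣ * poly± a x ^ j)
      moment j = ∑-cong (λ x → δ-cong {k} {∣ x ∣} (λ k≡|x| → cong (_^ j)
        (trans (poly-homogenise d≤k c deg-c x k≡|x|) (poly-indicatorCoefficients a x))))

    slice-mean-moments : ∀ d (a : Subset n → ℚ) → (∀ S → d ℕ.< ∣ S ∣ → a S ≡ 0ℚ) → let M = inv (B k n 0) in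
      M * ∑ (λ x → δ k ∣ x ∣ * poly± a x ^ 4) ≤ ι 4 ^ 4 * ((ι 8 * s * t) ^ 4) ^ d * (M * ∑ (λ x → δ k ∣ x ∣ * poly± a x ^ 2)) ^ 2
    slice-mean-moments d a deg = begin
      -- A factor N M = 1 is inserted; the correction term with 1 - N M keeps this a ring identity
      -- until N M is rewritten.
      M * A₄                    ≡⟨ solve 3 (λ m a u → m :* a := m :* (u :* a) :+ m :* a :* (con 1ℚ :- u)) refl M A₄ (B k n 0 * M) ⟩
      M * (B k n 0 * M * A₄) + M * A₄ * (1ℚ - B k n 0 * M)
                                ≡⟨ cong (λ u → M * (B k n 0 * M * A₄) + M * A₄ * (1ℚ - u)) NM≡1 ⟩
      M * (B k n 0 * M * A₄) + M * A₄ * (1ℚ - 1ℚ)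
                                ≡⟨ solve 3 (λ m n a → m :* (n :* m :* a) :+ m :* a :* (con 1ℚ :- con 1ℚ) := m :* m :* (n :* a)) refl M (B k n 0) A₄ ⟩
      M * M * (B k n 0 * A₄)    ≤⟨ *-monoˡ (M * M) (a*a≥0 M) (slice-moments d a deg) ⟩
      M * M * (K * A₂ ^ 2)      ≡⟨ solve 3 (λ m k a → m :* m :* (k :* a :^ 2) := k :* (m :* a) :^ 2) refl M K A₂ ⟩
      K * (M * A₂) ^ 2          ∎
      where
      open ≤-Reasoning
      M = inv (B k n 0)
      K = ι 4 ^ 4 * ((ι 8 * s * t) ^ 4) ^ d
      A₄ = ∑ (λ x → δ k ∣ x ∣ * poly± a x ^ 4)
      A₂ = ∑ (λ x → δ k ∣ x ∣ * poly± a x ^ 2)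
      NM≡1 : B k n 0 * M ≡ 1ℚ
      NM≡1 = *-invʳ (≢-sym (<⇒≢ N>0))

  -- Naturals as fractions

  /1≡ι : ∀ m → ℤ.+ m ℚ./ 1 ≡ ι m
  /1≡ι zero    = refl
  /1≡ι (suc m) = trans (toℚᵘ-injective (ℚᵘₚ.≃-trans (toℚᵘ-fromℚᵘ (ℚᵘ.mkℚᵘ (ℤ.+ suc m) 0))
    (ℚᵘₚ.≃-trans (ℚᵘ.*≡* step) (ℚᵘₚ.≃-sym (ℚᵘₚ.≃-trans (toℚᵘ-homo-+ 1ℚ (ℤ.+ m ℚ./ 1))
      (ℚᵘₚ.+-congʳ (ℚ.toℚᵘ 1ℚ) (toℚᵘ-fromℚᵘ (ℚᵘ.mkℚᵘ (ℤ.+ m) 0))))))))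
    (cong (1ℚ +_) (/1≡ι m))
    where
    step : ℤ.+ suc m ℤ.* ℤ.+ 1 ≡ (ℤ.+ 1 ℤ.* ℤ.+ 1 ℤ.+ ℤ.+ m ℤ.* ℤ.+ 1) ℤ.* ℤ.+ 1
    step = cong (ℤ._* ℤ.+ 1) (sym (cong (λ z → ℤ.+ 1 ℤ.+ z) (ℤₚ.*-identityʳ (ℤ.+ m))))

  1/≡inv : ∀ l → ℤ.+ 1 ℚ./ suc l ≡ inv (ι (suc l))
  1/≡inv l = begin
    q                                  ≡⟨ sym (*-identityʳ q) ⟩
    q * 1ℚ                             ≡⟨ cong (q *_) (sym (*-invʳ ι≢0)) ⟩
    q * (ι (suc l) * inv (ι (suc l)))  ≡⟨ sym (*-assoc q (ι (suc l)) _) ⟩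
    q * ι (suc l) * inv (ι (suc l))    ≡⟨ cong (_* inv (ι (suc l))) (trans (cong (q *_) (sym (/1≡ι (suc l)))) unit) ⟩
    1ℚ * inv (ι (suc l))               ≡⟨ *-identityˡ _ ⟩
    inv (ι (suc l))                    ∎
    where
    open ≡-Reasoning
    q = ℤ.+ 1 ℚ./ suc l
    ι≢0 : ι (suc l) ≢ 0ℚ
    ι≢0 = ≢-sym (<⇒≢ (ι->0 l))
    unit : q * (ℤ.+ suc l ℚ./ 1) ≡ 1ℚ
    unit = toℚᵘ-injective (ℚᵘₚ.≃-trans (toℚᵘ-homo-* q (ℤ.+ suc l ℚ./ 1))
      (ℚᵘₚ.≃-trans (ℚᵘₚ.*-cong (toℚᵘ-fromℚᵘ (ℚᵘ.mkℚᵘ (ℤ.+ 1) l)) (toℚᵘ-fromℚᵘ (ℚᵘ.mkℚᵘ (ℤ.+ suc l) 0)))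
        (ℚᵘ.*≡* (cong (ℤ.+_) (cong suc step)))))
      where
      step : (l ℕ.+ 0) ℕ.* 1 ≡ l ℕ.* 1 ℕ.+ 0
      step = trans (ℕₚ.*-identityʳ (l ℕ.+ 0)) (cong (ℕ._+ 0) (sym (ℕₚ.*-identityʳ l)))

  -- Sums over lists

  sumᴸ : ∀ {A : Set} → List A → (A → ℚ) → ℚ
  sumᴸ xs F = foldr (λ x r → F x + r) 0ℚ xs

  module _ {A : Set} where

    sumᴸ-++ : ∀ (xs ys : List A) F → sumᴸ (xs ++ ys) F ≡ sumᴸ xs F + sumᴸ ys F
    sumᴸ-++ []       ys F = sym (+-identityˡ _)
    sumᴸ-++ (x ∷ xs) ys F = trans (cong (F x +_) (sumᴸ-++ xs ys F)) (sym (+-assoc (F x) _ _))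

    sumᴸ-map : ∀ {B : Set} (g : A → B) xs F → sumᴸ (List.map g xs) F ≡ sumᴸ xs (F ∘ g)
    sumᴸ-map g []       F = refl
    sumᴸ-map g (x ∷ xs) F = cong (F (g x) +_) (sumᴸ-map g xs F)

    sumᴸ-filter : ∀ {P : A → Set} (P? : Decidable P) (w : A → ℚ) → (∀ x → P x → w x ≡ 1ℚ) → (∀ x → ¬ P x → w x ≡ 0ℚ) →
      ∀ xs F → sumᴸ (filter P? xs) F ≡ sumᴸ xs (λ x → w x * F x)
    sumᴸ-filter P? w w≡1 w≡0 []       F = refl
    sumᴸ-filter P? w w≡1 w≡0 (x ∷ xs) F with P? x
    ... | yes Px = cong₂ _+_ (trans (sym (*-identityˡ (F x))) (cong (_* F x) (sym (w≡1 x Px)))) (sumᴸ-filter P? w w≡1 w≡0 xs F)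
    ... | no ¬Px = trans (sumᴸ-filter P? w w≡1 w≡0 xs F) (trans (sym (+-identityˡ _))
      (cong (_+ sumᴸ xs (λ x → w x * F x)) (trans (sym (*-zeroˡ (F x))) (cong (_* F x) (sym (w≡0 x ¬Px))))))

    sumᴸ-length : ∀ (xs : List A) → ι (length xs) ≡ sumᴸ xs (λ _ → 1ℚ)
    sumᴸ-length []       = refl
    sumᴸ-length (x ∷ xs) = cong (1ℚ +_) (sumᴸ-length xs)

  -- Limits of sequences of rationals

  infix 4 _~_

  -- Equality of reals unfolds to this relation on their sequences; no Cauchy modulus has to be
  -- carried along.
  _~_ : (ℕ → ℚ) → (ℕ → ℚ) → Set
  x ~ y = ∀ ε → 0ℚ < ε → ∃[ N ] (∀ n → N ℕ.≤ n → ℚ.∣ x n - y n ∣ ≤ ε)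

  Bounded : (ℕ → ℚ) → Set
  Bounded x = ∃[ M ] ∃[ N ] (0ℚ < M × (∀ n → N ℕ.≤ n → ℚ.∣ x n ∣ ≤ M))

  ~-refl : ∀ {x} → x ~ x
  ~-refl {x} ε 0<ε = 0 , λ n _ → subst (λ z → ℚ.∣ z ∣ ≤ ε) (sym (+-inverseʳ (x n))) (<⇒≤ 0<ε)

  ~-sym : ∀ {x y} → x ~ y → y ~ x
  ~-sym {x} {y} x~y ε 0<ε with x~y ε 0<ε
  ... | N , h = N , λ n N≤n → subst (_≤ ε) (trans (sym (∣-p∣≡∣p∣ (x n - y n))) (cong ℚ.∣_∣ (swap (x n) (y n)))) (h n N≤n)
    where
    swap : ∀ a b → - (a - b) ≡ b - a
    swap = solve 2 (λ a b → :- (a :- b) := b :- a) refl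

  ~-+ : ∀ {x x′ y y′} → x ~ x′ → y ~ y′ → (λ n → x n + y n) ~ (λ n → x′ n + y′ n)
  ~-+ {x} {x′} {y} {y′} x~ y~ ε 0<ε with x~ (½ * ε) (*->0 (positive⁻¹ ½) 0<ε) | y~ (½ * ε) (*->0 (positive⁻¹ ½) 0<ε)
  ... | M , hx | N , hy = M ℕ.⊔ N , λ n ≤n → begin
    ℚ.∣ (x n + y n) - (x′ n + y′ n) ∣         ≡⟨ cong ℚ.∣_∣ (solve 4 (λ a b c d → (a :+ b) :- (c :+ d) := (a :- c) :+ (b :- d)) refl (x n) (y n) (x′ n) (y′ n)) ⟩
    ℚ.∣ (x n - x′ n) + (y n - y′ n) ∣         ≤⟨ ∣p+q∣≤∣p∣+∣q∣ (x n - x′ n) (y n - y′ n) ⟩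
    ℚ.∣ x n - x′ n ∣ + ℚ.∣ y n - y′ n ∣       ≤⟨ +-mono-≤ (hx n (ℕₚ.m⊔n≤o⇒m≤o M N ≤n)) (hy n (ℕₚ.m⊔n≤o⇒n≤o M N ≤n)) ⟩
    ½ * ε + ½ * ε                             ≡⟨ ½*a+½*a ε ⟩
    ε                                         ∎
    where open ≤-Reasoning

  ~-* : ∀ {x x′ y y′} → Bounded x → Bounded y′ → x ~ x′ → y ~ y′ → (λ n → x n * y n) ~ (λ n → x′ n * y′ n)
  ~-* {x} {x′} {y} {y′} (A , K , 0<A , |x|≤A) (D , L , 0<D , |y′|≤D) x~ y~ ε 0<ε = result
    where
    open ≤-Reasoning
    A+D = A + D
    0<A+D : 0ℚ < A+D
    0<A+D = +-mono-< 0<A 0<D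
    unit : A+D * inv A+D ≡ 1ℚ
    unit = *-invʳ (≢-sym (<⇒≢ 0<A+D))
    η = inv A+D * ε
    [A+D]η≡ε : A+D * η ≡ ε
    [A+D]η≡ε = trans (sym (*-assoc A+D (inv A+D) ε)) (trans (cong (_* ε) unit) (*-identityˡ ε))
    0<η : 0ℚ < η
    0<η = ≰⇒> (λ η≤0 → <-irrefl refl (<-≤-trans 0<ε (subst₂ _≤_ [A+D]η≡ε (*-zeroʳ A+D) (*-monoˡ A+D (<⇒≤ 0<A+D) η≤0))))
    ∣*∣ : ∀ a b {α β} → ℚ.∣ a ∣ ≤ α → ℚ.∣ b ∣ ≤ β → ℚ.∣ a * b ∣ ≤ α * β
    ∣*∣ a b {α} {β} a≤ b≤ = subst (_≤ α * β) (sym (∣p*q∣≡∣p∣*∣q∣ a b)) (*-mono (0≤∣p∣ b) (≤-trans (0≤∣p∣ a) a≤) a≤ b≤)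
    result : ∃[ N ] (∀ n → N ℕ.≤ n → ℚ.∣ x n * y n - x′ n * y′ n ∣ ≤ ε)
    result with x~ η 0<η | y~ η 0<η
    ... | M , hx | N , hy = (K ℕ.⊔ L) ℕ.⊔ (M ℕ.⊔ N) , λ n ≤n →
      let KL = ℕₚ.m⊔n≤o⇒m≤o (K ℕ.⊔ L) (M ℕ.⊔ N) ≤n
          MN = ℕₚ.m⊔n≤o⇒n≤o (K ℕ.⊔ L) (M ℕ.⊔ N) ≤n
      in begin
      ℚ.∣ x n * y n - x′ n * y′ n ∣
        ≡⟨ cong ℚ.∣_∣ (solve 4 (λ a b c d → a :* b :- c :* d := a :* (b :- d) :+ d :* (a :- c)) refl (x n) (y n) (x′ n) (y′ n)) ⟩
      ℚ.∣ x n * (y n - y′ n) + y′ n * (x n - x′ n) ∣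
        ≤⟨ ∣p+q∣≤∣p∣+∣q∣ (x n * (y n - y′ n)) (y′ n * (x n - x′ n)) ⟩
      ℚ.∣ x n * (y n - y′ n) ∣ + ℚ.∣ y′ n * (x n - x′ n) ∣
        ≤⟨ +-mono-≤ (∣*∣ (x n) (y n - y′ n) (|x|≤A n (ℕₚ.m⊔n≤o⇒m≤o K L KL)) (hy n (ℕₚ.m⊔n≤o⇒n≤o M N MN)))
                    (∣*∣ (y′ n) (x n - x′ n) (|y′|≤D n (ℕₚ.m⊔n≤o⇒n≤o K L KL)) (hx n (ℕₚ.m⊔n≤o⇒m≤o M N MN))) ⟩
      A * η + D * η            ≡⟨ sym (*-distribʳ-+ η A D) ⟩
      A+D * η                  ≡⟨ [A+D]η≡ε ⟩
      ε                        ∎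

  ≤-close : ∀ a b {η} → ℚ.∣ a - b ∣ ≤ η → a ≤ b + η
  ≤-close a b {η} h = begin
    a                      ≡⟨ solve 2 (λ a b → a := b :+ (a :- b)) refl a b ⟩
    b + (a - b)            ≤⟨ +-monoʳ-≤ b (≤-trans (p≤∣p∣ (a - b)) h) ⟩
    b + η                  ∎
    where
    open ≤-Reasoning
    p≤∣p∣ : ∀ p → p ≤ ℚ.∣ p ∣
    p≤∣p∣ p with ≤-total 0ℚ p
    ... | inj₁ 0≤p = ≤-reflexive (sym (0≤p⇒∣p∣≡p 0≤p))
    ... | inj₂ p≤0 = ≤-trans p≤0 (0≤∣p∣ p)

  ~-≤-~ : ∀ {x x′ y y′} → x ~ x′ → (∀ n → x′ n ≤ y′ n) → y′ ~ y →
    ∀ ε → 0ℚ < ε → ∃[ N ] (∀ n → N ℕ.≤ n → x n ≤ y n + ε)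
  ~-≤-~ {x} {x′} {y} {y′} x~ x′≤y′ y~ ε 0<ε with x~ (½ * ε) (*->0 (positive⁻¹ ½) 0<ε) | y~ (½ * ε) (*->0 (positive⁻¹ ½) 0<ε)
  ... | M , hx | N , hy = M ℕ.⊔ N , λ n ≤n → begin
    x n                      ≤⟨ ≤-close (x n) (x′ n) (hx n (ℕₚ.m⊔n≤o⇒m≤o M N ≤n)) ⟩
    x′ n + ½ * ε             ≤⟨ +-monoˡ-≤ (½ * ε) (≤-trans (x′≤y′ n) (≤-close (y′ n) (y n) (hy n (ℕₚ.m⊔n≤o⇒n≤o M N ≤n)))) ⟩
    y n + ½ * ε + ½ * ε      ≡⟨ trans (+-assoc (y n) (½ * ε) (½ * ε)) (cong (y n +_) (½*a+½*a ε)) ⟩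
    y n + ε                  ∎
    where open ≤-Reasoning

open import Algebra.Bundles using (CommutativeRing)
import Algebra.Properties.CommutativeSemiring.Exp
open import Data.Bool using (Bool; true; false)
open import Data.Fin.Subset using (Subset; ∣_∣)
open import Data.Integer using (ℤ; +_; -[1+_])
open import Data.List using (List; []; _∷_; _++_; map; length)
open import Data.Nat as ℕ using (ℕ; zero; suc; NonZero)
import Data.Nat.Properties as ℕₚ
open import Data.Product using (Σ-syntax; _,_)
open import Data.Rational as ℚ using (ℚ; 0ℚ; 1ℚ; positive)
import Data.Rational.Properties as ℚₚ
open import Data.Rational.Solver using (module +-*-Solver)
open import Data.Sign using (Sign)
open import Data.Vec as Vec using (Vec; []; _∷_)
open import Data.Vec.Properties using (map-id)
open import Defs
open import Function using (_∘_; id)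
open import Relation.Binary.PropositionalEquality using (_≡_; refl; sym; trans; cong; cong₂; subst; subst₂; module ≡-Reasoning)
open import Relation.Nullary using (yes; no; contradiction; ¬_)
open Algebra.Properties.CommutativeSemiring.Exp (CommutativeRing.commutativeSemiring ℚₚ.+-*-commutativeRing) using () renaming (_^_ to _^ℚ_)
open +-*-Solver using (solve; con; _:+_; _:*_; _:-_; _:^_; _:=_)
open RationalSlice

-- Evaluation of the real quantities along representing sequences

seq-sumℝ : ∀ {A : Set} (xs : List A) g m → seq (sumℝ (map g xs)) m ≡ sumᴸ xs (λ x → seq (g x) m)
seq-sumℝ []       g m = refl
seq-sumℝ (x ∷ xs) g m = cong (seq (g x) m ℚ.+_) (seq-sumℝ xs g m)

seq-^ : ∀ x d m → seq (x ^ d) m ≡ seq x m ^ℚ d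
seq-^ x zero    m = refl
seq-^ x (suc d) m = cong (seq x m ℚ.*_) (seq-^ x d m)

-- The length is written as a sum of ones so that it is evaluated on the slice like every other sum.
-- For the empty list the convention `inv 0ℚ = 0ℚ` agrees with the mean.
seq-mean : ∀ {A : Set} (xs : List A) g m →
  seq (mean xs g) m ≡ inv (sumᴸ xs (λ _ → 1ℚ)) ℚ.* sumᴸ xs (λ x → seq (g x) m)
seq-mean []          g m = refl
seq-mean xs@(_ ∷ ys) g m = cong₂ ℚ._*_
  (trans (1/≡inv (length ys)) (cong inv (sumᴸ-length xs))) (seq-sumℝ xs g m)

-- Serves both enumerations: `subsets` with φ the identity and `cube` with φ = `sign`, as `outside`
-- and +1 are listed first.
sumᴸ-vectors : ∀ {A : Set} (φ : Bool → A) n F →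
  sumᴸ (vectors (φ false ∷ φ true ∷ []) n) F ≡ ∑ (λ (x : Subset n) → F (Vec.map φ x))
sumᴸ-vectors φ zero    F = ℚₚ.+-identityʳ (F [])
sumᴸ-vectors {A} φ (suc n) F = begin
  sumᴸ (map (φ false ∷_) vs ++ (map (φ true ∷_) vs ++ [])) F
    ≡⟨ sumᴸ-++ (map (φ false ∷_) vs) (map (φ true ∷_) vs ++ []) F ⟩
  sumᴸ (map (φ false ∷_) vs) F ℚ.+ sumᴸ (map (φ true ∷_) vs ++ []) F
    ≡⟨ cong₂ ℚ._+_ (half false) (trans (sumᴸ-++ (map (φ true ∷_) vs) [] F) (trans (ℚₚ.+-identityʳ _) (half true))) ⟩
  ∑ (λ x → F (Vec.map φ (false ∷ x))) ℚ.+ ∑ (λ x → F (Vec.map φ (true ∷ x))) ∎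
  where
  open ≡-Reasoning
  vs : List (Vec A n)
  vs = vectors (φ false ∷ φ true ∷ []) n
  half : ∀ b → sumᴸ (map (φ b ∷_) vs) F ≡ ∑ (λ x → F (Vec.map φ (b ∷ x)))
  half b = trans (sumᴸ-map (φ b ∷_) vs F) (sumᴸ-vectors φ n (λ x → F (φ b ∷ x)))

sign : Bool → Sign
sign false = Sign.+
sign true  = Sign.-

signs : ∀ {n} → Subset n → Vec Sign n
signs = Vec.map sign

reals : ∀ {n} → Vec Sign n → Vec ℝ n
reals = Vec.map (λ s → fromℚ (±1 s))

seq-monomial : ∀ {n} (S x : Subset n) m → seq (monomial S (reals (signs x))) m ≡ χ S x
seq-monomial []          []          m = refl
seq-monomial (true ∷ S)  (false ∷ x) m = cong (1ℚ ℚ.*_) (seq-monomial S x m)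
seq-monomial (true ∷ S)  (true ∷ x)  m = cong (ℚ.- 1ℚ ℚ.*_) (seq-monomial S x m)
seq-monomial (false ∷ S) (_ ∷ x)     m = seq-monomial S x m

seq-evalML : ∀ {n} (f : Multilinear n) (x : Subset n) m →
  seq (evalML f (reals (signs x))) m ≡ poly± (λ S → seq (f S) m) x
seq-evalML {n} f x m = trans (seq-sumℝ (subsets n) (λ S → f S * monomial S (reals (signs x))) m)
  (trans (sumᴸ-vectors id n (λ S → seq (f S) m ℚ.* seq (monomial S (reals (signs x))) m))
    (∑-cong (λ S → trans (cong (λ T → seq (f T) m ℚ.* seq (monomial T (reals (signs x))) m) (map-id S))
      (cong (seq (f S) m ℚ.*_) (seq-monomial S x m)))))

negatives : ∀ {n} → Vec Sign n → ℕ
negatives []            = 0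
negatives (Sign.+ ∷ x)  = negatives x
negatives (Sign.- ∷ x)  = suc (negatives x)

negatives-signs : ∀ {n} (x : Subset n) → negatives (signs x) ≡ ∣ x ∣
negatives-signs []          = refl
negatives-signs (false ∷ x) = negatives-signs x
negatives-signs (true ∷ x)  = cong suc (negatives-signs x)

coordinateSum-negatives : ∀ {n} (x : Vec Sign n) → coordinateSum x ≡ ι n ℚ.- ι 2 ℚ.* ι (negatives x)
coordinateSum-negatives []                   = refl
coordinateSum-negatives {suc n} (Sign.+ ∷ x) = trans (cong (1ℚ ℚ.+_) (coordinateSum-negatives x))
  (solve 2 (λ n k → con 1ℚ :+ (n :- con (ι 2) :* k) := (con 1ℚ :+ n) :- con (ι 2) :* k) refl (ι n) (ι (negatives x)))
coordinateSum-negatives {suc n} (Sign.- ∷ x) = trans (cong (ℚ.- 1ℚ ℚ.+_) (coordinateSum-negatives x))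
  (solve 2 (λ n k → con (ℚ.- 1ℚ) :+ (n :- con (ι 2) :* k) := (con 1ℚ :+ n) :- con (ι 2) :* (con 1ℚ :+ k)) refl (ι n) (ι (negatives x)))

module _ {p n k} (pn≡k : p ℚ.* ι n ≡ ι k) where

  private
    Σ-slice : ℚ
    Σ-slice = (1ℚ ℚ.- (+ 2 ℚ./ 1) ℚ.* p) ℚ.* (+ n ℚ./ 1)

    Σ-slice≡ : Σ-slice ≡ ι n ℚ.- ι 2 ℚ.* ι k
    Σ-slice≡ = trans (cong (λ z → (1ℚ ℚ.- (+ 2 ℚ./ 1) ℚ.* p) ℚ.* z) (/1≡ι n))
      (trans (solve 2 (λ p n → (con 1ℚ :- con (ι 2) :* p) :* n := n :- con (ι 2) :* (p :* n)) refl p (ι n))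
        (cong (λ z → ι n ℚ.- ι 2 ℚ.* z) pn≡k))

    on-slice : ∀ (x : Vec Sign n) → coordinateSum x ≡ Σ-slice → k ≡ negatives x
    on-slice x eq = ι-injective (sym (begin
      ι j                                                 ≡⟨ recover (ι n) (ι j) ⟩
      ℚ.½ ℚ.* (ι n ℚ.- (ι n ℚ.- ι 2 ℚ.* ι j))             ≡⟨ cong (λ z → ℚ.½ ℚ.* (ι n ℚ.- z)) (trans (sym (coordinateSum-negatives x)) (trans eq Σ-slice≡)) ⟩
      ℚ.½ ℚ.* (ι n ℚ.- (ι n ℚ.- ι 2 ℚ.* ι k))             ≡⟨ sym (recover (ι n) (ι k)) ⟩
      ι k                                                 ∎))
      where
      open ≡-Reasoning
      j = negatives x
      recover : ∀ n j → j ≡ ℚ.½ ℚ.* (n ℚ.- (n ℚ.- ι 2 ℚ.* j))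
      recover = solve 2 (λ n j → j := con ℚ.½ :* (n :- (n :- con (ι 2) :* j))) refl

    off-slice : ∀ (x : Vec Sign n) → ¬ (coordinateSum x ≡ Σ-slice) → ¬ (k ≡ negatives x)
    off-slice x ne refl = ne (trans (coordinateSum-negatives x) (sym Σ-slice≡))

  sumᴸ-slice : ∀ F → sumᴸ (slice p n) F ≡ ∑ (λ (x : Subset n) → δ k ∣ x ∣ ℚ.* F (signs x))
  sumᴸ-slice F = trans
    (sumᴸ-filter (λ x → coordinateSum x ℚₚ.≟ Σ-slice) (λ x → δ k (negatives x))
      (λ x eq → trans (cong (δ k) (sym (on-slice x eq))) (δ-diag k)) (λ x ne → δ-off (off-slice x ne)) (cube n) F)
    (trans (sumᴸ-vectors sign n (λ x → δ k (negatives x) ℚ.* F x))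
      (∑-cong (λ x → cong (λ j → δ k j ℚ.* F (signs x)) (negatives-signs x))))

  seq-𝔼 : ∀ (g : Vec ℝ n → ℝ) m →
    seq (𝔼 p g) m ≡ inv (B k n 0) ℚ.* ∑ (λ (x : Subset n) → δ k ∣ x ∣ ℚ.* seq (g (reals (signs x))) m)
  seq-𝔼 g m = trans (seq-mean (slice p n) (λ x → g (reals x)) m) (cong₂ ℚ._*_
    (cong inv (trans (sumᴸ-slice (λ _ → 1ℚ)) (trans (∑-cong {n} (λ x → ℚₚ.*-identityʳ (δ k ∣ x ∣))) (∑-size n (δ k)))))
    (sumᴸ-slice (λ x → seq (g (reals x)) m)))

  seq-𝔼-evalML : ∀ (f : Multilinear n) j m → seq (𝔼 p (λ x → evalML f x ^ j)) m
    ≡ inv (B k n 0) ℚ.* ∑ (λ (x : Subset n) → δ k ∣ x ∣ ℚ.* poly± (λ S → seq (f S) m) x ^ℚ j)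
  seq-𝔼-evalML f j m = trans (seq-𝔼 (λ x → evalML f x ^ j) m)
    (cong (inv (B k n 0) ℚ.*_) (∑-cong (λ x → cong (δ k ∣ x ∣ ℚ.*_)
      (trans (seq-^ (evalML f (reals (signs x))) j m) (cong (_^ℚ j) (seq-evalML f x m))))))

-- Congruence of the real operations

bounded : ∀ x → Bounded (seq x)
bounded x with cauchy x 1ℚ (ℚₚ.positive⁻¹ 1ℚ)
... | N , h = 1ℚ ℚ.+ ℚ.∣ a ∣ , N , ℚₚ.+-mono-<-≤ (ℚₚ.positive⁻¹ 1ℚ) (ℚₚ.0≤∣p∣ a) , λ n N≤n → begin
  ℚ.∣ seq x n ∣                     ≡⟨ cong ℚ.∣_∣ (solve 2 (λ a b → a := (a :- b) :+ b) refl (seq x n) a) ⟩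
  ℚ.∣ seq x n ℚ.- a ℚ.+ a ∣         ≤⟨ ℚₚ.∣p+q∣≤∣p∣+∣q∣ (seq x n ℚ.- a) a ⟩
  ℚ.∣ seq x n ℚ.- a ∣ ℚ.+ ℚ.∣ a ∣   ≤⟨ ℚₚ.+-monoˡ-≤ ℚ.∣ a ∣ (h n N N≤n ℕₚ.≤-refl) ⟩
  1ℚ ℚ.+ ℚ.∣ a ∣                    ∎
  where
  open ℚₚ.≤-Reasoning
  a = seq x N

≃-refl : ∀ x → x ≃ x
≃-refl x = ~-refl {seq x}

+-cong : ∀ {x x′ y y′} → x ≃ x′ → y ≃ y′ → x + y ≃ x′ + y′
+-cong {x} {x′} {y} {y′} = ~-+ {seq x} {seq x′} {seq y} {seq y′}

*-cong : ∀ {x x′ y y′} → x ≃ x′ → y ≃ y′ → x * y ≃ x′ * y′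
*-cong {x} {x′} {y} {y′} = ~-* {seq x} {seq x′} {seq y} {seq y′} (bounded x) (bounded y′)

^-cong : ∀ {x x′} n → x ≃ x′ → x ^ n ≃ x′ ^ n
^-cong zero    eq = ≃-refl 1ℝ
^-cong {x} {x′} (suc n) eq = *-cong {x} {x′} {x ^ n} {x′ ^ n} eq (^-cong {x} {x′} n eq)

sumℝ-cong : ∀ {A : Set} (xs : List A) {g g′ : A → ℝ} → (∀ x → g x ≃ g′ x) → sumℝ (map g xs) ≃ sumℝ (map g′ xs)
sumℝ-cong []       eq = ≃-refl 0ℝ
sumℝ-cong (x ∷ xs) {g} {g′} eq = +-cong {g x} {g′ x} {sumℝ (map g xs)} {sumℝ (map g′ xs)} (eq x) (sumℝ-cong xs {g} {g′} eq)

mean-cong : ∀ {A : Set} (xs : List A) {g g′ : A → ℝ} → (∀ x → g x ≃ g′ x) → mean xs g ≃ mean xs g′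
mean-cong []          eq = ≃-refl 0ℝ
mean-cong xs@(_ ∷ ys) {g} {g′} eq = *-cong {r} {r} {sumℝ (map g xs)} {sumℝ (map g′ xs)} (≃-refl r) (sumℝ-cong xs {g} {g′} eq)
  where r = fromℚ (+ 1 ℚ./ suc (length ys))

evalML-cong : ∀ {n} {f g : Multilinear n} → (∀ S → f S ≃ g S) → ∀ x → evalML f x ≃ evalML g x
evalML-cong {n} {f} {g} eq x = sumℝ-cong (subsets n) {λ S → f S * monomial S x} {λ S → g S * monomial S x}
  (λ S → *-cong {f S} {g S} {monomial S x} {monomial S x} (eq S) (≃-refl (monomial S x)))

𝔼-cong : ∀ p {n} {g g′ : Vec ℝ n → ℝ} → (∀ v → g v ≃ g′ v) → 𝔼 p g ≃ 𝔼 p g′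
𝔼-cong p {n} {g} {g′} eq = mean-cong (slice p n) {λ x → g (reals x)} {λ x → g′ (reals x)} (λ x → eq (reals x))

moment-cong : ∀ p {n} {f g : Multilinear n} j → (∀ S → f S ≃ g S) → 𝔼 p (λ x → evalML f x ^ j) ≃ 𝔼 p (λ x → evalML g x ^ j)
moment-cong p {n} {f} {g} j eq = 𝔼-cong p {g = λ x → evalML f x ^ j} {λ x → evalML g x ^ j}
  (λ x → ^-cong {evalML f x} {evalML g x} j (evalML-cong {f = f} {g} eq x))

-- The degree hypothesis says only that the high coefficients converge to 0, whereas the rational
-- inequality at index m needs their m-th terms to be exactly 0. Hence the passage to an equal
-- polynomial with literal zeros.
truncate : ∀ {n} → ℕ → Multilinear n → Multilinear n
truncate d f S with d ℕ.<? ∣ S ∣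
... | yes _ = 0ℝ
... | no  _ = f S

truncate-≃ : ∀ {n} d (f : Multilinear n) → DegreeAtMost d f → ∀ S → f S ≃ truncate d f S
truncate-≃ d f deg S with d ℕ.<? ∣ S ∣
... | yes d<|S| = deg S d<|S|
... | no  _     = ≃-refl (f S)

truncate-degree : ∀ {n} d (f : Multilinear n) m (S : Subset n) → d ℕ.< ∣ S ∣ → seq (truncate d f S) m ≡ 0ℚ
truncate-degree d f m S d<|S| with d ℕ.<? ∣ S ∣
... | yes _   = refl
... | no  d≮  = contradiction d<|S| d≮

-- The absolute polynomials and the passage to real coefficients

P₀ : Poly₁
P₀ = fromℚ (ι 4 ^ℚ 4) ∷ []

-- R₀(s, t) = 8⁴ s⁴ t⁴
R₀ : Poly₂
R₀ = [] ∷ [] ∷ [] ∷ [] ∷ (0ℝ ∷ 0ℝ ∷ 0ℝ ∷ 0ℝ ∷ fromℚ (ι 8 ^ℚ 4) ∷ []) ∷ []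

seq-P₀ : ∀ x m → seq (eval₁ P₀ x) m ≡ ι 4 ^ℚ 4
seq-P₀ x m = solve 1 (λ x → con (ι 4 ^ℚ 4) :+ x :* con 0ℚ := con (ι 4 ^ℚ 4)) refl (seq x m)

seq-R₀ : ∀ s t m → seq (eval₂ R₀ (fromℚ s) (fromℚ t)) m ≡ (ι 8 ℚ.* s ℚ.* t) ^ℚ 4
seq-R₀ s t m = solve 2 (λ s t →
  con 0ℚ :+ s :* (con 0ℚ :+ s :* (con 0ℚ :+ s :* (con 0ℚ :+ s :*
    ((con 0ℚ :+ t :* (con 0ℚ :+ t :* (con 0ℚ :+ t :* (con 0ℚ :+ t :* (con (ι 8 ^ℚ 4) :+ t :* con 0ℚ)))))
      :+ s :* con 0ℚ))))
  := (con (ι 8) :* s :* t) :^ 4) refl s t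

positive-numerator : ∀ {q} (k : ℤ) → 0ℚ ℚ.< q → q ≡ k ℚ./ 1 → Σ[ j ∈ ℕ ] q ≡ ι j
positive-numerator (+ j)    0<q eq = j , trans eq (/1≡ι j)
positive-numerator -[1+ j ] 0<q eq = contradiction (subst (0ℚ ℚ.<_) (trans eq (cong ℚ.-_ (/1≡ι (suc j)))) 0<q)
  (λ 0<-ι → ℚₚ.<-asym 0<-ι (ℚₚ.neg-antimono-< (ι->0 j)))

≤-from-approximations : ∀ {x x′ y y′} → x ≃ x′ → y ≃ y′ → (∀ m → seq x′ m ℚ.≤ seq y′ m) → x ≤ y
≤-from-approximations {x} {x′} {y} {y′} x≃x′ y≃y′ le =
  ~-≤-~ {seq x} {seq x′} {seq y} {seq y′} x≃x′ le (~-sym {seq y} {seq y′} y≃y′)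

module _ (p : ℚ) (0<p : 0ℚ ℚ.< p) (p<1 : p ℚ.< 1ℚ) where

  private
    0<1-p : 0ℚ ℚ.< 1ℚ ℚ.- p
    0<1-p = subst (ℚ._< 1ℚ ℚ.- p) (ℚₚ.+-inverseʳ p) (ℚₚ.+-monoˡ-< (ℚ.- p) p<1)
    s t : ℚ
    s = (ℚ.1/ (1ℚ ℚ.- p)) {{ℚₚ.pos⇒nonZero (1ℚ ℚ.- p) {{positive 0<1-p}}}}
    t = (ℚ.1/ p) {{ℚₚ.pos⇒nonZero p {{positive 0<p}}}}

  seq-C : ∀ m → seq (C R₀ p 0<p p<1) m ≡ (ι 8 ℚ.* s ℚ.* t) ^ℚ 4
  seq-C m = seq-R₀ s t m

  seq-bound : ∀ d a m → seq (eval₁ P₀ (fromℕ d) * C R₀ p 0<p p<1 ^ d * a ^ 2) m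
    ≡ ι 4 ^ℚ 4 ℚ.* ((ι 8 ℚ.* s ℚ.* t) ^ℚ 4) ^ℚ d ℚ.* seq a m ^ℚ 2
  seq-bound d a m = cong (λ z → z ℚ.* seq a m ^ℚ 2) (cong₂ ℚ._*_ (seq-P₀ (fromℕ d) m)
    (trans (seq-^ (C R₀ p 0<p p<1) d m) (cong (_^ℚ d) (seq-C m))))

  -- The rational inequality holds at each index m, without slack. The slack in the order of the
  -- reals is spent only on replacing f by its truncation.
  moment-bound : ∀ {n k} → 0ℚ ℚ.< ι n → p ℚ.* ι n ≡ ι k → ∀ d (g : Multilinear n) →
    (∀ m S → d ℕ.< ∣ S ∣ → seq (g S) m ≡ 0ℚ) → ∀ m →
    seq (𝔼 p (λ x → evalML g x ^ 4)) m ℚ.≤ seq (eval₁ P₀ (fromℕ d) * C R₀ p 0<p p<1 ^ d * 𝔼 p (λ x → evalML g x ^ 2) ^ 2) m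
  moment-bound {n} {k} 0<n pn≡k d g deg m = subst₂ ℚ._≤_ (sym (seq-𝔼-evalML {p} {n} {k} pn≡k g 4 m))
    (sym (trans (seq-bound d (𝔼 p (λ x → evalML g x ^ 2)) m)
      (cong (λ z → ι 4 ^ℚ 4 ℚ.* ((ι 8 ℚ.* s ℚ.* t) ^ℚ 4) ^ℚ d ℚ.* z ^ℚ 2) (seq-𝔼-evalML {p} {n} {k} pn≡k g 2 m))))
    (slice-mean-moments {p} {s} {t} {n} {k} 0<p p<1
      (ℚₚ.*-inverseˡ (1ℚ ℚ.- p) {{ℚₚ.pos⇒nonZero (1ℚ ℚ.- p) {{positive 0<1-p}}}})
      (ℚₚ.*-inverseˡ p {{ℚₚ.pos⇒nonZero p {{positive 0<p}}}})
      0<n pn≡k d (λ S → seq (g S) m) (deg m))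

bound-from-approximations : ∀ {a a′ b b′} K → a ≃ a′ → b ≃ b′ →
  (∀ m → seq a′ m ℚ.≤ seq (K * b′ ^ 2) m) → a ≤ K * b ^ 2
bound-from-approximations {a} {a′} {b} {b′} K a≃a′ b≃b′ = ≤-from-approximations {a} {a′} {K * b ^ 2} {K * b′ ^ 2} a≃a′
  (*-cong {K} {K} {b ^ 2} {b′ ^ 2} (≃-refl K) (^-cong {b} {b′} 2 b≃b′))

theorem1p2 : Σ[ P ∈ Poly₁ ] Σ[ R ∈ Poly₂ ]
    ((p : ℚ) (0<p : 0ℚ ℚ.< p) (p<1 : p ℚ.< 1ℚ)
    (n : ℕ) .{{_ : NonZero n}} →
    Σ[ k ∈ ℤ ] (p ℚ.* (+ n ℚ./ 1) ≡ k ℚ./ 1) →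
    (d : ℕ) (f : Multilinear n) → DegreeAtMost d f →
    𝔼 p (λ x → evalML f x ^ 4)
    ≤ eval₁ P (fromℕ d) * C R p 0<p p<1 ^ d * 𝔼 p (λ x → evalML f x ^ 2) ^ 2)
theorem1p2 = P₀ , R₀ , λ { p 0<p p<1 n@(suc n-1) (kᶻ , pn≡kᶻ) d f deg →
  let 0<n = ι->0 n-1
      pn≡k/1 = trans (cong (p ℚ.*_) (sym (/1≡ι n))) pn≡kᶻ
      k , pn≡k = positive-numerator kᶻ (*->0 0<p 0<n) pn≡k/1
      f≃g = truncate-≃ d f deg
      g = truncate d f
  in bound-from-approximations
       {𝔼 p (λ x → evalML f x ^ 4)} {𝔼 p (λ x → evalML g x ^ 4)} {𝔼 p (λ x → evalML f x ^ 2)} {𝔼 p (λ x → evalML g x ^ 2)}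
       (eval₁ P₀ (fromℕ d) * C R₀ p 0<p p<1 ^ d)
       (moment-cong p {f = f} {g} 4 f≃g) (moment-cong p {f = f} {g} 2 f≃g)
       (moment-bound p 0<p p<1 {k = k} 0<n pn≡k d g (truncate-degree d f)) }
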